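{- For any $p\geq0$, there exists a polynomial $T_p(b,r_0,\ldots,r_{p+1})$, homogeneous of degree $2p$ in $r_0,\ldots,r_{p+1}$, such that for any integer $b\geq0$, $$\bar M^{(b)}_p(x_b,x_{b+1},\ldots)=\frac{(R^{(b)})^{1-b}}{(\partial_{x_b}R^{(b)})^{2p+1}}\,T_p\big(b,R^{(b)},\partial_{x_b}R^{(b)},\ldots,\partial_{x_b}^{p+1}R^{(b)}\big).$$
   Context: With $\mathrm{Cat}(\ell)=\frac1{\ell+1}\binom{2\ell}\ell$, let $$Z^{(b)}(r;x_{b+1},x_{b+2},\ldots)=r\mathbf 1_{\{b=0\}}-\sum_{\ell=0}^b(-1)^{b-\ell}\binom{b+\ell}{2\ell}\mathrm{Cat}(\ell)r^{b-\ell}-\sum_{j=b+1}^\infty\binom{2j-1}{j+b}x_jr^{b+j},$$ and let $R^{(b)}(x_b,x_{b+1},\ldots)$ be the unique formal power series with constant term $1$ satisfying $Z^{(b)}(R^{(b)};x_{b+1},\ldots)=x_b$. For $p\geq0$ let $Q_p(b,j)$ be the unique polynomial with $$\sum_{k=b}^{j-1}\binom{2k+1+p}{2p+1}\binom{2j-1}{j+k}=\binom{2j-1}{j+b}Q_p(b,j)\quad\text{for all integers }j>b\geq0$$ (it exists, has degree $p+1$ in $j$, and satisfies $Q_p(b,-b)=0$). The moments are $$\bar M_p^{(b)}(x_b,x_{b+1},\ldots)=Q_p(b,r\,\partial_r)\,r^{ -b}Z^{(b)}(r;x_{b+1},x_{b+2},\ldots)\Big|_{r=R^{(b)}(x_b,x_{b+1},\ldots)},$$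 where $Q_p(b,r\partial_r)$ is the differential operator obtained by replacing $j$ by $r\,\partial_r$, acting on $r^{ -b}Z^{(b)}$. -}

module Defs where

open import Algebra.Bundles.Raw using (RawMonoid; RawSemiring)
import Algebra.Definitions.RawMonoid as RawMonoidDefs
import Algebra.Definitions.RawSemiring as RawSemiringDefs
open import Data.Fin.Base using (toℕ)
open import Data.Integer.Base as ℤ using (ℤ; +_; -[1+_]; ∣_∣)
import Data.Integer.Properties as ℤₚ
open import Data.List.Base as List using (List; []; _∷_; _∷ʳ_; length)
import Data.List.Properties as Listₚ
open import Data.List.Relation.Unary.All using (All)
open import Data.Nat.Base as ℕ using (ℕ; zero; suc; z≤n; s≤s)
open import Data.Nat.Combinatorics using (_C_)
import Data.Nat.ListAction as ℕL
import Data.Nat.ListAction.Properties as ℕLₚ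
import Data.Nat.Properties as ℕₚ
open import Data.Product.Base using (_×_; _,_; proj₂)
open import Data.Rational.Base as ℚ using (ℚ; 0ℚ; 1ℚ)
import Data.Rational.Properties as ℚₚ
open import Data.Vec.Base as Vec using (Vec; []; _∷_)
open import Function.Base using (_∘_; id)
open import Level using (0ℓ)
open import Relation.Binary.PropositionalEquality
open import Relation.Nullary using (yes; no; contradiction)

------------------------------------------------------------------------

module FiniteSum (M : RawMonoid 0ℓ 0ℓ) where
  open RawMonoid M using (Carrier)

  ∑< : ℕ → (ℕ → Carrier) → Carrier
  ∑< n f = RawMonoidDefs.sum M {n} (f ∘ toℕ)

open FiniteSum ℚ.+-0-rawMonoid public
open RawSemiringDefs ℚ.+-*-rawSemiring public using () renaming (_^_ to _^ℚ_)

fromℤ : ℤ → ℚ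
fromℤ i = i ℚ./ 1

fromℕ : ℕ → ℚ
fromℕ n = fromℤ (+ n)

-- Total inverse on ℚ, with the convention 0⁻¹ = 0.
recip : ℚ → ℚ
recip q with q ℚₚ.≟ 0ℚ
... | yes _   = 0ℚ
... | no  q≢0 = ℚ.1/_ q {{ℚ.≢-nonZero q≢0}}

∑<-cong : ∀ n {f g} → (∀ i → f i ≡ g i) → ∑< n f ≡ ∑< n g
∑<-cong zero    f≡g = refl
∑<-cong (suc n) f≡g = cong₂ ℚ._+_ (f≡g 0) (∑<-cong n (f≡g ∘ suc))

∑<-indep : ∀ m n f → (∀ i → m ℕ.≤ i → f i ≡ 0ℚ) → (∀ i → n ℕ.≤ i → f i ≡ 0ℚ) →
           ∑< m f ≡ ∑< n f
∑<-indep zero    zero    f p q = refl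
∑<-indep zero    (suc n) f p q =
  trans (∑<-indep zero n (f ∘ suc) (λ i _ → p (suc i) z≤n) (λ i n≤i → q (suc i) (s≤s n≤i)))
        (trans (sym (ℚₚ.+-identityˡ _)) (cong (ℚ._+ ∑< n (f ∘ suc)) (sym (p 0 z≤n))))
∑<-indep (suc m) zero    f p q =
  trans (cong (ℚ._+ ∑< m (f ∘ suc)) (q 0 z≤n))
        (trans (ℚₚ.+-identityˡ _)
               (∑<-indep m zero (f ∘ suc) (λ i m≤i → p (suc i) (s≤s m≤i)) (λ i _ → q (suc i) z≤n)))
∑<-indep (suc m) (suc n) f p q =
  cong (f 0 ℚ.+_) (∑<-indep m n (f ∘ suc) (λ i m≤i → p (suc i) (s≤s m≤i)) (λ i n≤i → q (suc i) (s≤s n≤i)))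

∑<-zero : ∀ n f → (∀ i → f i ≡ 0ℚ) → ∑< n f ≡ 0ℚ
∑<-zero n f p = ∑<-indep n 0 f (λ i _ → p i) (λ i _ → p i)

------------------------------------------------------------------------
-- Formal power series over ℚ in countably many variables y₀, y₁, y₂, ...
--
-- A list (e₀ ∷ e₁ ∷ ... ∷ eₙ₋₁ ∷ []) stands for the monomial
-- y₀^e₀ y₁^e₁ ... yₙ₋₁^eₙ₋₁; lists that differ by trailing zeros stand for
-- the same monomial, hence the condition Stable.

Stable : (List ℕ → ℚ) → Set
Stable f = ∀ e → f (e ∷ʳ 0) ≡ f e

record FPS : Set where
  constructor mkFPS
  field
    coeff  : List ℕ → ℚ
    stable : Stable coeff

open FPS public

infix 4 _≈_
_≈_ : FPS → FPS → Set
f ≈ g = ∀ e → coeff f e ≡ coeff g e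

constCoeff : ℚ → List ℕ → ℚ
constCoeff q []          = q
constCoeff q (zero  ∷ e) = constCoeff q e
constCoeff q (suc _ ∷ e) = 0ℚ

constCoeff-stable : ∀ q → Stable (constCoeff q)
constCoeff-stable q []          = refl
constCoeff-stable q (zero  ∷ e) = constCoeff-stable q e
constCoeff-stable q (suc _ ∷ e) = refl

const : ℚ → FPS
const q = mkFPS (constCoeff q) (constCoeff-stable q)

varCoeff : ℕ → List ℕ → ℚ
varCoeff i       []                = 0ℚ
varCoeff zero    (zero        ∷ e) = 0ℚ
varCoeff zero    (suc zero    ∷ e) = constCoeff 1ℚ e
varCoeff zero    (suc (suc _) ∷ e) = 0ℚ
varCoeff (suc i) (zero        ∷ e) = varCoeff i e
varCoeff (suc i) (suc _       ∷ e) = 0ℚ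

varCoeff-stable : ∀ i → Stable (varCoeff i)
varCoeff-stable zero    []                = refl
varCoeff-stable (suc i) []                = refl
varCoeff-stable zero    (zero        ∷ e) = refl
varCoeff-stable zero    (suc zero    ∷ e) = constCoeff-stable 1ℚ e
varCoeff-stable zero    (suc (suc _) ∷ e) = refl
varCoeff-stable (suc i) (zero        ∷ e) = varCoeff-stable i e
varCoeff-stable (suc i) (suc _       ∷ e) = refl

var : ℕ → FPS
var i = mkFPS (varCoeff i) (varCoeff-stable i)

-- Cauchy product: the sum of f(d) g(d′) over all d + d′ = e.
conv : (List ℕ → ℚ) → (List ℕ → ℚ) → List ℕ → ℚ
conv f g []      = f [] ℚ.* g []
conv f g (n ∷ e) = ∑< (suc n) λ i → conv (λ d → f (i ∷ d)) (λ d → g ((n ℕ.∸ i) ∷ d)) e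

conv-stable : ∀ {f g} → Stable f → Stable g → Stable (conv f g)
conv-stable p q []      = trans (ℚₚ.+-identityʳ _) (cong₂ ℚ._*_ (p []) (q []))
conv-stable p q (n ∷ e) =
  ∑<-cong (suc n) λ i → conv-stable (λ d → p (i ∷ d)) (λ d → q ((n ℕ.∸ i) ∷ d)) e

infixl 6 _+_ _-_
infixl 7 _*_ _•_

_+_ : FPS → FPS → FPS
f + g = mkFPS (λ e → coeff f e ℚ.+ coeff g e) λ e → cong₂ ℚ._+_ (stable f e) (stable g e)

_-_ : FPS → FPS → FPS
f - g = mkFPS (λ e → coeff f e ℚ.- coeff g e) λ e → cong₂ ℚ._-_ (stable f e) (stable g e)

_•_ : ℚ → FPS → FPS
q • f = mkFPS (λ e → q ℚ.* coeff f e) λ e → cong (q ℚ.*_) (stable f e)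

_*_ : FPS → FPS → FPS
f * g = mkFPS (conv (coeff f) (coeff g)) (conv-stable (stable f) (stable g))

FPS-rawSemiring : RawSemiring 0ℓ 0ℓ
FPS-rawSemiring = record
  { Carrier = FPS ; _≈_ = _≈_ ; _+_ = _+_ ; _*_ = _*_ ; 0# = const 0ℚ ; 1# = const 1ℚ }

open RawSemiringDefs FPS-rawSemiring public using (_^_)

constantTerm : FPS → ℚ
constantTerm f = coeff f []

-- With c the constant term of f, f⁻¹ = c⁻¹ ∑ₙ (1 - c⁻¹ f)ⁿ.  As 1 - c⁻¹ f has
-- no constant term, only n ≤ (total degree of e) contribute at e.  This is the
-- inverse of f when c ≠ 0; otherwise f ⁻¹ = 0 by convention.
infix 9 _⁻¹
_⁻¹ : FPS → FPS
f ⁻¹ = mkFPS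
  (λ e → c⁻¹ ℚ.* ∑< (suc (ℕL.sum e)) (λ n → coeff (u ^ n) e))
  (λ e → cong (c⁻¹ ℚ.*_)
    (trans (cong (λ s → ∑< (suc s) (λ n → coeff (u ^ n) (e ∷ʳ 0)))
                 (trans (ℕLₚ.sum-++ e (0 ∷ [])) (ℕₚ.+-identityʳ _)))
           (∑<-cong (suc (ℕL.sum e)) (λ n → stable (u ^ n) e))))
  where
  c⁻¹ = recip (constantTerm f)
  u   = const 1ℚ - c⁻¹ • f

infixr 8 _^ᶻ_
_^ᶻ_ : FPS → ℤ → FPS
f ^ᶻ (+ n)    = f ^ n
f ^ᶻ -[1+ n ] = (f ⁻¹) ^ suc n

-- Partial derivative with respect to y₀.
∂Coeff : (List ℕ → ℚ) → List ℕ → ℚ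
∂Coeff f []      = fromℕ 1 ℚ.* f (1 ∷ [])
∂Coeff f (n ∷ e) = fromℕ (suc n) ℚ.* f (suc n ∷ e)

∂Coeff-stable : ∀ {f} → Stable f → Stable (∂Coeff f)
∂Coeff-stable p []      = refl
∂Coeff-stable p (n ∷ e) = cong (fromℕ (suc n) ℚ.*_) (p (suc n ∷ e))

∂ : FPS → FPS
∂ f = mkFPS (∂Coeff (coeff f)) (∂Coeff-stable (stable f))

∂^ : ℕ → FPS → FPS
∂^ zero    f = f
∂^ (suc n) f = ∂ (∂^ n f)

------------------------------------------------------------------------
-- Series ∑ₘ Fₘ rᵐ (m ∈ ℤ) in an extra variable r with coefficients Fₘ in FPS,
-- such that on setting all but finitely many of the yᵢ to zero only finitely
-- many powers of r remain.  This finiteness makes the substitution of an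
-- invertible power series for r well defined.

record Laurent : Set where
  constructor mkLaurent
  field
    at     : ℤ → FPS
    bound  : ℕ → ℕ
    vanish : ∀ m e → bound (length e) ℕ.< ∣ m ∣ → coeff (at m) e ≡ 0ℚ

open Laurent public

infix 4 _≈ᴸ_
_≈ᴸ_ : Laurent → Laurent → Set
F ≈ᴸ G = ∀ m → at F m ≈ at G m

constCoeff-0 : ∀ e → constCoeff 0ℚ e ≡ 0ℚ
constCoeff-0 []          = refl
constCoeff-0 (zero  ∷ e) = constCoeff-0 e
constCoeff-0 (suc _ ∷ e) = refl

varCoeff-short : ∀ i e → length e ℕ.≤ i → varCoeff i e ≡ 0ℚ
varCoeff-short i       []          _       = refl
varCoeff-short (suc i) (zero  ∷ e) (s≤s p) = varCoeff-short i e p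
varCoeff-short (suc i) (suc _ ∷ e) _       = refl

conv-vanish : ∀ f g e → (∀ d → length d ≡ length e → f d ≡ 0ℚ) → conv f g e ≡ 0ℚ
conv-vanish f g []      p = trans (cong (ℚ._* g []) (p [] refl)) (ℚₚ.*-zeroˡ (g []))
conv-vanish f g (n ∷ e) p = ∑<-zero (suc n) _ λ i →
  conv-vanish (λ d → f (i ∷ d)) (λ d → g ((n ℕ.∸ i) ∷ d)) e λ d eq → p (i ∷ d) (cong suc eq)

0ᴸ : Laurent
0ᴸ = mkLaurent (λ _ → const 0ℚ) (λ _ → 0) (λ _ e _ → constCoeff-0 e)

infixl 6 _+ᴸ_ _-ᴸ_
infixl 7 _•ᴸ_

_+ᴸ_ : Laurent → Laurent → Laurent
F +ᴸ G = mkLaurent (λ m → at F m + at G m) (λ n → bound F n ℕ.+ bound G n) λ m e lt →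
  cong₂ ℚ._+_ (vanish F m e (ℕₚ.≤-<-trans (ℕₚ.m≤m+n _ _) lt))
              (vanish G m e (ℕₚ.≤-<-trans (ℕₚ.m≤n+m _ _) lt))

_•ᴸ_ : ℚ → Laurent → Laurent
q •ᴸ F = mkLaurent (λ m → q • at F m) (bound F) λ m e lt →
  trans (cong (q ℚ.*_) (vanish F m e lt)) (ℚₚ.*-zeroʳ q)

_-ᴸ_ : Laurent → Laurent → Laurent
F -ᴸ G = F +ᴸ (ℚ.- 1ℚ) •ᴸ G

-- q rᵏ
monomialAt : ℚ → ℤ → ℤ → FPS
monomialAt q k m with m ℤₚ.≟ k
... | yes _ = const q
... | no  _ = const 0ℚ

monomial : ℚ → ℤ → Laurent
monomial q k = mkLaurent (monomialAt q k) (λ _ → ∣ k ∣) vanishes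
  where
  vanishes : ∀ m e → ∣ k ∣ ℕ.< ∣ m ∣ → coeff (monomialAt q k m) e ≡ 0ℚ
  vanishes m e lt with m ℤₚ.≟ k
  ... | yes refl = contradiction lt (ℕₚ.<-irrefl refl)
  ... | no  _    = constCoeff-0 e

r∂ᵣ : Laurent → Laurent
r∂ᵣ F = mkLaurent (λ m → fromℤ m • at F m) (bound F) λ m e lt →
  trans (cong (fromℤ m ℚ.*_) (vanish F m e lt)) (ℚₚ.*-zeroʳ (fromℤ m))

-- Multiplication by r⁻ᵏ.
r^-_·_ : ℕ → Laurent → Laurent
r^- k · F = mkLaurent (λ m → at F (m ℤ.+ + k)) (λ n → bound F n ℕ.+ k) λ m e lt →
  vanish F (m ℤ.+ + k) e (ℕₚ.+-cancelʳ-< k _ _ (ℕₚ.<-≤-trans lt (bd m)))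
  where
  bd : ∀ m → ∣ m ∣ ℕ.≤ ∣ m ℤ.+ + k ∣ ℕ.+ k
  bd m = subst (λ x → ∣ x ∣ ℕ.≤ ∣ m ℤ.+ + k ∣ ℕ.+ k)
    (trans (ℤₚ.+-assoc m (+ k) (ℤ.- + k))
           (trans (cong (λ z → m ℤ.+ z) (ℤₚ.+-inverseʳ (+ k))) (ℤₚ.+-identityʳ m)))
    (ℤₚ.∣i-j∣≤∣i∣+∣j∣ (m ℤ.+ + k) (+ k))

-- ∑ t(m) over -N ≤ m ≤ N
∑± : ℕ → (ℤ → ℚ) → ℚ
∑± N t = ∑< (suc N) (λ i → t (+ i)) ℚ.+ ∑< N (λ i → t -[1+ i ])

∑±-cong : ∀ N {s t} → (∀ m → s m ≡ t m) → ∑± N s ≡ ∑± N t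
∑±-cong N s≡t = cong₂ ℚ._+_ (∑<-cong (suc N) (s≡t ∘ (λ i → + i))) (∑<-cong N (s≡t ∘ -[1+_]))

∑±-indep : ∀ M N t → (∀ m → M ℕ.< ∣ m ∣ → t m ≡ 0ℚ) → (∀ m → N ℕ.< ∣ m ∣ → t m ≡ 0ℚ) →
           ∑± M t ≡ ∑± N t
∑±-indep M N t p q = cong₂ ℚ._+_
  (∑<-indep (suc M) (suc N) _ (λ i → p (+ i)) (λ i → q (+ i)))
  (∑<-indep M N _ (λ i M≤i → p -[1+ i ] (s≤s M≤i)) (λ i N≤i → q -[1+ i ] (s≤s N≤i)))

-- F |ᵣ₌ S = ∑ₘ Fₘ Sᵐ; all terms with ∣m∣ > bound F (length e) vanish at e.
infix 5 _|ᵣ₌_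
_|ᵣ₌_ : Laurent → FPS → FPS
F |ᵣ₌ S = mkFPS (λ e → ∑± (bound F (length e)) (term e)) λ e →
  trans (∑±-cong (bound F (length (e ∷ʳ 0))) (λ m → stable (at F m * S ^ᶻ m) e))
        (∑±-indep _ _ (term e)
          (λ m lt → trans (sym (stable (at F m * S ^ᶻ m) e)) (term-vanish (e ∷ʳ 0) m lt))
          (term-vanish e))
  where
  term : List ℕ → ℤ → ℚ
  term e m = coeff (at F m * S ^ᶻ m) e

  term-vanish : ∀ e m → bound F (length e) ℕ.< ∣ m ∣ → term e m ≡ 0ℚ
  term-vanish e m lt = conv-vanish (coeff (at F m)) (coeff (S ^ᶻ m)) e λ d eq →
    vanish F m d (subst (λ n → bound F n ℕ.< ∣ m ∣) (sym eq) lt)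

Laurent-rawMonoid : RawMonoid 0ℓ 0ℓ
Laurent-rawMonoid = record { Carrier = Laurent ; _≈_ = _≈ᴸ_ ; _∙_ = _+ᴸ_ ; ε = 0ᴸ }

-- Operators on Laurent, with composition as product.
Operator-rawSemiring : RawSemiring 0ℓ 0ℓ
Operator-rawSemiring = record
  { Carrier = Laurent → Laurent
  ; _≈_     = λ A B → ∀ F → A F ≈ᴸ B F
  ; _+_     = λ A B F → A F +ᴸ B F
  ; _*_     = λ A B F → A (B F)
  ; 0#      = λ _ → 0ᴸ
  ; 1#      = id
  }

------------------------------------------------------------------------
-- Polynomials in n variables over ℚ, as sums of terms (coefficient, exponents)

Poly : ℕ → Set
Poly n = List (ℚ × Vec ℕ n)

module Evaluation (S : RawSemiring 0ℓ 0ℓ) (ι : ℚ → RawSemiring.Carrier S) where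
  private
    module S = RawSemiring S
    module D = RawSemiringDefs S

  power : ∀ {n} → Vec ℕ n → Vec S.Carrier n → S.Carrier
  power []       []       = S.1#
  power (k ∷ ks) (a ∷ as) = (a D.^ k) S.* power ks as

  eval : ∀ {n} → Poly n → Vec S.Carrier n → S.Carrier
  eval []            as = S.0#
  eval ((q , k) ∷ P) as = (ι q S.* power k as) S.+ eval P as

open Evaluation ℚ.+-*-rawSemiring id public using () renaming (eval to evalℚ)
open Evaluation FPS-rawSemiring const public using () renaming (eval to evalFPS)
open Evaluation Operator-rawSemiring _•ᴸ_ public using () renaming (eval to evalOp)

-- Homogeneity of degree d in all variables but the first.
HomogeneousInTail : ∀ {n} → ℕ → Poly (suc n) → Set
HomogeneousInTail d = All λ t → Vec.sum (Vec.tail (proj₂ t)) ≡ d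

------------------------------------------------------------------------
-- For a given b, the variable x_j (j ≥ b) is y_{j-b}; in particular x_b is
-- y₀ and ∂ is the derivative with respect to x_b.

x : (b j : ℕ) → FPS
x b j = var (j ℕ.∸ b)

Cat : ℕ → ℚ
Cat ℓ = + ((2 ℕ.* ℓ) C ℓ) ℚ./ suc ℓ

-- The coefficient of rᵐ in ∑_{j>b} binom(2j-1, j+b) x_j r^{b+j}, where j = m - b.
infinitePartAt : ℕ → ℤ → FPS
infinitePartAt b -[1+ _ ] = const 0ℚ
infinitePartAt b (+ m) with b ℕ.+ suc b ℕₚ.≤? m
... | yes _ = let j = m ℕ.∸ b in fromℕ ((2 ℕ.* j ℕ.∸ 1) C (j ℕ.+ b)) • x b j
... | no  _ = const 0ℚ

infinitePart : ℕ → Laurent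
infinitePart b = mkLaurent (infinitePartAt b) (λ n → (b ℕ.+ b) ℕ.+ n) vanishes
  where
  vanishes : ∀ m e → (b ℕ.+ b) ℕ.+ length e ℕ.< ∣ m ∣ → coeff (infinitePartAt b m) e ≡ 0ℚ
  vanishes -[1+ _ ] e lt = constCoeff-0 e
  vanishes (+ m)    e lt with b ℕ.+ suc b ℕₚ.≤? m
  ... | no  _ = constCoeff-0 e
  ... | yes _ = trans (cong (q ℚ.*_) (varCoeff-short (m ℕ.∸ b ℕ.∸ b) e short)) (ℚₚ.*-zeroʳ q)
    where
    q = fromℕ ((2 ℕ.* (m ℕ.∸ b) ℕ.∸ 1) C ((m ℕ.∸ b) ℕ.+ b))

    short : length e ℕ.≤ m ℕ.∸ b ℕ.∸ b
    short = subst₂ ℕ._≤_ (ℕₚ.m+n∸m≡n (b ℕ.+ b) (length e)) (sym (ℕₚ.∸-+-assoc m b b))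
      (ℕₚ.∸-monoˡ-≤ (b ℕ.+ b) (ℕₚ.<⇒≤ lt))

-- r 𝟏_{b=0}
indicator : ℕ → Laurent
indicator zero    = monomial 1ℚ (+ 1)
indicator (suc _) = 0ᴸ

open FiniteSum Laurent-rawMonoid public using () renaming (∑< to ∑ᴸ<)

Z : ℕ → Laurent
Z b = indicator b
   -ᴸ ∑ᴸ< (suc b) (λ ℓ →
        monomial ((ℚ.- 1ℚ) ^ℚ (b ℕ.∸ ℓ) ℚ.* fromℕ ((b ℕ.+ ℓ) C (2 ℕ.* ℓ)) ℚ.* Cat ℓ)
                 (+ (b ℕ.∸ ℓ)))
   -ᴸ infinitePart b

-- R is R^{(b)}.
IsR : ℕ → FPS → Set
IsR b R = constantTerm R ≡ 1ℚ × (Z b |ᵣ₌ R) ≈ x b b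

-- The characterisation of Q_p(b, j); the sum over b ≤ k ≤ j - 1 is written
-- with k = b + i, 0 ≤ i < j - b.
IsQ : ℕ → Poly 2 → Set
IsQ p Q = ∀ b j → b ℕ.< j →
  ∑< (j ℕ.∸ b) (λ i → let k = b ℕ.+ i in
    fromℕ ((2 ℕ.* k ℕ.+ 1 ℕ.+ p) C (2 ℕ.* p ℕ.+ 1)) ℚ.* fromℕ ((2 ℕ.* j ℕ.∸ 1) C (j ℕ.+ k)))
  ≡ fromℕ ((2 ℕ.* j ℕ.∸ 1) C (j ℕ.+ b)) ℚ.* evalℚ Q (fromℕ b ∷ fromℕ j ∷ [])

-- The moment M̄_p^{(b)}, given Q = Q_p and R = R^{(b)}.
moment : Poly 2 → ℕ → FPS → FPS
moment Q b R = evalOp Q ((fromℕ b •ᴸ_) ∷ r∂ᵣ ∷ []) (r^- b · Z b) |ᵣ₌ R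

-- (R, ∂R, ..., ∂ⁿ⁻¹R)
derivatives : (n : ℕ) → FPS → Vec FPS n
derivatives n R = Vec.tabulate λ i → ∂^ (toℕ i) R

{-# OPTIONS --safe #-}
module Submission where

open import Defs
open import Data.Nat.Base as ℕ using (ℕ; suc)
open import Data.Integer.Base using (_⊖_)
open import Data.Product.Base using (Σ-syntax; _×_)
open import Data.Vec.Base using (_∷_)
open import Algebra.Bundles using (CommutativeRing)
import Algebra.Definitions.RawSemiring as RawSemiringDefs
import Algebra.Solver.Ring as RingSolver
open import Algebra.Solver.Ring.AlmostCommutativeRing using (fromCommutativeRing; _-Raw-AlmostCommutative⟶_)
open import Data.Fin.Base as Fin using (Fin; zero; suc; toℕ)
import Data.Fin.Properties as Finₚ
open import Data.Integer.Base as ℤ using (ℤ; +_; -[1+_]; ∣_∣)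
import Data.Integer.Properties as ℤₚ
open import Data.List.Base as List using (List; []; _∷_; length; _++_)
open import Data.List.Relation.Unary.All as All using ([]; _∷_)
import Data.List.Relation.Unary.All.Properties as Allₚ
import Data.Maybe.Base as Maybe
open import Data.Nat.Base using (zero; z≤n; s≤s)
open import Data.Nat.Combinatorics using (_C_; nCk+nC[k+1]≡[n+1]C[k+1]; k>n⇒nCk≡0)
import Data.Nat.ListAction as ℕL
import Data.Nat.Properties as ℕₚ
open import Data.Nat.Solver using () renaming (module +-*-Solver to ℕ-Solver)
open import Data.Product.Base using (_,_; proj₁; proj₂)
open import Data.Rational.Base as ℚ using (ℚ; 0ℚ; 1ℚ)
import Data.Rational.Properties as ℚₚ
open import Data.Rational.Solver using (module +-*-Solver)
import Data.Rational.Unnormalised.Base as ℚᵘ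
import Data.Rational.Unnormalised.Properties as ℚᵘₚ
open import Data.Vec.Base as Vec using (Vec; [])
import Data.Vec.Properties as Vecₚ
open import Function.Base using (_∘_; id)
open import Level using (0ℓ)
open import Relation.Binary.PropositionalEquality hiding (J)
import Relation.Binary.Reasoning.Setoid
open import Relation.Nullary using (yes; no; contradiction)
open import Relation.Nullary.Decidable using (dec⇒maybe)

-- Write θ = r∂ᵣ.  The coefficients of Z do not involve x_b, so the chain rule gives
-- (θF)|ᵣ₌R = (R/∂R) ∂(F|ᵣ₌R) for every F = f(θ)Z, starting from Z|ᵣ₌R = x_b.  Moving
-- r⁻ᵇ out replaces Q(b, j) by Q(b, n - b), n = θ, which is n times a polynomial of
-- degree p in n.  Hence the moment is R⁻ᵇ times a combination of ((R/∂R)∂)ᵏ x_b with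
-- 1 ≤ k ≤ p+1, each of which is R/(∂R)²ᵏ⁻¹ times a homogeneous differential polynomial.
--
-- The shape of Q comes from summing by telescoping: binom(2k+1+p, 2p+1) is a
-- combination of polynomials a(k) for which a(k) binom(2j-1, j+k) is a difference
-- t(k) - t(k+1) with t(k) = (j+k) h(k, j+k) binom(2j-1, j+k).  This exhibits one such
-- Q, and for each b a polynomial in j is determined by its values at all j > b.

-- T must be chosen before b, while `IsQ` constrains a given Q only at natural b. The telescoping
-- supplies coefficients that depend on p alone and are polynomial in b; Q is then compared with
-- them for each b separately, by uniqueness in the single variable j. The sum over k is t(b) -
-- t(j). Here t(j) contains binom(2j-1, 2j) = 0, and t(b) carries the factor j+b, which is n = θ
-- after r⁻ᵇ has been moved out. This factor is essential: Z|ᵣ₌R = x_b gives no expression in R,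
-- whereas (θZ)|ᵣ₌R = R/∂R does, so every term has to contain at least one θ. The degree p in n
-- matters as much, because every further θ brings in one more derivative of R. It is therefore
-- recorded in the types, by vectors of length p+1, and the summands are built so that each step of
-- the summation raises the degree in n by exactly one. Quotients by powers of ∂R are avoided until
-- the end: the recursion is proved multiplied out, and ∂R is invertible because it divides R, whose
-- constant term is 1.

toℚᵘ-fromℤ : ∀ i → ℚ.toℚᵘ (fromℤ i) ℚᵘ.≃ ℚᵘ.mkℚᵘ i 0
toℚᵘ-fromℤ i = ℚₚ.toℚᵘ-fromℚᵘ (ℚᵘ.mkℚᵘ i 0)

fromℤ-+ : ∀ i j → fromℤ (i ℤ.+ j) ≡ fromℤ i ℚ.+ fromℤ j
fromℤ-+ i j = ℚₚ.toℚᵘ-injective (begin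
  ℚ.toℚᵘ (fromℤ (i ℤ.+ j))                    ≈⟨ toℚᵘ-fromℤ (i ℤ.+ j) ⟩
  ℚᵘ.mkℚᵘ (i ℤ.+ j) 0
      ≈⟨ ℚᵘ.*≡* (cong (ℤ._* + 1) (cong₂ ℤ._+_ (ℤₚ.*-identityʳ i) (ℤₚ.*-identityʳ j))) ⟨
  ℚᵘ.mkℚᵘ i 0 ℚᵘ.+ ℚᵘ.mkℚᵘ j 0                ≈⟨ ℚᵘₚ.+-cong (toℚᵘ-fromℤ i) (toℚᵘ-fromℤ j) ⟨
  ℚ.toℚᵘ (fromℤ i) ℚᵘ.+ ℚ.toℚᵘ (fromℤ j)      ≈⟨ ℚₚ.toℚᵘ-homo-+ (fromℤ i) (fromℤ j) ⟨
  ℚ.toℚᵘ (fromℤ i ℚ.+ fromℤ j)                ∎)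
  where open import Relation.Binary.Reasoning.Setoid ℚᵘₚ.≃-setoid

fromℤ-* : ∀ i j → fromℤ (i ℤ.* j) ≡ fromℤ i ℚ.* fromℤ j
fromℤ-* i j = ℚₚ.toℚᵘ-injective (begin
  ℚ.toℚᵘ (fromℤ (i ℤ.* j))                    ≈⟨ toℚᵘ-fromℤ (i ℤ.* j) ⟩
  ℚᵘ.mkℚᵘ i 0 ℚᵘ.* ℚᵘ.mkℚᵘ j 0                ≈⟨ ℚᵘₚ.*-cong (toℚᵘ-fromℤ i) (toℚᵘ-fromℤ j) ⟨
  ℚ.toℚᵘ (fromℤ i) ℚᵘ.* ℚ.toℚᵘ (fromℤ j)      ≈⟨ ℚₚ.toℚᵘ-homo-* (fromℤ i) (fromℤ j) ⟨
  ℚ.toℚᵘ (fromℤ i ℚ.* fromℤ j)                ∎)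
  where open import Relation.Binary.Reasoning.Setoid ℚᵘₚ.≃-setoid

-- Rational numbers

module _ where
  open +-*-Solver using (solve; con; _:=_; _:+_; _:*_; _:-_; :-_)
  open ≡-Reasoning

  fromℤ-injective : ∀ {i j} → fromℤ i ≡ fromℤ j → i ≡ j
  fromℤ-injective {i} {j} eq with ℚᵘₚ.≃-trans (ℚᵘₚ.≃-sym (toℚᵘ-fromℤ i))
      (ℚᵘₚ.≃-trans (ℚᵘₚ.≃-reflexive (cong ℚ.toℚᵘ eq)) (toℚᵘ-fromℤ j))
  ... | ℚᵘ.*≡* i*1≡j*1 = trans (sym (ℤₚ.*-identityʳ i)) (trans i*1≡j*1 (ℤₚ.*-identityʳ j))

  fromℕ-+ : ∀ m n → fromℕ (m ℕ.+ n) ≡ fromℕ m ℚ.+ fromℕ n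
  fromℕ-+ m n = fromℤ-+ (+ m) (+ n)

  fromℕ-suc : ∀ n → fromℕ (suc n) ≡ 1ℚ ℚ.+ fromℕ n
  fromℕ-suc = fromℕ-+ 1

  fromℕ-* : ∀ m n → fromℕ (m ℕ.* n) ≡ fromℕ m ℚ.* fromℕ n
  fromℕ-* m n = trans (cong fromℤ (ℤₚ.pos-* m n)) (fromℤ-* (+ m) (+ n))

  fromℕ-suc≢0 : ∀ n → fromℕ (suc n) ≢ 0ℚ
  fromℕ-suc≢0 n eq with fromℤ-injective {+ suc n} {+ 0} eq
  ... | ()

  recip-inverseʳ : ∀ {q} → q ≢ 0ℚ → q ℚ.* recip q ≡ 1ℚ
  recip-inverseʳ {q} q≢0 with q ℚₚ.≟ 0ℚ
  ... | yes q≡0 = contradiction q≡0 q≢0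
  ... | no  q≢0 = ℚₚ.*-inverseʳ q {{ℚ.≢-nonZero q≢0}}

  *-cancelˡ-≢0 : ∀ {q} → q ≢ 0ℚ → ∀ {s t} → q ℚ.* s ≡ q ℚ.* t → s ≡ t
  *-cancelˡ-≢0 {q} q≢0 {s} {t} eq = begin
    s                       ≡⟨ lemma s ⟨
    recip q ℚ.* (q ℚ.* s)   ≡⟨ cong (recip q ℚ.*_) eq ⟩
    recip q ℚ.* (q ℚ.* t)   ≡⟨ lemma t ⟩
    t                       ∎
    where
    lemma : ∀ s → recip q ℚ.* (q ℚ.* s) ≡ s
    lemma s = begin
      recip q ℚ.* (q ℚ.* s)  ≡⟨ solve 3 (λ a b c → a :* (b :* c) := (b :* a) :* c) refl (recip q) q s ⟩
      (q ℚ.* recip q) ℚ.* s  ≡⟨ cong (ℚ._* s) (recip-inverseʳ q≢0) ⟩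
      1ℚ ℚ.* s               ≡⟨ ℚₚ.*-identityˡ s ⟩
      s                      ∎

  -- Finite sums

  +-interchange : ∀ a b c d → (a ℚ.+ b) ℚ.+ (c ℚ.+ d) ≡ (a ℚ.+ c) ℚ.+ (b ℚ.+ d)
  +-interchange = solve 4 (λ a b c d → (a :+ b) :+ (c :+ d) := (a :+ c) :+ (b :+ d)) refl

  ∑<-cong< : ∀ n {f g} → (∀ i → i ℕ.< n → f i ≡ g i) → ∑< n f ≡ ∑< n g
  ∑<-cong< zero    f≡g = refl
  ∑<-cong< (suc n) f≡g = cong₂ ℚ._+_ (f≡g 0 (s≤s z≤n)) (∑<-cong< n λ i i<n → f≡g (suc i) (s≤s i<n))

  ∑<-+ : ∀ n f g → ∑< n (λ i → f i ℚ.+ g i) ≡ ∑< n f ℚ.+ ∑< n g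
  ∑<-+ zero    f g = sym (ℚₚ.+-identityˡ 0ℚ)
  ∑<-+ (suc n) f g = trans (cong (f 0 ℚ.+ g 0 ℚ.+_) (∑<-+ n (f ∘ suc) (g ∘ suc)))
                           (+-interchange (f 0) (g 0) (∑< n (f ∘ suc)) (∑< n (g ∘ suc)))

  ∑<-*ˡ : ∀ n q f → ∑< n (λ i → q ℚ.* f i) ≡ q ℚ.* ∑< n f
  ∑<-*ˡ zero    q f = sym (ℚₚ.*-zeroʳ q)
  ∑<-*ˡ (suc n) q f = trans (cong (q ℚ.* f 0 ℚ.+_) (∑<-*ˡ n q (f ∘ suc)))
                            (sym (ℚₚ.*-distribˡ-+ q (f 0) (∑< n (f ∘ suc))))

  ∑<-last : ∀ n f → ∑< (suc n) f ≡ ∑< n f ℚ.+ f n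
  ∑<-last zero    f = ℚₚ.+-comm (f 0) 0ℚ
  ∑<-last (suc n) f = trans (cong (f 0 ℚ.+_) (∑<-last n (f ∘ suc)))
                            (sym (ℚₚ.+-assoc (f 0) (∑< n (f ∘ suc)) (f (suc n))))

  -- `conv` at `n ∷ e` unfolds to such an antidiagonal sum, so the laws of the product reduce to
  -- laws of antidiagonals by induction on the exponent list.
  Δ : ℕ → (ℕ → ℕ → ℚ) → ℚ
  Δ n F = ∑< (suc n) λ i → F i (n ℕ.∸ i)

  Δ-cong : ∀ n {F G} → (∀ a b → a ℕ.+ b ≡ n → F a b ≡ G a b) → Δ n F ≡ Δ n G
  Δ-cong n F≡G = ∑<-cong< (suc n) λ i i<1+n → F≡G i (n ℕ.∸ i) (ℕₚ.m+[n∸m]≡n (ℕₚ.≤-pred i<1+n))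

  Δ-+ : ∀ n F G → Δ n (λ a b → F a b ℚ.+ G a b) ≡ Δ n F ℚ.+ Δ n G
  Δ-+ n F G = ∑<-+ (suc n) (λ i → F i (n ℕ.∸ i)) (λ i → G i (n ℕ.∸ i))

  Δ-*ˡ : ∀ n q F → Δ n (λ a b → q ℚ.* F a b) ≡ q ℚ.* Δ n F
  Δ-*ˡ n q F = ∑<-*ˡ (suc n) q (λ i → F i (n ℕ.∸ i))

  Δ-last : ∀ n F → Δ (suc n) F ≡ Δ n (λ a b → F a (suc b)) ℚ.+ F (suc n) 0
  Δ-last n F = trans (∑<-last (suc n) (λ i → F i (suc n ℕ.∸ i))) (cong₂ ℚ._+_
    (∑<-cong< (suc n) λ i i<1+n → cong (F i) (ℕₚ.+-∸-assoc 1 (ℕₚ.≤-pred i<1+n)))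
    (cong (F (suc n)) (ℕₚ.n∸n≡0 n)))

  Δ-comm : ∀ n F → Δ n F ≡ Δ n (λ a b → F b a)
  Δ-comm zero    F = refl
  Δ-comm (suc n) F = begin
    F 0 (suc n) ℚ.+ Δ n (λ a b → F (suc a) b)   ≡⟨ cong (F 0 (suc n) ℚ.+_) (Δ-comm n (λ a b → F (suc a) b)) ⟩
    F 0 (suc n) ℚ.+ Δ n (λ a b → F (suc b) a)   ≡⟨ ℚₚ.+-comm (F 0 (suc n)) _ ⟩
    Δ n (λ a b → F (suc b) a) ℚ.+ F 0 (suc n)   ≡⟨ Δ-last n (λ a b → F b a) ⟨
    Δ (suc n) (λ a b → F b a)                   ∎

  Δ-assoc : ∀ n (T : ℕ → ℕ → ℕ → ℚ) →
            Δ n (λ i c → Δ i (λ a b → T a b c)) ≡ Δ n (λ a j → Δ j (λ b c → T a b c))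
  Δ-assoc zero    T = refl
  Δ-assoc (suc n) T = begin
    Δ 0 (λ a b → T a b (suc n)) ℚ.+ Δ n (λ i c → T 0 (suc i) c ℚ.+ Δ i (λ a b → T (suc a) b c))
      ≡⟨ cong₂ ℚ._+_ (ℚₚ.+-identityʳ (T 0 0 (suc n)))
          (Δ-+ n (λ i c → T 0 (suc i) c) (λ i c → Δ i (λ a b → T (suc a) b c))) ⟩
    T 0 0 (suc n) ℚ.+ (Δ n (λ i c → T 0 (suc i) c) ℚ.+ Δ n (λ i c → Δ i (λ a b → T (suc a) b c)))
      ≡⟨ cong (λ z → T 0 0 (suc n) ℚ.+ (Δ n (λ i c → T 0 (suc i) c) ℚ.+ z)) (Δ-assoc n (λ a → T (suc a))) ⟩
    T 0 0 (suc n) ℚ.+ (Δ n (λ i c → T 0 (suc i) c) ℚ.+ Δ n (λ a j → Δ j (T (suc a))))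
      ≡⟨ ℚₚ.+-assoc (T 0 0 (suc n)) _ _ ⟨
    Δ (suc n) (T 0) ℚ.+ Δ n (λ a j → Δ j (T (suc a)))
      ∎

  -- On the antidiagonal the factor n + 1 equals a + b, and the terms with a = 0 or b = 0 drop out
  -- of the respective halves. This is the product rule at the level of coefficients.
  Δ-leibniz : ∀ n F → fromℕ (suc n) ℚ.* Δ (suc n) F ≡
              Δ n (λ a b → fromℕ (suc a) ℚ.* F (suc a) b) ℚ.+ Δ n (λ a b → fromℕ (suc b) ℚ.* F a (suc b))
  Δ-leibniz n F = begin
    fromℕ (suc n) ℚ.* Δ (suc n) F
      ≡⟨ Δ-*ˡ (suc n) (fromℕ (suc n)) F ⟨
    Δ (suc n) (λ a b → fromℕ (suc n) ℚ.* F a b)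
      ≡⟨ Δ-cong (suc n) (λ a b a+b≡1+n → trans
           (cong (ℚ._* F a b) (trans (cong fromℕ (sym a+b≡1+n)) (fromℕ-+ a b)))
           (ℚₚ.*-distribʳ-+ (F a b) (fromℕ a) (fromℕ b))) ⟩
    Δ (suc n) (λ a b → fromℕ a ℚ.* F a b ℚ.+ fromℕ b ℚ.* F a b)
      ≡⟨ Δ-+ (suc n) (λ a b → fromℕ a ℚ.* F a b) (λ a b → fromℕ b ℚ.* F a b) ⟩
    Δ (suc n) (λ a b → fromℕ a ℚ.* F a b) ℚ.+ Δ (suc n) (λ a b → fromℕ b ℚ.* F a b)
      ≡⟨ cong₂ ℚ._+_ (trans (cong (ℚ._+ L) (ℚₚ.*-zeroˡ (F 0 (suc n)))) (ℚₚ.+-identityˡ L))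
                     (trans (Δ-last n (λ a b → fromℕ b ℚ.* F a b))
                            (trans (cong (M ℚ.+_) (ℚₚ.*-zeroˡ (F (suc n) 0))) (ℚₚ.+-identityʳ M))) ⟩
    L ℚ.+ M
      ∎
    where
    L = Δ n (λ a b → fromℕ (suc a) ℚ.* F (suc a) b)
    M = Δ n (λ a b → fromℕ (suc b) ℚ.* F a (suc b))

  -- The Cauchy product

  infixl 8 _▹_
  _▹_ : (List ℕ → ℚ) → ℕ → List ℕ → ℚ
  (f ▹ n) d = f (n ∷ d)

  -- Lengths and total degrees are handed to the hypothesis because the bounds of Laurent series
  -- depend on lengths, and the truncation of the geometric series on degrees.
  conv-cong : ∀ f f′ g g′ e →
              (∀ d d′ → length d ≡ length e → length d′ ≡ length e → ℕL.sum d ℕ.+ ℕL.sum d′ ≡ ℕL.sum e →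
                f d ℚ.* g d′ ≡ f′ d ℚ.* g′ d′) →
              conv f g e ≡ conv f′ g′ e
  conv-cong f f′ g g′ []      p = p [] [] refl refl refl
  conv-cong f f′ g g′ (n ∷ e) p = Δ-cong n {λ a b → conv (f ▹ a) (g ▹ b) e} {λ a b → conv (f′ ▹ a) (g′ ▹ b) e}
      λ a b a+b≡n → conv-cong (f ▹ a) (f′ ▹ a) (g ▹ b) (g′ ▹ b) e λ d d′ l l′ s →
    p (a ∷ d) (b ∷ d′) (cong suc l) (cong suc l′)
      (trans (interchange a (ℕL.sum d) b (ℕL.sum d′)) (cong₂ ℕ._+_ a+b≡n s))
    where
    open import Algebra.Properties.CommutativeSemigroup ℕₚ.+-commutativeSemigroup using (interchange)

  conv-congˡ : ∀ {f f′ g} e → (∀ d → length d ≡ length e → f d ≡ f′ d) → conv f g e ≡ conv f′ g e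
  conv-congˡ {f} {f′} {g} e p = conv-cong f f′ g g e λ d d′ l _ _ → cong (ℚ._* g d′) (p d l)

  conv-comm : ∀ f g e → conv f g e ≡ conv g f e
  conv-comm f g []      = ℚₚ.*-comm (f []) (g [])
  conv-comm f g (n ∷ e) = trans
    (Δ-cong n {λ a b → conv (f ▹ a) (g ▹ b) e} λ a b _ → conv-comm (f ▹ a) (g ▹ b) e)
    (Δ-comm n λ a b → conv (g ▹ b) (f ▹ a) e)

  conv-distribʳ-+ : ∀ f f′ g e → conv (λ d → f d ℚ.+ f′ d) g e ≡ conv f g e ℚ.+ conv f′ g e
  conv-distribʳ-+ f f′ g []      = ℚₚ.*-distribʳ-+ (g []) (f []) (f′ [])
  conv-distribʳ-+ f f′ g (n ∷ e) = trans
    (Δ-cong n {λ a b → conv (λ d → f (a ∷ d) ℚ.+ f′ (a ∷ d)) (g ▹ b) e} λ a b _ → conv-distribʳ-+ (f ▹ a)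
        (f′ ▹ a) (g ▹ b) e)
    (Δ-+ n (λ a b → conv (f ▹ a) (g ▹ b) e) (λ a b → conv (f′ ▹ a) (g ▹ b) e))

  conv-*ˡ : ∀ q f g e → conv (λ d → q ℚ.* f d) g e ≡ q ℚ.* conv f g e
  conv-*ˡ q f g []      = ℚₚ.*-assoc q (f []) (g [])
  conv-*ˡ q f g (n ∷ e) = trans
    (Δ-cong n {λ a b → conv (λ d → q ℚ.* f (a ∷ d)) (g ▹ b) e} λ a b _ → conv-*ˡ q (f ▹ a) (g ▹ b) e)
    (Δ-*ˡ n q (λ a b → conv (f ▹ a) (g ▹ b) e))

  conv-*ʳ : ∀ q f g e → conv f (λ d → q ℚ.* g d) e ≡ q ℚ.* conv f g e
  conv-*ʳ q f g e = trans (conv-comm f _ e) (trans (conv-*ˡ q g f e) (cong (q ℚ.*_) (conv-comm g f e)))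

  conv-∑ˡ : ∀ n (F : ℕ → List ℕ → ℚ) g e → conv (λ d → ∑< n (λ i → F i d)) g e ≡ ∑< n (λ i → conv (F i) g e)
  conv-∑ˡ zero    F g e = conv-vanish (λ _ → 0ℚ) g e (λ _ _ → refl)
  conv-∑ˡ (suc n) F g e = trans (conv-distribʳ-+ (F 0) (λ d → ∑< n (λ i → F (suc i) d)) g e)
                                (cong (conv (F 0) g e ℚ.+_) (conv-∑ˡ n (F ∘ suc) g e))

  conv-∑ʳ : ∀ n f (G : ℕ → List ℕ → ℚ) e → conv f (λ d → ∑< n (λ i → G i d)) e ≡ ∑< n (λ i → conv f (G i) e)
  conv-∑ʳ n f G e = trans (conv-comm f _ e) (trans (conv-∑ˡ n G f e) (∑<-cong n λ i → conv-comm (G i) f e))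

  conv-assoc : ∀ f g h e → conv (conv f g) h e ≡ conv f (conv g h) e
  conv-assoc f g h []      = ℚₚ.*-assoc (f []) (g []) (h [])
  conv-assoc f g h (n ∷ e) = begin
    Δ n (λ i c → conv (λ d → Δ i (λ a b → conv (f ▹ a) (g ▹ b) d)) (h ▹ c) e)
      ≡⟨ Δ-cong n {λ i c → conv (λ d → Δ i (λ a b → conv (f ▹ a) (g ▹ b) d)) (h ▹ c) e}
          {λ i c → Δ i (λ a b → conv (conv (f ▹ a) (g ▹ b)) (h ▹ c) e)}
          (λ i c _ → conv-∑ˡ (suc i) (λ a → conv (f ▹ a) (g ▹ (i ℕ.∸ a))) (h ▹ c) e) ⟩
    Δ n (λ i c → Δ i (λ a b → conv (conv (f ▹ a) (g ▹ b)) (h ▹ c) e))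
      ≡⟨ Δ-cong n {λ i c → Δ i (λ a b → conv (conv (f ▹ a) (g ▹ b)) (h ▹ c) e)}
          (λ i c _ → Δ-cong i {λ a b → conv (conv (f ▹ a) (g ▹ b)) (h ▹ c) e}
          (λ a b _ → conv-assoc (f ▹ a) (g ▹ b) (h ▹ c) e)) ⟩
    Δ n (λ i c → Δ i (λ a b → conv (f ▹ a) (conv (g ▹ b) (h ▹ c)) e))
      ≡⟨ Δ-assoc n (λ a b c → conv (f ▹ a) (conv (g ▹ b) (h ▹ c)) e) ⟩
    Δ n (λ a j → Δ j (λ b c → conv (f ▹ a) (conv (g ▹ b) (h ▹ c)) e))
      ≡⟨ Δ-cong n {λ a j → conv (f ▹ a) (λ d → Δ j (λ b c → conv (g ▹ b) (h ▹ c) d)) e}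
          {λ a j → Δ j (λ b c → conv (f ▹ a) (conv (g ▹ b) (h ▹ c)) e)}
          (λ a j _ → conv-∑ʳ (suc j) (f ▹ a) (λ b → conv (g ▹ b) (h ▹ (j ℕ.∸ b))) e) ⟨
    Δ n (λ a j → conv (f ▹ a) (λ d → Δ j (λ b c → conv (g ▹ b) (h ▹ c) d)) e)
      ∎

  conv-constˡ : ∀ q g e → conv (constCoeff q) g e ≡ q ℚ.* g e
  conv-constˡ q g []      = refl
  conv-constˡ q g (n ∷ e) = trans
    (cong₂ ℚ._+_ (conv-constˡ q (g ▹ n) e)
                 (∑<-zero n (λ i → conv (λ _ → 0ℚ) (g ▹ (n ℕ.∸ suc i)) e) λ i → conv-vanish (λ _ → 0ℚ)
                     (g ▹ (n ℕ.∸ suc i)) e (λ _ _ → refl)))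
    (ℚₚ.+-identityʳ _)

  -- Sums over symmetric windows of integers

  ∑±-+ : ∀ N s t → ∑± N (λ m → s m ℚ.+ t m) ≡ ∑± N s ℚ.+ ∑± N t
  ∑±-+ N s t = trans
    (cong₂ ℚ._+_ (∑<-+ (suc N) (s ∘ λ i → + i) (t ∘ λ i → + i)) (∑<-+ N (s ∘ -[1+_]) (t ∘ -[1+_])))
    (+-interchange (∑< (suc N) (s ∘ λ i → + i)) (∑< (suc N) (t ∘ λ i → + i)) (∑< N (s ∘ -[1+_]))
        (∑< N (t ∘ -[1+_])))

  ∑±-*ˡ : ∀ N q t → ∑± N (λ m → q ℚ.* t m) ≡ q ℚ.* ∑± N t
  ∑±-*ˡ N q t = trans
    (cong₂ ℚ._+_ (∑<-*ˡ (suc N) q (t ∘ λ i → + i)) (∑<-*ˡ N q (t ∘ -[1+_])))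
    (sym (ℚₚ.*-distribˡ-+ q (∑< (suc N) (t ∘ λ i → + i)) (∑< N (t ∘ -[1+_]))))

  conv-∑±ˡ : ∀ N (F : ℤ → List ℕ → ℚ) g e → conv (λ d → ∑± N (λ m → F m d)) g e ≡ ∑± N (λ m → conv (F m) g e)
  conv-∑±ˡ N F g e = trans
    (conv-distribʳ-+ (λ d → ∑< (suc N) (λ i → F (+ i) d)) (λ d → ∑< N (λ i → F -[1+ i ] d)) g e)
    (cong₂ ℚ._+_ (conv-∑ˡ (suc N) (F ∘ λ i → + i) g e) (conv-∑ˡ N (F ∘ -[1+_]) g e))

  -- Both windows are first enlarged by zeros only. Shifting by one then merely moves `t (+ 0)` from
  -- the negative half of the sum to the nonnegative half.
  ∑±-suc : ∀ M N t → (∀ m → M ℕ.< ∣ m ∣ → t (ℤ.suc m) ≡ 0ℚ) → (∀ m → N ℕ.< ∣ m ∣ → t m ≡ 0ℚ) →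
           ∑± M (t ∘ ℤ.suc) ≡ ∑± N t
  ∑±-suc M N t p q = begin
    ∑± M (t ∘ ℤ.suc)
      ≡⟨ ∑±-indep M (suc K) (t ∘ ℤ.suc) p (λ m lt → p m (ℕₚ.≤-<-trans (ℕₚ.m≤n⇒m≤1+n (ℕₚ.m≤m+n M N)) lt)) ⟩
    P ℚ.+ (t (+ 0) ℚ.+ ∑< K (t ∘ -[1+_]))
      ≡⟨ cong (λ z → P ℚ.+ (t (+ 0) ℚ.+ z)) (∑<-indep K (2 ℕ.+ K) (t ∘ -[1+_])
          (λ i K≤i → q -[1+ i ] (s≤s (ℕₚ.≤-trans (ℕₚ.m≤n+m N M) K≤i)))
           (λ i K≤i → q -[1+ i ] (s≤s (ℕₚ.≤-trans (ℕₚ.m≤n⇒m≤o+n 2 (ℕₚ.m≤n+m N M)) K≤i)))) ⟩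
    P ℚ.+ (t (+ 0) ℚ.+ ∑< (2 ℕ.+ K) (t ∘ -[1+_]))
      ≡⟨ solve 3 (λ a b c → a :+ (b :+ c) := (b :+ a) :+ c) refl P (t (+ 0)) (∑< (2 ℕ.+ K) (t ∘ -[1+_])) ⟩
    ∑± (2 ℕ.+ K) t
      ≡⟨ ∑±-indep N (2 ℕ.+ K) t q (λ m lt → q m (ℕₚ.≤-<-trans (ℕₚ.m≤n⇒m≤o+n 2 (ℕₚ.m≤n+m N M)) lt)) ⟨
    ∑± N t
      ∎
    where
    K = M ℕ.+ N
    P = ∑< (2 ℕ.+ K) (λ i → t (+ suc i))

  ∣suc∣-bound : ∀ N m → suc N ℕ.< ∣ m ∣ → N ℕ.< ∣ ℤ.suc m ∣
  ∣suc∣-bound N (+ n)          lt       = ℕₚ.≤-trans (ℕₚ.≤-trans (ℕₚ.n≤1+n (suc N)) lt) (ℕₚ.n≤1+n n)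
  ∣suc∣-bound N -[1+ zero ]    (s≤s ())
  ∣suc∣-bound N -[1+ suc n ]   (s≤s lt) = lt

  +-suc-ℤ : ∀ m b → m ℤ.+ + suc b ≡ ℤ.suc (m ℤ.+ + b)
  +-suc-ℤ m b = trans (sym (ℤₚ.+-assoc m (+ 1) (+ b)))
                (trans (cong (ℤ._+ + b) (ℤₚ.+-comm m (+ 1))) (ℤₚ.+-assoc (+ 1) m (+ b)))

  ∑±-shift : ∀ b M N t → (∀ m → M ℕ.< ∣ m ∣ → t (m ℤ.+ + b) ≡ 0ℚ) → (∀ m → N ℕ.< ∣ m ∣ → t m ≡ 0ℚ) →
             ∑± M (λ m → t (m ℤ.+ + b)) ≡ ∑± N t
  ∑±-shift zero    M N t p q = trans
    (∑±-cong M {λ m → t (m ℤ.+ + 0)} {t} λ m → cong t (ℤₚ.+-identityʳ m))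
    (∑±-indep M N t (λ m lt → trans (cong t (sym (ℤₚ.+-identityʳ m))) (p m lt)) q)
  ∑±-shift (suc b) M N t p q = begin
    ∑± M (λ m → t (m ℤ.+ + suc b))
      ≡⟨ ∑±-cong M {λ m → t (m ℤ.+ + suc b)} {λ m → t (ℤ.suc (m ℤ.+ + b))} (λ m → cong t (+-suc-ℤ m b)) ⟩
    ∑± M (λ m → t (ℤ.suc (m ℤ.+ + b)))
      ≡⟨ ∑±-shift b M (suc N) (t ∘ ℤ.suc) (λ m lt → trans (cong t (sym (+-suc-ℤ m b))) (p m lt)) q′ ⟩
    ∑± (suc N) (t ∘ ℤ.suc)
      ≡⟨ ∑±-suc (suc N) N t q′ q ⟩
    ∑± N t
      ∎
    where
    q′ : ∀ m → suc N ℕ.< ∣ m ∣ → t (ℤ.suc m) ≡ 0ℚ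
    q′ m lt = q (ℤ.suc m) (∣suc∣-bound N m lt)

  -- Univariate polynomials

  horner : List ℚ → ℚ → ℚ
  horner []       x = 0ℚ
  horner (c ∷ cs) x = c ℚ.+ x ℚ.* horner cs x

  infixl 6 _⊞_
  infixl 7 _⊡_ _⊠_

  _⊞_ : List ℚ → List ℚ → List ℚ
  []       ⊞ ds       = ds
  (c ∷ cs) ⊞ []       = c ∷ cs
  (c ∷ cs) ⊞ (d ∷ ds) = c ℚ.+ d ∷ cs ⊞ ds

  _⊡_ : ℚ → List ℚ → List ℚ
  q ⊡ []       = []
  q ⊡ (c ∷ cs) = q ℚ.* c ∷ q ⊡ cs

  _⊠_ : List ℚ → List ℚ → List ℚ
  []       ⊠ ds = []
  (c ∷ cs) ⊠ ds = c ⊡ ds ⊞ (0ℚ ∷ cs ⊠ ds)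

  horner-⊞ : ∀ cs ds x → horner (cs ⊞ ds) x ≡ horner cs x ℚ.+ horner ds x
  horner-⊞ []       ds       x = sym (ℚₚ.+-identityˡ (horner ds x))
  horner-⊞ (c ∷ cs) []       x = sym (ℚₚ.+-identityʳ (horner (c ∷ cs) x))
  horner-⊞ (c ∷ cs) (d ∷ ds) x = trans (cong (λ z → c ℚ.+ d ℚ.+ x ℚ.* z) (horner-⊞ cs ds x))
    (solve 5 (λ c d x s t → c :+ d :+ x :* (s :+ t) := (c :+ x :* s) :+ (d :+ x :* t)) refl c d x
        (horner cs x) (horner ds x))

  horner-⊡ : ∀ q cs x → horner (q ⊡ cs) x ≡ q ℚ.* horner cs x
  horner-⊡ q []       x = sym (ℚₚ.*-zeroʳ q)
  horner-⊡ q (c ∷ cs) x = trans (cong (λ z → q ℚ.* c ℚ.+ x ℚ.* z) (horner-⊡ q cs x))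
    (solve 4 (λ q c x s → q :* c :+ x :* (q :* s) := q :* (c :+ x :* s)) refl q c x (horner cs x))

  horner-⊠ : ∀ cs ds x → horner (cs ⊠ ds) x ≡ horner cs x ℚ.* horner ds x
  horner-⊠ []       ds x = sym (ℚₚ.*-zeroˡ (horner ds x))
  horner-⊠ (c ∷ cs) ds x = begin
    horner (c ⊡ ds ⊞ (0ℚ ∷ cs ⊠ ds)) x
      ≡⟨ horner-⊞ (c ⊡ ds) (0ℚ ∷ cs ⊠ ds) x ⟩
    horner (c ⊡ ds) x ℚ.+ (0ℚ ℚ.+ x ℚ.* horner (cs ⊠ ds) x)
      ≡⟨ cong₂ (λ y z → y ℚ.+ (0ℚ ℚ.+ x ℚ.* z)) (horner-⊡ c ds x) (horner-⊠ cs ds x) ⟩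
    c ℚ.* horner ds x ℚ.+ (0ℚ ℚ.+ x ℚ.* (horner cs x ℚ.* horner ds x))
      ≡⟨ solve 4 (λ c d x s → c :* d :+ (con 0ℚ :+ x :* (s :* d)) := (c :+ x :* s) :* d) refl c (horner ds x)
          x (horner cs x) ⟩
    horner (c ∷ cs) x ℚ.* horner ds x
      ∎

  -- Synthetic division of c ∷ cs by x - a; the quotient does not depend on c.
  divide : ℚ → List ℚ → List ℚ
  divide a []       = []
  divide a (c ∷ cs) = horner (c ∷ cs) a ∷ divide a cs

  length-divide : ∀ a cs → length (divide a cs) ≡ length cs
  length-divide a []       = refl
  length-divide a (c ∷ cs) = cong suc (length-divide a cs)

  horner-divide : ∀ a c cs x → horner (c ∷ cs) x ≡ (x ℚ.- a) ℚ.* horner (divide a cs) x ℚ.+ horner (c ∷ cs) a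
  horner-divide a c []       x =
    solve 3 (λ a c x → c :+ x :* con 0ℚ := (x :- a) :* con 0ℚ :+ (c :+ a :* con 0ℚ)) refl a c x
  horner-divide a c (d ∷ ds) x = begin
    c ℚ.+ x ℚ.* horner (d ∷ ds) x
      ≡⟨ cong (λ z → c ℚ.+ x ℚ.* z) (horner-divide a d ds x) ⟩
    c ℚ.+ x ℚ.* ((x ℚ.- a) ℚ.* horner (divide a ds) x ℚ.+ horner (d ∷ ds) a)
      ≡⟨ solve 5 (λ a c x s t → c :+ x :* ((x :- a) :* s :+ t) := (x :- a) :* (t :+ x :* s) :+ (c :+ a :* t))
          refl
           a c x (horner (divide a ds) x) (horner (d ∷ ds) a) ⟩
    (x ℚ.- a) ℚ.* (horner (d ∷ ds) a ℚ.+ x ℚ.* horner (divide a ds) x) ℚ.+ (c ℚ.+ a ℚ.* horner (d ∷ ds) a)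
      ∎

  fromℕ-∸ : ∀ m n → fromℕ (m ℕ.+ n) ℚ.- fromℕ n ≡ fromℕ m
  fromℕ-∸ m n = trans (cong (ℚ._- fromℕ n) (fromℕ-+ m n))
      (solve 2 (λ m n → (m :+ n) :- n := m) refl (fromℕ m) (fromℕ n))

  -- The zero at N is split off by synthetic division; the quotient vanishes at every j > N, where j
  -- - N can be cancelled. The bound `l` drives the recursion, as the quotient is not a subterm of
  -- the list.
  horner-vanish : ∀ l cs → length cs ℕ.≤ l → ∀ N → (∀ j → N ℕ.≤ j → horner cs (fromℕ j) ≡ 0ℚ) →
                  ∀ x → horner cs x ≡ 0ℚ
  horner-vanish l       []       _        N p x = refl
  horner-vanish (suc l) (c ∷ cs) (s≤s le) N p x = begin
    horner (c ∷ cs) x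
      ≡⟨ horner-divide a c cs x ⟩
    (x ℚ.- a) ℚ.* horner (divide a cs) x ℚ.+ horner (c ∷ cs) a
      ≡⟨ cong₂ (λ y z → (x ℚ.- a) ℚ.* y ℚ.+ z)
          (horner-vanish l (divide a cs) (subst (ℕ._≤ l) (sym (length-divide a cs)) le) (suc N) quotient x)
          (p N ℕₚ.≤-refl) ⟩
    (x ℚ.- a) ℚ.* 0ℚ ℚ.+ 0ℚ
      ≡⟨ solve 1 (λ y → y :* con 0ℚ :+ con 0ℚ := con 0ℚ) refl (x ℚ.- a) ⟩
    0ℚ
      ∎
    where
    a = fromℕ N

    quotient : ∀ j → suc N ℕ.≤ j → horner (divide a cs) (fromℕ j) ≡ 0ℚ
    quotient j N<j = *-cancelˡ-≢0 (fromℕ-suc≢0 m) (begin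
      fromℕ (suc m) ℚ.* horner (divide a cs) (fromℕ j)
        ≡⟨ cong (ℚ._* horner (divide a cs) (fromℕ j))
            (trans (cong (λ i → fromℕ i ℚ.- a) j≡) (fromℕ-∸ (suc m) N)) ⟨
      (fromℕ j ℚ.- a) ℚ.* horner (divide a cs) (fromℕ j)
        ≡⟨ ℚₚ.+-identityʳ _ ⟨
      (fromℕ j ℚ.- a) ℚ.* horner (divide a cs) (fromℕ j) ℚ.+ 0ℚ
        ≡⟨ cong ((fromℕ j ℚ.- a) ℚ.* horner (divide a cs) (fromℕ j) ℚ.+_) (p N ℕₚ.≤-refl) ⟨
      (fromℕ j ℚ.- a) ℚ.* horner (divide a cs) (fromℕ j) ℚ.+ horner (c ∷ cs) a
        ≡⟨ horner-divide a c cs (fromℕ j) ⟨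
      horner (c ∷ cs) (fromℕ j)
        ≡⟨ p j (ℕₚ.<⇒≤ N<j) ⟩
      0ℚ
        ≡⟨ ℚₚ.*-zeroʳ (fromℕ (suc m)) ⟨
      fromℕ (suc m) ℚ.* 0ℚ
        ∎)
      where
      m = j ℕ.∸ suc N
      j≡ : j ≡ suc m ℕ.+ N
      j≡ = sym (trans (sym (ℕₚ.+-suc m N)) (ℕₚ.m∸n+n≡m N<j))

  IsPolynomial : (ℚ → ℚ) → Set
  IsPolynomial f = Σ[ cs ∈ List ℚ ] ∀ x → f x ≡ horner cs x

  const-poly : ∀ q → IsPolynomial (λ _ → q)
  const-poly q = q ∷ [] , λ x → solve 2 (λ q x → q := q :+ x :* con 0ℚ) refl q x

  id-poly : IsPolynomial (λ x → x)
  id-poly = 0ℚ ∷ 1ℚ ∷ [] , solve 1 (λ x → x := con 0ℚ :+ x :* (con 1ℚ :+ x :* con 0ℚ)) refl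

  +-poly : ∀ {f g} → IsPolynomial f → IsPolynomial g → IsPolynomial (λ x → f x ℚ.+ g x)
  +-poly (cs , p) (ds , q) = cs ⊞ ds , λ x → trans (cong₂ ℚ._+_ (p x) (q x)) (sym (horner-⊞ cs ds x))

  *-poly : ∀ {f g} → IsPolynomial f → IsPolynomial g → IsPolynomial (λ x → f x ℚ.* g x)
  *-poly (cs , p) (ds , q) = cs ⊠ ds , λ x → trans (cong₂ ℚ._*_ (p x) (q x)) (sym (horner-⊠ cs ds x))

  ^-poly : ∀ {f} → IsPolynomial f → ∀ k → IsPolynomial (λ x → f x ^ℚ k)
  ^-poly     p zero    = const-poly 1ℚ
  ^-poly {f} p (suc k) = *-poly {f} {λ x → f x ^ℚ k} p (^-poly {f} p k)

  evalℚ-poly : ∀ Q b → IsPolynomial (λ x → evalℚ Q (b ∷ x ∷ []))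
  evalℚ-poly []                    b = const-poly 0ℚ
  evalℚ-poly ((q , i ∷ k ∷ []) ∷ Q) b = +-poly {λ x → q ℚ.* (b ^ℚ i ℚ.* (x ^ℚ k ℚ.* 1ℚ))}
      {λ x → evalℚ Q (b ∷ x ∷ [])}
    (*-poly {λ _ → q} {λ x → b ^ℚ i ℚ.* (x ^ℚ k ℚ.* 1ℚ)} (const-poly q)
      (*-poly {λ _ → b ^ℚ i} {λ x → x ^ℚ k ℚ.* 1ℚ} (const-poly (b ^ℚ i))
        (*-poly {λ x → x ^ℚ k} {λ _ → 1ℚ} (^-poly {λ x → x} id-poly k) (const-poly 1ℚ))))
    (evalℚ-poly Q b)

  -- Agreement is asked for only from some N on, since the identity that characterises Q is
  -- available only for j > b.
  polynomial-unique : ∀ {f g} → IsPolynomial f → IsPolynomial g →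
                      ∀ N → (∀ j → N ℕ.≤ j → f (fromℕ j) ≡ g (fromℕ j)) → ∀ x → f x ≡ g x
  polynomial-unique {f} {g} (cs , p) (ds , q) N f≡g x = begin
    f x                                    ≡⟨ solve 2 (λ f g → f := (f :+ con (ℚ.- 1ℚ) :* g) :+ g) refl (f x)
        (g x) ⟩
    (f x ℚ.+ (ℚ.- 1ℚ) ℚ.* g x) ℚ.+ g x     ≡⟨ cong (ℚ._+ g x)
        (trans (difference x) (horner-vanish (length es) es ℕₚ.≤-refl N vanishes x)) ⟩
    0ℚ ℚ.+ g x                             ≡⟨ ℚₚ.+-identityˡ (g x) ⟩
    g x                                    ∎
    where
    es = cs ⊞ (ℚ.- 1ℚ) ⊡ ds

    difference : ∀ x → f x ℚ.+ (ℚ.- 1ℚ) ℚ.* g x ≡ horner es x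
    difference x = trans (cong₂ (λ y z → y ℚ.+ (ℚ.- 1ℚ) ℚ.* z) (p x) (q x))
      (trans (cong (horner cs x ℚ.+_) (sym (horner-⊡ (ℚ.- 1ℚ) ds x))) (sym (horner-⊞ cs ((ℚ.- 1ℚ) ⊡ ds) x)))

    vanishes : ∀ j → N ℕ.≤ j → horner es (fromℕ j) ≡ 0ℚ
    vanishes j N≤j = trans (sym (difference (fromℕ j)))
        (trans (cong (ℚ._+ (ℚ.- 1ℚ) ℚ.* g (fromℕ j)) (f≡g j N≤j))
      (solve 1 (λ g → g :+ con (ℚ.- 1ℚ) :* g := con 0ℚ) refl (g (fromℕ j))))

  -- Binomial coefficients

  binom : ℕ → ℕ → ℚ
  binom n k = fromℕ (n C k)

  binom-pascal : ∀ n k → binom (suc n) (suc k) ≡ binom n k ℚ.+ binom n (suc k)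
  binom-pascal n k = trans (cong fromℕ (sym (nCk+nC[k+1]≡[n+1]C[k+1] n k))) (fromℕ-+ (n C k) (n C suc k))

  -- Derived from Pascal's rule, hence valid also for k ≥ n. This range matters: binom(2k+1+p, 2p+1)
  -- has its lower index above the upper one when p > 2k, and the polynomial in k must then give 0.
  binom-sucʳ : ∀ n k → fromℕ (suc k) ℚ.* binom n (suc k) ≡ (fromℕ n ℚ.- fromℕ k) ℚ.* binom n k
  binom-sucʳ zero    zero    = refl
  binom-sucʳ zero    (suc k) = trans (ℚₚ.*-zeroʳ (fromℕ (suc (suc k))))
      (sym (ℚₚ.*-zeroʳ (fromℕ 0 ℚ.- fromℕ (suc k))))
  binom-sucʳ (suc n) zero    = begin
    1ℚ ℚ.* binom (suc n) 1                        ≡⟨ cong (1ℚ ℚ.*_) (binom-pascal n 0) ⟩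
    1ℚ ℚ.* (1ℚ ℚ.+ binom n 1)
        ≡⟨ solve 1 (λ c → con 1ℚ :* (con 1ℚ :+ c) := con 1ℚ :+ con 1ℚ :* c) refl (binom n 1) ⟩
    1ℚ ℚ.+ 1ℚ ℚ.* binom n 1                       ≡⟨ cong (1ℚ ℚ.+_) (binom-sucʳ n 0) ⟩
    1ℚ ℚ.+ (fromℕ n ℚ.- 0ℚ) ℚ.* 1ℚ
        ≡⟨ solve 1 (λ n → con 1ℚ :+ (n :- con 0ℚ) :* con 1ℚ := ((con 1ℚ :+ n) :- con 0ℚ) :* con 1ℚ) refl
        (fromℕ n) ⟩
    ((1ℚ ℚ.+ fromℕ n) ℚ.- 0ℚ) ℚ.* 1ℚ              ≡⟨ cong (λ m → (m ℚ.- 0ℚ) ℚ.* 1ℚ) (fromℕ-suc n) ⟨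
    (fromℕ (suc n) ℚ.- 0ℚ) ℚ.* 1ℚ                 ∎
  binom-sucʳ (suc n) (suc k) = begin
    fromℕ (suc (suc k)) ℚ.* binom (suc n) (suc (suc k))
      ≡⟨ cong₂ ℚ._*_ (fromℕ-suc (suc k)) (binom-pascal n (suc k)) ⟩
    (1ℚ ℚ.+ k₁) ℚ.* (c₁ ℚ.+ c₂)
      ≡⟨ solve 3 (λ k₁ c₁ c₂ → (con 1ℚ :+ k₁) :* (c₁ :+ c₂) := (con 1ℚ :+ k₁) :* c₁ :+ (con 1ℚ :+ k₁) :* c₂)
          refl k₁ c₁ c₂ ⟩
    (1ℚ ℚ.+ k₁) ℚ.* c₁ ℚ.+ (1ℚ ℚ.+ k₁) ℚ.* c₂
      ≡⟨ cong ((1ℚ ℚ.+ k₁) ℚ.* c₁ ℚ.+_) (trans (cong (ℚ._* c₂) (sym (fromℕ-suc (suc k))))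
          (binom-sucʳ n (suc k))) ⟩
    (1ℚ ℚ.+ k₁) ℚ.* c₁ ℚ.+ (fromℕ n ℚ.- k₁) ℚ.* c₁
      ≡⟨ solve 3 (λ k₁ n c₁ → (con 1ℚ :+ k₁) :* c₁ :+ (n :- k₁) :* c₁ := k₁ :* c₁ :+ (con 1ℚ :+ n :- k₁) :*
          c₁) refl k₁ (fromℕ n) c₁ ⟩
    k₁ ℚ.* c₁ ℚ.+ (1ℚ ℚ.+ fromℕ n ℚ.- k₁) ℚ.* c₁
      ≡⟨ cong (ℚ._+ (1ℚ ℚ.+ fromℕ n ℚ.- k₁) ℚ.* c₁) (binom-sucʳ n k) ⟩
    (fromℕ n ℚ.- fromℕ k) ℚ.* c₀ ℚ.+ (1ℚ ℚ.+ fromℕ n ℚ.- k₁) ℚ.* c₁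
      ≡⟨ cong (λ z → z ℚ.* c₀ ℚ.+ (1ℚ ℚ.+ fromℕ n ℚ.- k₁) ℚ.* c₁)
           (trans (solve 2 (λ n k → n :- k := con 1ℚ :+ n :- (con 1ℚ :+ k)) refl (fromℕ n) (fromℕ k))
                  (cong (λ z → 1ℚ ℚ.+ fromℕ n ℚ.- z) (sym (fromℕ-suc k)))) ⟩
    (1ℚ ℚ.+ fromℕ n ℚ.- k₁) ℚ.* c₀ ℚ.+ (1ℚ ℚ.+ fromℕ n ℚ.- k₁) ℚ.* c₁
      ≡⟨ ℚₚ.*-distribˡ-+ (1ℚ ℚ.+ fromℕ n ℚ.- k₁) c₀ c₁ ⟨
    (1ℚ ℚ.+ fromℕ n ℚ.- k₁) ℚ.* (c₀ ℚ.+ c₁)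
      ≡⟨ cong₂ (λ m c → (m ℚ.- k₁) ℚ.* c) (fromℕ-suc n) (binom-pascal n k) ⟨
    (fromℕ (suc n) ℚ.- k₁) ℚ.* binom (suc n) (suc k)
      ∎
    where
    k₁ = fromℕ (suc k)
    c₀ = binom n k
    c₁ = binom n (suc k)
    c₂ = binom n (suc (suc k))

  binom-suc-suc : ∀ n k → fromℕ (suc k) ℚ.* binom (suc n) (suc k) ≡ fromℕ (suc n) ℚ.* binom n k
  binom-suc-suc n k = begin
    fromℕ (suc k) ℚ.* binom (suc n) (suc k)
      ≡⟨ trans (cong (fromℕ (suc k) ℚ.*_) (binom-pascal n k))
          (ℚₚ.*-distribˡ-+ (fromℕ (suc k)) (binom n k) (binom n (suc k))) ⟩
    fromℕ (suc k) ℚ.* binom n k ℚ.+ fromℕ (suc k) ℚ.* binom n (suc k)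
      ≡⟨ cong₂ ℚ._+_ (cong (ℚ._* binom n k) (fromℕ-suc k)) (binom-sucʳ n k) ⟩
    (1ℚ ℚ.+ fromℕ k) ℚ.* binom n k ℚ.+ (fromℕ n ℚ.- fromℕ k) ℚ.* binom n k
      ≡⟨ solve 3 (λ k n c → (con 1ℚ :+ k) :* c :+ (n :- k) :* c := (con 1ℚ :+ n) :* c) refl (fromℕ k)
          (fromℕ n) (binom n k) ⟩
    (1ℚ ℚ.+ fromℕ n) ℚ.* binom n k
      ≡⟨ cong (ℚ._* binom n k) (fromℕ-suc n) ⟨
    fromℕ (suc n) ℚ.* binom n k
      ∎

  nCk>0 : ∀ n k → k ℕ.≤ n → 0 ℕ.< n C k
  nCk>0 n       zero    _         = s≤s z≤n
  nCk>0 (suc n) (suc k) (s≤s k≤n) = subst (0 ℕ.<_) (nCk+nC[k+1]≡[n+1]C[k+1] n k)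
      (ℕₚ.m≤n⇒m≤n+o (n C suc k) (nCk>0 n k k≤n))

  binom≢0 : ∀ n k → k ℕ.≤ n → binom n k ≢ 0ℚ
  binom≢0 n k k≤n with n C k | nCk>0 n k k≤n
  ... | suc m | _ = fromℕ-suc≢0 m

  -- Summation by telescoping

  -- A polynomial in n with coefficients polynomial in k. The length bounds the degree in n, which
  -- decides how many derivatives of R occur; the degree in k is left free.
  horner₂ : ∀ {l} → Vec (List ℚ) l → ℚ → ℚ → ℚ
  horner₂ []       k n = 0ℚ
  horner₂ (c ∷ cs) k n = horner c k ℚ.+ n ℚ.* horner₂ cs k n

  horner₂-zipWith : ∀ {l} (cs ds : Vec (List ℚ) l) k n →
                    horner₂ (Vec.zipWith _⊞_ cs ds) k n ≡ horner₂ cs k n ℚ.+ horner₂ ds k n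
  horner₂-zipWith []       []       k n = refl
  horner₂-zipWith (c ∷ cs) (d ∷ ds) k n = trans
    (cong₂ (λ y z → y ℚ.+ n ℚ.* z) (horner-⊞ c d k) (horner₂-zipWith cs ds k n))
    (solve 5 (λ c d n s t → c :+ d :+ n :* (s :+ t) := (c :+ n :* s) :+ (d :+ n :* t)) refl
      (horner c k) (horner d k) n (horner₂ cs k n) (horner₂ ds k n))

  horner₂-map : ∀ {l} f (cs : Vec (List ℚ) l) k n → horner₂ (Vec.map (f ⊠_) cs) k n ≡ horner f k ℚ.* horner₂
      cs k n
  horner₂-map f []       k n = sym (ℚₚ.*-zeroʳ (horner f k))
  horner₂-map f (c ∷ cs) k n = trans
    (cong₂ (λ y z → y ℚ.+ n ℚ.* z) (horner-⊠ f c k) (horner₂-map f cs k n))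
    (solve 4 (λ f c n s → f :* c :+ n :* (f :* s) := f :* (c :+ n :* s)) refl (horner f k) (horner c k) n
        (horner₂ cs k n))

  horner₂-pad : ∀ {l} (cs : Vec (List ℚ) l) k n → horner₂ (cs Vec.∷ʳ []) k n ≡ horner₂ cs k n
  horner₂-pad []       k n = trans (ℚₚ.+-identityˡ (n ℚ.* 0ℚ)) (ℚₚ.*-zeroʳ n)
  horner₂-pad (c ∷ cs) k n = cong (λ z → horner c k ℚ.+ n ℚ.* z) (horner₂-pad cs k n)

  horner₂-poly : ∀ {l} (cs : Vec (List ℚ) l) b → IsPolynomial (λ x → horner₂ cs b (x ℚ.+ b))
  horner₂-poly []       b = const-poly 0ℚ
  horner₂-poly (c ∷ cs) b = +-poly {λ _ → horner c b} {λ x → (x ℚ.+ b) ℚ.* horner₂ cs b (x ℚ.+ b)}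
      (const-poly (horner c b))
    (*-poly {λ x → x ℚ.+ b} {λ x → horner₂ cs b (x ℚ.+ b)} (+-poly {λ x → x} {λ _ → b} id-poly (const-poly b))
        (horner₂-poly cs b))

  -- The relation makes a(k) binom(2j-1, j+k) the difference t(k) - t(k+1) of
  -- t(k) = (j+k) h(k, j+k) binom(2j-1, j+k), because
  -- (j+k+1) binom(2j-1, j+k+1) = (j-k-1) binom(2j-1, j+k).
  Telescopes : (ℚ → ℚ) → (ℚ → ℚ → ℚ) → Set
  Telescopes a h = ∀ k j →
    (j ℚ.+ k) ℚ.* h k (j ℚ.+ k) ≡ a k ℚ.+ (j ℚ.- k ℚ.- 1ℚ) ℚ.* h (k ℚ.+ 1ℚ) (j ℚ.+ k ℚ.+ 1ℚ)

  Summable : ℕ → (ℚ → ℚ) → Set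
  Summable p a = Σ[ cs ∈ Vec (List ℚ) (suc p) ] Telescopes a (horner₂ cs)

  Telescopes-cong : ∀ {a a′ h h′} → (∀ k → a k ≡ a′ k) → (∀ k n → h k n ≡ h′ k n) → Telescopes a h →
      Telescopes a′ h′
  Telescopes-cong {a} {a′} {h} {h′} a≡ h≡ t k j = begin
    (j ℚ.+ k) ℚ.* h′ k (j ℚ.+ k)   ≡⟨ cong ((j ℚ.+ k) ℚ.*_) (h≡ k (j ℚ.+ k)) ⟨
    (j ℚ.+ k) ℚ.* h k (j ℚ.+ k)    ≡⟨ t k j ⟩
    a k ℚ.+ (j ℚ.- k ℚ.- 1ℚ) ℚ.* h (k ℚ.+ 1ℚ) (j ℚ.+ k ℚ.+ 1ℚ)
      ≡⟨ cong₂ (λ y z → y ℚ.+ (j ℚ.- k ℚ.- 1ℚ) ℚ.* z) (a≡ k) (h≡ (k ℚ.+ 1ℚ) (j ℚ.+ k ℚ.+ 1ℚ)) ⟩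
    a′ k ℚ.+ (j ℚ.- k ℚ.- 1ℚ) ℚ.* h′ (k ℚ.+ 1ℚ) (j ℚ.+ k ℚ.+ 1ℚ) ∎

  Summable-cong : ∀ {p a a′} → (∀ k → a k ≡ a′ k) → Summable p a → Summable p a′
  Summable-cong {a = a} {a′} a≡ (cs , t) = cs , Telescopes-cong {a} {a′} {horner₂ cs} {horner₂ cs} a≡
      (λ _ _ → refl) t

  Summable-suc : ∀ {p a} → Summable p a → Summable (suc p) a
  Summable-suc {a = a} (cs , t) = cs Vec.∷ʳ [] ,
    Telescopes-cong {a} {a} {horner₂ cs} {horner₂ (cs Vec.∷ʳ [])} (λ _ → refl)
        (λ k n → sym (horner₂-pad cs k n)) t

  Summable-combine : ∀ {p a b} α β → Summable p a → Summable p b → Summable p (λ k → α ℚ.* a k ℚ.+ β ℚ.* b k)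
  Summable-combine {a = a} {b} α β (cs , s) (ds , t) = es ,
    Telescopes-cong {λ k → α ℚ.* a k ℚ.+ β ℚ.* b k} {λ k → α ℚ.* a k ℚ.+ β ℚ.* b k}
      {λ k n → α ℚ.* horner₂ cs k n ℚ.+ β ℚ.* horner₂ ds k n} {horner₂ es} (λ _ → refl)
          (λ k n → sym (es≡ k n)) λ k j → begin
      (j ℚ.+ k) ℚ.* (α ℚ.* H k (j ℚ.+ k) ℚ.+ β ℚ.* G k (j ℚ.+ k))
        ≡⟨ solve 5 (λ n α β H G → n :* (α :* H :+ β :* G) := α :* (n :* H) :+ β :* (n :* G)) refl (j ℚ.+ k) α
            β (H k (j ℚ.+ k)) (G k (j ℚ.+ k)) ⟩
      α ℚ.* ((j ℚ.+ k) ℚ.* H k (j ℚ.+ k)) ℚ.+ β ℚ.* ((j ℚ.+ k) ℚ.* G k (j ℚ.+ k))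
        ≡⟨ cong₂ (λ y z → α ℚ.* y ℚ.+ β ℚ.* z) (s k j) (t k j) ⟩
      α ℚ.* (a k ℚ.+ (j ℚ.- k ℚ.- 1ℚ) ℚ.* H (k ℚ.+ 1ℚ) (j ℚ.+ k ℚ.+ 1ℚ)) ℚ.+ β ℚ.*
          (b k ℚ.+ (j ℚ.- k ℚ.- 1ℚ) ℚ.* G (k ℚ.+ 1ℚ) (j ℚ.+ k ℚ.+ 1ℚ))
        ≡⟨ solve 7 (λ α β a b m H G → α :* (a :+ m :* H) :+ β :* (b :+ m :* G) := (α :* a :+ β :* b) :+ m :*
            (α :* H :+ β :* G)) refl
             α β (a k) (b k) (j ℚ.- k ℚ.- 1ℚ) (H (k ℚ.+ 1ℚ) (j ℚ.+ k ℚ.+ 1ℚ))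
                 (G (k ℚ.+ 1ℚ) (j ℚ.+ k ℚ.+ 1ℚ)) ⟩
      (α ℚ.* a k ℚ.+ β ℚ.* b k) ℚ.+ (j ℚ.- k ℚ.- 1ℚ) ℚ.*
          (α ℚ.* H (k ℚ.+ 1ℚ) (j ℚ.+ k ℚ.+ 1ℚ) ℚ.+ β ℚ.* G (k ℚ.+ 1ℚ) (j ℚ.+ k ℚ.+ 1ℚ))
        ∎
    where
    H = horner₂ cs
    G = horner₂ ds
    es = Vec.zipWith _⊞_ (Vec.map ((α ∷ []) ⊠_) cs) (Vec.map ((β ∷ []) ⊠_) ds)
    es≡ : ∀ k n → horner₂ es k n ≡ α ℚ.* H k n ℚ.+ β ℚ.* G k n
    es≡ k n = trans (horner₂-zipWith (Vec.map ((α ∷ []) ⊠_) cs) (Vec.map ((β ∷ []) ⊠_) ds) k n)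
      (cong₂ ℚ._+_ (trans (horner₂-map (α ∷ []) cs k n) (cong (ℚ._* H k n) (sym (proj₂ (const-poly α) k))))
                   (trans (horner₂-map (β ∷ []) ds k n) (cong (ℚ._* G k n) (sym (proj₂ (const-poly β) k)))))

  -- basis s = (2k+1) ∏ (k²+k - i(i-1)) over 1 ≤ i ≤ s, and these span the odd
  -- polynomials in 2k+1; squares s = ∏ (k² - i²) over 0 ≤ i ≤ s.  Telescoping with
  -- h(k, n) = squares s produces basis (s+1) up to a multiple of basis s, linear in j.

  common : ℕ → ℚ → ℚ
  common zero    k = 1ℚ
  common (suc s) k = common s k ℚ.* (k ℚ.* k ℚ.+ k ℚ.- (1ℚ ℚ.+ fromℕ s) ℚ.* fromℕ s)

  basis : ℕ → ℚ → ℚ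
  basis s k = (k ℚ.+ k ℚ.+ 1ℚ) ℚ.* common s k

  squares : ℕ → List ℚ
  squares zero    = 0ℚ ∷ 0ℚ ∷ 1ℚ ∷ []
  squares (suc s) = squares s ⊠ (ℚ.- ((1ℚ ℚ.+ fromℕ s) ℚ.* (1ℚ ℚ.+ fromℕ s)) ∷ 0ℚ ∷ 1ℚ ∷ [])

  squares-suc : ∀ s k → horner (squares (suc s)) k ≡ horner (squares s) k ℚ.*
      (k ℚ.* k ℚ.- (1ℚ ℚ.+ fromℕ s) ℚ.* (1ℚ ℚ.+ fromℕ s))
  squares-suc s k = trans (horner-⊠ (squares s) _ k) (cong (horner (squares s) k ℚ.*_)
    (solve 2 (λ σ k → :- (σ :* σ) :+ k :* (con 0ℚ :+ k :* (con 1ℚ :+ k :* con 0ℚ)) := k :* k :- σ :* σ) refl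
        (1ℚ ℚ.+ fromℕ s) k))

  -- `common s k` is the product of the 2s consecutive factors k-s+1, ..., k+s. These are the
  -- factors that `squares s` has in common at k and at k+1; here and in `squares-right` the
  -- remaining two are displayed.
  squares-left : ∀ s k → horner (squares s) k ≡ k ℚ.* (k ℚ.- fromℕ s) ℚ.* common s k
  squares-left zero    k = solve 1 (λ k → con 0ℚ :+ k :* (con 0ℚ :+ k :* (con 1ℚ :+ k :* con 0ℚ)) := k :*
      (k :- con 0ℚ) :* con 1ℚ) refl k
  squares-left (suc s) k = begin
    horner (squares (suc s)) k
      ≡⟨ trans (squares-suc s k) (cong (ℚ._* (k ℚ.* k ℚ.- (1ℚ ℚ.+ fromℕ s) ℚ.* (1ℚ ℚ.+ fromℕ s)))
          (squares-left s k)) ⟩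
    k ℚ.* (k ℚ.- fromℕ s) ℚ.* common s k ℚ.* (k ℚ.* k ℚ.- (1ℚ ℚ.+ fromℕ s) ℚ.* (1ℚ ℚ.+ fromℕ s))
      ≡⟨ solve 3 (λ k s c → k :* (k :- s) :* c :* (k :* k :- (con 1ℚ :+ s) :* (con 1ℚ :+ s))
                  := k :* (k :- (con 1ℚ :+ s)) :* (c :* (k :* k :+ k :- (con 1ℚ :+ s) :* s))) refl k (fromℕ s)
                      (common s k) ⟩
    k ℚ.* (k ℚ.- (1ℚ ℚ.+ fromℕ s)) ℚ.* common (suc s) k
      ≡⟨ cong (λ σ → k ℚ.* (k ℚ.- σ) ℚ.* common (suc s) k) (fromℕ-suc s) ⟨
    k ℚ.* (k ℚ.- fromℕ (suc s)) ℚ.* common (suc s) k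
      ∎

  squares-right : ∀ s k → horner (squares s) (k ℚ.+ 1ℚ) ≡ (k ℚ.+ 1ℚ) ℚ.* (k ℚ.+ 1ℚ ℚ.+ fromℕ s) ℚ.* common s k
  squares-right zero    k = solve 1 (λ k → con 0ℚ :+ k :* (con 0ℚ :+ k :* (con 1ℚ :+ k :* con 0ℚ)) := k :*
      (k :+ con 0ℚ) :* con 1ℚ) refl (k ℚ.+ 1ℚ)
  squares-right (suc s) k = begin
    horner (squares (suc s)) k₁
      ≡⟨ trans (squares-suc s k₁) (cong (ℚ._* (k₁ ℚ.* k₁ ℚ.- (1ℚ ℚ.+ fromℕ s) ℚ.* (1ℚ ℚ.+ fromℕ s)))
          (squares-right s k)) ⟩
    k₁ ℚ.* (k₁ ℚ.+ fromℕ s) ℚ.* common s k ℚ.* (k₁ ℚ.* k₁ ℚ.- (1ℚ ℚ.+ fromℕ s) ℚ.* (1ℚ ℚ.+ fromℕ s))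
      ≡⟨ solve 3 (λ k s c → let k₁ = k :+ con 1ℚ in k₁ :* (k₁ :+ s) :* c :*
          (k₁ :* k₁ :- (con 1ℚ :+ s) :* (con 1ℚ :+ s))
                  := k₁ :* (k₁ :+ (con 1ℚ :+ s)) :* (c :* (k :* k :+ k :- (con 1ℚ :+ s) :* s))) refl k
                      (fromℕ s) (common s k) ⟩
    k₁ ℚ.* (k₁ ℚ.+ (1ℚ ℚ.+ fromℕ s)) ℚ.* common (suc s) k
      ≡⟨ cong (λ σ → k₁ ℚ.* (k₁ ℚ.+ σ) ℚ.* common (suc s) k) (fromℕ-suc s) ⟨
    k₁ ℚ.* (k₁ ℚ.+ fromℕ (suc s)) ℚ.* common (suc s) k
      ∎
    where k₁ = k ℚ.+ 1ℚ

  -- Up to the shared factor `common s k` this is a cubic identity in j, k and s. The multiplier of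
  -- `basis s k` is free of k, which lets `basis-summable` absorb that term.
  basis-step : ∀ s k j → (j ℚ.+ k) ℚ.* horner (squares s) k ≡
    (j ℚ.- k ℚ.- 1ℚ) ℚ.* horner (squares s) (k ℚ.+ 1ℚ) ℚ.+ basis (suc s) k ℚ.+ (1ℚ ℚ.+ fromℕ s) ℚ.*
        (1ℚ ℚ.+ fromℕ s ℚ.- j) ℚ.* basis s k
  basis-step s k j = begin
    (j ℚ.+ k) ℚ.* horner (squares s) k
      ≡⟨ cong ((j ℚ.+ k) ℚ.*_) (squares-left s k) ⟩
    (j ℚ.+ k) ℚ.* (k ℚ.* (k ℚ.- fromℕ s) ℚ.* common s k)
      ≡⟨ solve 4 (λ j k s c → (j :+ k) :* (k :* (k :- s) :* c) :=
           (j :- k :- con 1ℚ) :* ((k :+ con 1ℚ) :* (k :+ con 1ℚ :+ s) :* c)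
           :+ (k :+ k :+ con 1ℚ) :* (c :* (k :* k :+ k :- (con 1ℚ :+ s) :* s))
           :+ (con 1ℚ :+ s) :* (con 1ℚ :+ s :- j) :* ((k :+ k :+ con 1ℚ) :* c)) refl j k (fromℕ s)
               (common s k) ⟩
    (j ℚ.- k ℚ.- 1ℚ) ℚ.* ((k ℚ.+ 1ℚ) ℚ.* (k ℚ.+ 1ℚ ℚ.+ fromℕ s) ℚ.* common s k) ℚ.+ basis (suc s) k ℚ.+ E
      ≡⟨ cong (λ z → (j ℚ.- k ℚ.- 1ℚ) ℚ.* z ℚ.+ basis (suc s) k ℚ.+ E) (squares-right s k) ⟨
    (j ℚ.- k ℚ.- 1ℚ) ℚ.* horner (squares s) (k ℚ.+ 1ℚ) ℚ.+ basis (suc s) k ℚ.+ E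
      ∎
    where
    E = (1ℚ ℚ.+ fromℕ s) ℚ.* (1ℚ ℚ.+ fromℕ s ℚ.- j) ℚ.* basis s k

  -- The remainder σ(σ - j) `basis s` of `basis-step` is a multiple constant in k, so it is
  -- cancelled by adding σ(j - σ) times the `h` that telescopes `basis s`. In the arguments of `h`
  -- one has j = n - k, which is unchanged when k and n both grow by one.
  basis-summable : ∀ s → Summable s (basis s)
  basis-summable zero = (1ℚ ∷ []) ∷ [] , λ k j → solve 2 (λ k j →
    (j :+ k) :* ((con 1ℚ :+ k :* con 0ℚ) :+ (j :+ k) :* con 0ℚ) :=
    (k :+ k :+ con 1ℚ) :* con 1ℚ :+ (j :- k :- con 1ℚ) :*
        ((con 1ℚ :+ (k :+ con 1ℚ) :* con 0ℚ) :+ (j :+ k :+ con 1ℚ) :* con 0ℚ)) refl k j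
  basis-summable (suc s) = es , Telescopes-cong {basis (suc s)} {basis (suc s)}
    {λ k n → horner (squares s) k ℚ.+ σ ℚ.* (n ℚ.- k ℚ.- σ) ℚ.* H k n} {horner₂ es} (λ _ → refl)
        (λ k n → sym (es≡ k n)) λ k j → begin
    (j ℚ.+ k) ℚ.* (horner (squares s) k ℚ.+ σ ℚ.* ((j ℚ.+ k) ℚ.- k ℚ.- σ) ℚ.* H k (j ℚ.+ k))
      ≡⟨ solve 5 (λ j k u σ h → (j :+ k) :* (u :+ σ :* ((j :+ k) :- k :- σ) :* h) := (j :+ k) :* u :+ σ :*
          (j :- σ) :* ((j :+ k) :* h)) refl
           j k (horner (squares s) k) σ (H k (j ℚ.+ k)) ⟩
    (j ℚ.+ k) ℚ.* horner (squares s) k ℚ.+ σ ℚ.* (j ℚ.- σ) ℚ.* ((j ℚ.+ k) ℚ.* H k (j ℚ.+ k))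
      ≡⟨ cong₂ (λ y z → y ℚ.+ σ ℚ.* (j ℚ.- σ) ℚ.* z) (basis-step s k j) (t k j) ⟩
    ((j ℚ.- k ℚ.- 1ℚ) ℚ.* horner (squares s) (k ℚ.+ 1ℚ) ℚ.+ basis (suc s) k ℚ.+ σ ℚ.* (σ ℚ.- j) ℚ.* basis s k)
      ℚ.+ σ ℚ.* (j ℚ.- σ) ℚ.* (basis s k ℚ.+ (j ℚ.- k ℚ.- 1ℚ) ℚ.* H (k ℚ.+ 1ℚ) (j ℚ.+ k ℚ.+ 1ℚ))
      ≡⟨ solve 7 (λ j k u σ a₁ a h →
           ((j :- k :- con 1ℚ) :* u :+ a₁ :+ σ :* (σ :- j) :* a) :+ σ :* (j :- σ) :*
               (a :+ (j :- k :- con 1ℚ) :* h)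
           := a₁ :+ (j :- k :- con 1ℚ) :* (u :+ σ :* ((j :+ k :+ con 1ℚ) :- (k :+ con 1ℚ) :- σ) :* h)) refl
           j k (horner (squares s) (k ℚ.+ 1ℚ)) σ (basis (suc s) k) (basis s k)
               (H (k ℚ.+ 1ℚ) (j ℚ.+ k ℚ.+ 1ℚ)) ⟩
    basis (suc s) k ℚ.+ (j ℚ.- k ℚ.- 1ℚ) ℚ.* (horner (squares s) (k ℚ.+ 1ℚ) ℚ.+ σ ℚ.*
        ((j ℚ.+ k ℚ.+ 1ℚ) ℚ.- (k ℚ.+ 1ℚ) ℚ.- σ) ℚ.* H (k ℚ.+ 1ℚ) (j ℚ.+ k ℚ.+ 1ℚ))
      ∎
    where
    σ = 1ℚ ℚ.+ fromℕ s
    cs = proj₁ (basis-summable s)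
    t = proj₂ (basis-summable s)
    H = horner₂ cs
    -- Splits σ(n - k - σ) as σn + ℓ(k): the part σn raises the degree in n by one, and the part
    -- ℓ(k) is padded to the same length.
    ℓ = ℚ.- (σ ℚ.* σ) ∷ ℚ.- σ ∷ []
    ds = Vec.map (ℓ ⊠_) cs Vec.∷ʳ []
    es = Vec.zipWith _⊞_ (squares s ∷ Vec.map ((σ ∷ []) ⊠_) cs) ds
    es≡ : ∀ k n → horner₂ es k n ≡ horner (squares s) k ℚ.+ σ ℚ.* (n ℚ.- k ℚ.- σ) ℚ.* H k n
    es≡ k n = begin
      horner₂ es k n
        ≡⟨ horner₂-zipWith (squares s ∷ Vec.map ((σ ∷ []) ⊠_) cs) ds k n ⟩
      (horner (squares s) k ℚ.+ n ℚ.* horner₂ (Vec.map ((σ ∷ []) ⊠_) cs) k n) ℚ.+ horner₂ ds k n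
        ≡⟨ cong₂ (λ y z → (horner (squares s) k ℚ.+ n ℚ.* y) ℚ.+ z) (horner₂-map (σ ∷ []) cs k n)
             (trans (horner₂-pad (Vec.map (ℓ ⊠_) cs) k n) (horner₂-map ℓ cs k n)) ⟩
      (horner (squares s) k ℚ.+ n ℚ.* (horner (σ ∷ []) k ℚ.* H k n)) ℚ.+ horner ℓ k ℚ.* H k n
        ≡⟨ solve 5 (λ u n σ k h → (u :+ n :* ((σ :+ k :* con 0ℚ) :* h)) :+
            (:- (σ :* σ) :+ k :* (:- σ :+ k :* con 0ℚ)) :* h
                    := u :+ σ :* (n :- k :- σ) :* h) refl (horner (squares s) k) n σ k (H k n) ⟩
      horner (squares s) k ℚ.+ σ ℚ.* (n ℚ.- k ℚ.- σ) ℚ.* H k n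
        ∎

  -- binom(2k+1+p, 2p+1) as a polynomial in k: the ratio of two consecutive ones is
  -- (2k+2+p)(2k-p) / ((2p+3)(2p+2)), and (2k+2+p)(2k-p) = 4(k²+k) + 1 - (p+1)².

  denominator : ℕ → ℕ
  denominator t = suc (suc (2 ℕ.* t ℕ.+ 1)) ℕ.* suc (2 ℕ.* t ℕ.+ 1)

  denominator≢0 : ∀ t → fromℕ (denominator t) ≢ 0ℚ
  denominator≢0 t = fromℕ-suc≢0 (ℕ.pred (denominator t))

  weightFactor : ℕ → ℚ → ℚ
  weightFactor t κ = (4ℚ ℚ.* κ ℚ.+ (1ℚ ℚ.- (1ℚ ℚ.+ fromℕ t) ℚ.* (1ℚ ℚ.+ fromℕ t))) ℚ.* recip
      (fromℕ (denominator t))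
    where 4ℚ = 1ℚ ℚ.+ 1ℚ ℚ.+ (1ℚ ℚ.+ 1ℚ)

  weightProduct : ℕ → ℚ → ℚ
  weightProduct zero    k = 1ℚ
  weightProduct (suc t) k = weightProduct t k ℚ.* weightFactor t (k ℚ.* k ℚ.+ k)

  -- Since k²+k times `basis s` is `basis (suc s)` plus (s+1)s times `basis s`, each weight factor
  -- is traded for at most one step in s. Hence t + s bounds the degree in n throughout.
  basis*weight-summable : ∀ t s p → t ℕ.+ s ≡ p → Summable p (λ k → basis s k ℚ.* weightProduct t k)
  basis*weight-summable zero    s p       refl = Summable-cong {s} {basis s} {λ k → basis s k ℚ.* 1ℚ}
      (λ k → sym (ℚₚ.*-identityʳ (basis s k))) (basis-summable s)
  basis*weight-summable (suc t) s (suc p) eq   = Summable-cong {suc p}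
    {λ k → α ℚ.* (basis (suc s) k ℚ.* weightProduct t k) ℚ.+ β ℚ.* (basis s k ℚ.* weightProduct t k)}
        {λ k → basis s k ℚ.* weightProduct (suc t) k}
    (λ k → solve 6 (λ k c w s g d → let n = con 1ℚ :+ con 1ℚ :+ (con 1ℚ :+ con 1ℚ) in
         n :* d :* (((k :+ k :+ con 1ℚ) :* (c :* (k :* k :+ k :- (con 1ℚ :+ s) :* s))) :* w)
         :+ (n :* ((con 1ℚ :+ s) :* s) :+ g) :* d :* ((k :+ k :+ con 1ℚ) :* c :* w)
         := (k :+ k :+ con 1ℚ) :* c :* (w :* ((n :* (k :* k :+ k) :+ g) :* d))) refl
       k (common s k) (weightProduct t k) (fromℕ s) γ δ)
    (Summable-combine {suc p} {λ k → basis (suc s) k ℚ.* weightProduct t k}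
        {λ k → basis s k ℚ.* weightProduct t k} α β
      (basis*weight-summable t (suc s) (suc p) (trans (ℕₚ.+-suc t s) eq))
      (Summable-suc {p} {λ k → basis s k ℚ.* weightProduct t k}
          (basis*weight-summable t s p (ℕₚ.suc-injective eq))))
    where
    4ℚ = 1ℚ ℚ.+ 1ℚ ℚ.+ (1ℚ ℚ.+ 1ℚ)
    γ = 1ℚ ℚ.- (1ℚ ℚ.+ fromℕ t) ℚ.* (1ℚ ℚ.+ fromℕ t)
    δ = recip (fromℕ (denominator t))
    α = 4ℚ ℚ.* δ
    β = (4ℚ ℚ.* ((1ℚ ℚ.+ fromℕ s) ℚ.* fromℕ s) ℚ.+ γ) ℚ.* δ

  qPoly : ℕ → ℚ → ℚ
  qPoly p k = basis 0 k ℚ.* weightProduct p k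

  fromℕ-double : ∀ n → fromℕ (2 ℕ.* n) ≡ fromℕ n ℚ.+ fromℕ n
  fromℕ-double n = trans (fromℕ-+ n (n ℕ.+ 0)) (cong (λ i → fromℕ n ℚ.+ fromℕ i) (ℕₚ.+-identityʳ n))

  fromℕ-2n+1 : ∀ n → fromℕ (2 ℕ.* n ℕ.+ 1) ≡ fromℕ n ℚ.+ fromℕ n ℚ.+ 1ℚ
  fromℕ-2n+1 n = trans (fromℕ-+ (2 ℕ.* n) 1) (cong (ℚ._+ 1ℚ) (fromℕ-double n))

  binom≡qPoly : ∀ p k → binom (2 ℕ.* k ℕ.+ 1 ℕ.+ p) (2 ℕ.* p ℕ.+ 1) ≡ qPoly p (fromℕ k)
  binom≡qPoly zero k = begin
    binom (2 ℕ.* k ℕ.+ 1 ℕ.+ 0) 1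
      ≡⟨ ℚₚ.*-identityˡ (binom (2 ℕ.* k ℕ.+ 1 ℕ.+ 0) 1) ⟨
    1ℚ ℚ.* binom (2 ℕ.* k ℕ.+ 1 ℕ.+ 0) 1
      ≡⟨ binom-sucʳ (2 ℕ.* k ℕ.+ 1 ℕ.+ 0) 0 ⟩
    (fromℕ (2 ℕ.* k ℕ.+ 1 ℕ.+ 0) ℚ.- 0ℚ) ℚ.* 1ℚ
      ≡⟨ cong (λ z → (z ℚ.- 0ℚ) ℚ.* 1ℚ) (trans (cong fromℕ (ℕₚ.+-identityʳ (2 ℕ.* k ℕ.+ 1))) (fromℕ-2n+1 k)) ⟩
    (fromℕ k ℚ.+ fromℕ k ℚ.+ 1ℚ ℚ.- 0ℚ) ℚ.* 1ℚ
      ≡⟨ solve 1 (λ x → (x :- con 0ℚ) :* con 1ℚ := x :* con 1ℚ :* con 1ℚ) refl (fromℕ k ℚ.+ fromℕ k ℚ.+ 1ℚ) ⟩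
    qPoly 0 (fromℕ k)
      ∎
  binom≡qPoly (suc p) k = *-cancelˡ-≢0 (denominator≢0 p) (begin
    D ℚ.* binom (2 ℕ.* k ℕ.+ 1 ℕ.+ suc p) (2 ℕ.* suc p ℕ.+ 1)
      ≡⟨ cong₂ (λ n i → D ℚ.* binom n i) (ℕₚ.+-suc (2 ℕ.* k ℕ.+ 1) p)
           (ℕ-Solver.solve 1 (λ p → ℕ-Solver.con 2 ℕ-Solver.:* (ℕ-Solver.con 1 ℕ-Solver.:+ p) ℕ-Solver.:+
               ℕ-Solver.con 1
              ℕ-Solver.:= ℕ-Solver.con 2 ℕ-Solver.:+
                  (ℕ-Solver.con 2 ℕ-Solver.:* p ℕ-Solver.:+ ℕ-Solver.con 1)) refl p) ⟩
    D ℚ.* binom (suc N) (suc (suc K))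
      ≡⟨ cong (ℚ._* binom (suc N) (suc (suc K))) (fromℕ-* (suc (suc K)) (suc K)) ⟩
    fromℕ (suc (suc K)) ℚ.* fromℕ (suc K) ℚ.* binom (suc N) (suc (suc K))
      ≡⟨ solve 3 (λ a b c → a :* b :* c := b :* (a :* c)) refl (fromℕ (suc (suc K))) (fromℕ (suc K))
          (binom (suc N) (suc (suc K))) ⟩
    fromℕ (suc K) ℚ.* (fromℕ (suc (suc K)) ℚ.* binom (suc N) (suc (suc K)))
      ≡⟨ cong (fromℕ (suc K) ℚ.*_) (binom-suc-suc N (suc K)) ⟩
    fromℕ (suc K) ℚ.* (fromℕ (suc N) ℚ.* binom N (suc K))
      ≡⟨ solve 3 (λ a b c → a :* (b :* c) := b :* (a :* c)) refl (fromℕ (suc K)) (fromℕ (suc N))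
          (binom N (suc K)) ⟩
    fromℕ (suc N) ℚ.* (fromℕ (suc K) ℚ.* binom N (suc K))
      ≡⟨ cong (fromℕ (suc N) ℚ.*_) (binom-sucʳ N K) ⟩
    fromℕ (suc N) ℚ.* ((fromℕ N ℚ.- fromℕ K) ℚ.* binom N K)
      ≡⟨ cong₂ (λ y z → y ℚ.* z) (trans (fromℕ-suc N) (cong (1ℚ ℚ.+_) N≡))
          (cong₂ ℚ._*_ (cong₂ (λ y z → y ℚ.- z) N≡ (fromℕ-2n+1 p)) (binom≡qPoly p k)) ⟩
    (1ℚ ℚ.+ (k̂ ℚ.+ k̂ ℚ.+ 1ℚ ℚ.+ p̂)) ℚ.* ((k̂ ℚ.+ k̂ ℚ.+ 1ℚ ℚ.+ p̂ ℚ.- (p̂ ℚ.+ p̂ ℚ.+ 1ℚ)) ℚ.*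
        (basis 0 k̂ ℚ.* w))
      ≡⟨ solve 4 (λ k p a w → (con 1ℚ :+ (k :+ k :+ con 1ℚ :+ p)) :*
          ((k :+ k :+ con 1ℚ :+ p :- (p :+ p :+ con 1ℚ)) :* (a :* w)) :=
            con 1ℚ :* (a :* (w :* ((con 1ℚ :+ con 1ℚ :+ (con 1ℚ :+ con 1ℚ)) :* (k :* k :+ k) :+
                (con 1ℚ :- (con 1ℚ :+ p) :* (con 1ℚ :+ p)))))) refl k̂ p̂ (basis 0 k̂) w ⟩
    1ℚ ℚ.* (basis 0 k̂ ℚ.* (w ℚ.* X))
      ≡⟨ cong (ℚ._* (basis 0 k̂ ℚ.* (w ℚ.* X))) (recip-inverseʳ (denominator≢0 p)) ⟨
    D ℚ.* recip D ℚ.* (basis 0 k̂ ℚ.* (w ℚ.* X))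
      ≡⟨ solve 5 (λ D d a w x → D :* d :* (a :* (w :* x)) := D :* (a :* (w :* (x :* d)))) refl D (recip D)
          (basis 0 k̂) w X ⟩
    D ℚ.* qPoly (suc p) k̂
      ∎)
    where
    N = 2 ℕ.* k ℕ.+ 1 ℕ.+ p
    K = 2 ℕ.* p ℕ.+ 1
    D = fromℕ (denominator p)
    k̂ = fromℕ k
    p̂ = fromℕ p
    w = weightProduct p k̂
    X = (1ℚ ℚ.+ 1ℚ ℚ.+ (1ℚ ℚ.+ 1ℚ)) ℚ.* (k̂ ℚ.* k̂ ℚ.+ k̂) ℚ.+ (1ℚ ℚ.- (1ℚ ℚ.+ p̂) ℚ.* (1ℚ ℚ.+ p̂))
    N≡ : fromℕ N ≡ k̂ ℚ.+ k̂ ℚ.+ 1ℚ ℚ.+ p̂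
    N≡ = trans (fromℕ-+ (2 ℕ.* k ℕ.+ 1) p) (cong (ℚ._+ p̂) (fromℕ-2n+1 k))

  -- Induction on the number `d` of summands, removing the lowest one. For `d = 0` the lower end has
  -- reached j, and t(j) vanishes because of binom(2j-1, 2j) = 0.
  telescoped-sum : ∀ {a h} → Telescopes a h → ∀ d b j → d ℕ.+ b ≡ suc j →
    ∑< d (λ i → a (fromℕ (b ℕ.+ i)) ℚ.* binom (2 ℕ.* suc j ℕ.∸ 1) (suc j ℕ.+ (b ℕ.+ i)))
    ≡ binom (2 ℕ.* suc j ℕ.∸ 1) (suc j ℕ.+ b) ℚ.*
        ((fromℕ (suc j) ℚ.+ fromℕ b) ℚ.* h (fromℕ b) (fromℕ (suc j) ℚ.+ fromℕ b))
  telescoped-sum {a} {h} t zero b j refl = sym (trans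
    (cong (λ n → fromℕ n ℚ.* X) (k>n⇒nCk≡0 {2 ℕ.* suc j ℕ.∸ 1} {suc j ℕ.+ suc j}
      (s≤s (ℕₚ.≤-reflexive (cong (λ i → j ℕ.+ suc i) (ℕₚ.+-identityʳ j))))))
    (ℚₚ.*-zeroˡ X))
    where
    X = (fromℕ (suc j) ℚ.+ fromℕ (suc j)) ℚ.* h (fromℕ (suc j)) (fromℕ (suc j) ℚ.+ fromℕ (suc j))
  telescoped-sum {a} {h} t (suc d) b j eq = begin
    a (fromℕ (b ℕ.+ 0)) ℚ.* binom n (J ℕ.+ (b ℕ.+ 0)) ℚ.+ ∑< d (λ i → f (b ℕ.+ suc i))
      ≡⟨ cong₂ ℚ._+_ (cong f (ℕₚ.+-identityʳ b))
          (∑<-cong d {λ i → f (b ℕ.+ suc i)} {λ i → f (suc b ℕ.+ i)} (λ i → cong f (ℕₚ.+-suc b i))) ⟩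
    f b ℚ.+ ∑< d (λ i → f (suc b ℕ.+ i))
      ≡⟨ cong (f b ℚ.+_) (telescoped-sum {a} {h} t d (suc b) j (trans (ℕₚ.+-suc d b) eq)) ⟩
    f b ℚ.+ binom n (J ℕ.+ suc b) ℚ.* ((Ĵ ℚ.+ fromℕ (suc b)) ℚ.* h (fromℕ (suc b)) (Ĵ ℚ.+ fromℕ (suc b)))
      ≡⟨ cong₂ (λ i y → f b ℚ.+ binom n i ℚ.* ((Ĵ ℚ.+ y) ℚ.* h y (Ĵ ℚ.+ y))) (ℕₚ.+-suc J b)
          (trans (fromℕ-suc b) (ℚₚ.+-comm 1ℚ b̂)) ⟩
    f b ℚ.+ binom n (suc (J ℕ.+ b)) ℚ.* ((Ĵ ℚ.+ (b̂ ℚ.+ 1ℚ)) ℚ.* h (b̂ ℚ.+ 1ℚ) (Ĵ ℚ.+ (b̂ ℚ.+ 1ℚ)))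
      ≡⟨ cong (λ y → f b ℚ.+ binom n (suc (J ℕ.+ b)) ℚ.* (y ℚ.* h (b̂ ℚ.+ 1ℚ) y)) (sym (ℚₚ.+-assoc Ĵ b̂ 1ℚ)) ⟩
    f b ℚ.+ binom n (suc (J ℕ.+ b)) ℚ.* ((Ĵ ℚ.+ b̂ ℚ.+ 1ℚ) ℚ.* H′)
      ≡⟨ cong (λ y → f b ℚ.+ binom n (suc (J ℕ.+ b)) ℚ.* (y ℚ.* H′))
           (trans (ℚₚ.+-comm (Ĵ ℚ.+ b̂) 1ℚ) (trans (cong (1ℚ ℚ.+_) (sym (fromℕ-+ J b)))
               (sym (fromℕ-suc (J ℕ.+ b))))) ⟩
    f b ℚ.+ binom n (suc (J ℕ.+ b)) ℚ.* (fromℕ (suc (J ℕ.+ b)) ℚ.* H′)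
      ≡⟨ cong (f b ℚ.+_) (solve 3 (λ c m h → c :* (m :* h) := (m :* c) :* h) refl (binom n (suc (J ℕ.+ b)))
          (fromℕ (suc (J ℕ.+ b))) H′) ⟩
    f b ℚ.+ fromℕ (suc (J ℕ.+ b)) ℚ.* binom n (suc (J ℕ.+ b)) ℚ.* H′
      ≡⟨ cong (λ y → f b ℚ.+ y ℚ.* H′) (binom-sucʳ n (J ℕ.+ b)) ⟩
    a b̂ ℚ.* B ℚ.+ (fromℕ n ℚ.- fromℕ (J ℕ.+ b)) ℚ.* B ℚ.* H′
      ≡⟨ cong (λ y → a b̂ ℚ.* B ℚ.+ y ℚ.* B ℚ.* H′) (trans (cong₂ (λ y z → y ℚ.- z) n≡ (fromℕ-+ J b))
           (solve 2 (λ j b → (j :+ j :- con 1ℚ) :- (j :+ b) := j :- b :- con 1ℚ) refl Ĵ b̂)) ⟩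
    a b̂ ℚ.* B ℚ.+ (Ĵ ℚ.- b̂ ℚ.- 1ℚ) ℚ.* B ℚ.* H′
      ≡⟨ solve 4 (λ a B m h → a :* B :+ m :* B :* h := B :* (a :+ m :* h)) refl (a b̂) B (Ĵ ℚ.- b̂ ℚ.- 1ℚ)
          H′ ⟩
    B ℚ.* (a b̂ ℚ.+ (Ĵ ℚ.- b̂ ℚ.- 1ℚ) ℚ.* H′)
      ≡⟨ cong (B ℚ.*_) (t b̂ Ĵ) ⟨
    B ℚ.* ((Ĵ ℚ.+ b̂) ℚ.* h b̂ (Ĵ ℚ.+ b̂))
      ∎
    where
    J = suc j
    n = 2 ℕ.* J ℕ.∸ 1
    Ĵ = fromℕ J
    b̂ = fromℕ b
    B = binom n (J ℕ.+ b)
    H′ = h (b̂ ℚ.+ 1ℚ) (Ĵ ℚ.+ b̂ ℚ.+ 1ℚ)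
    f : ℕ → ℚ
    f k = a (fromℕ k) ℚ.* binom n (J ℕ.+ k)
    n≡ : fromℕ n ≡ Ĵ ℚ.+ Ĵ ℚ.- 1ℚ
    n≡ = trans (solve 1 (λ n → n := con 1ℚ :+ n :- con 1ℚ) refl (fromℕ n))
        (cong (ℚ._- 1ℚ) (trans (sym (fromℕ-suc n)) (fromℕ-double J)))

  -- The witness depends on p only; Q enters through its values at j > b, where binom(2j-1, j+b) is
  -- nonzero and can be cancelled. The factor x + b is that of the lower boundary term of the
  -- telescoping.
  Q-factorised : ∀ p Q → IsQ p Q → Σ[ cs ∈ Vec (List ℚ) (suc p) ]
    ∀ b x → evalℚ Q (fromℕ b ∷ x ∷ []) ≡ (x ℚ.+ fromℕ b) ℚ.* horner₂ cs (fromℕ b) (x ℚ.+ fromℕ b)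
  Q-factorised p Q isQ = cs , λ b → polynomial-unique
      {λ x → evalℚ Q (fromℕ b ∷ x ∷ [])} {λ x → (x ℚ.+ fromℕ b) ℚ.* horner₂ cs (fromℕ b) (x ℚ.+ fromℕ b)}
      (evalℚ-poly Q (fromℕ b))
      (*-poly {λ x → x ℚ.+ fromℕ b} {λ x → horner₂ cs (fromℕ b) (x ℚ.+ fromℕ b)}
        (+-poly {λ x → x} {λ _ → fromℕ b} id-poly (const-poly (fromℕ b))) (horner₂-poly cs (fromℕ b)))
      (suc b) (agree b)
    where
    summable : Summable p (qPoly p)
    summable = basis*weight-summable p 0 p (ℕₚ.+-identityʳ p)
    cs = proj₁ summable

    agree : ∀ b j → suc b ℕ.≤ j → evalℚ Q (fromℕ b ∷ fromℕ j ∷ []) ≡ (fromℕ j ℚ.+ fromℕ b) ℚ.* horner₂ cs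
        (fromℕ b) (fromℕ j ℚ.+ fromℕ b)
    agree b (suc j) b<j = *-cancelˡ-≢0 (binom≢0 n (suc j ℕ.+ b)
        (ℕₚ.≤-trans (s≤s (ℕₚ.+-monoʳ-≤ j (ℕₚ.≤-pred b<j)))
        (ℕₚ.≤-reflexive (trans (sym (ℕₚ.+-suc j j)) (cong (λ i → j ℕ.+ suc i) (sym (ℕₚ.+-identityʳ j)))))))
            (begin
      binom n (suc j ℕ.+ b) ℚ.* evalℚ Q (fromℕ b ∷ fromℕ (suc j) ∷ [])
        ≡⟨ isQ b (suc j) b<j ⟨
      ∑< (suc j ℕ.∸ b) (λ i → binom (2 ℕ.* (b ℕ.+ i) ℕ.+ 1 ℕ.+ p) (2 ℕ.* p ℕ.+ 1) ℚ.* binom n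
          (suc j ℕ.+ (b ℕ.+ i)))
        ≡⟨ ∑<-cong (suc j ℕ.∸ b) {λ i → binom (2 ℕ.* (b ℕ.+ i) ℕ.+ 1 ℕ.+ p) (2 ℕ.* p ℕ.+ 1) ℚ.* binom n
            (suc j ℕ.+ (b ℕ.+ i))}
             {λ i → qPoly p (fromℕ (b ℕ.+ i)) ℚ.* binom n (suc j ℕ.+ (b ℕ.+ i))}
             (λ i → cong (ℚ._* binom n (suc j ℕ.+ (b ℕ.+ i))) (binom≡qPoly p (b ℕ.+ i))) ⟩
      ∑< (suc j ℕ.∸ b) (λ i → qPoly p (fromℕ (b ℕ.+ i)) ℚ.* binom n (suc j ℕ.+ (b ℕ.+ i)))
        ≡⟨ telescoped-sum {qPoly p} {horner₂ cs} (proj₂ summable) (suc j ℕ.∸ b) b j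
            (ℕₚ.m∸n+n≡m (ℕₚ.<⇒≤ b<j)) ⟩
      binom n (suc j ℕ.+ b) ℚ.* ((fromℕ (suc j) ℚ.+ fromℕ b) ℚ.* horner₂ cs (fromℕ b)
          (fromℕ (suc j) ℚ.+ fromℕ b))
        ∎)
      where n = 2 ℕ.* suc j ℕ.∸ 1

-- The ring of power series

-- A record, unlike _≈_, lets the two series be inferred from the type.
infix 4 _≋_
record _≋_ (f g : FPS) : Set where
  constructor mk≋
  field coeffs : f ≈ g

open _≋_ public

infix 8 -_
-_ : FPS → FPS
- f = mkFPS (λ e → ℚ.- coeff f e) λ e → cong ℚ.-_ (stable f e)

FPS-commutativeRing : CommutativeRing 0ℓ 0ℓ
FPS-commutativeRing = record
  { Carrier = FPS ; _≈_ = _≋_ ; _+_ = _+_ ; _*_ = _*_ ; -_ = -_ ; 0# = const 0ℚ ; 1# = const 1ℚ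
  ; isCommutativeRing = record
    { isRing = record
      { +-isAbelianGroup = record
        { isGroup = record
          { isMonoid = record
            { isSemigroup = record
              { isMagma = record
                { isEquivalence = record
                  { refl = mk≋ λ _ → refl
                  ; sym = λ p → mk≋ λ e → sym (coeffs p e)
                  ; trans = λ p q → mk≋ λ e → trans (coeffs p e) (coeffs q e) }
                ; ∙-cong = λ p q → mk≋ λ e → cong₂ ℚ._+_ (coeffs p e) (coeffs q e) }
              ; assoc = λ f g h → mk≋ λ e → ℚₚ.+-assoc (coeff f e) (coeff g e) (coeff h e) }
            ; identity = (λ f → mk≋ λ e → trans (cong (ℚ._+ coeff f e) (constCoeff-0 e))
                (ℚₚ.+-identityˡ (coeff f e)))
                       , (λ f → mk≋ λ e → trans (cong (coeff f e ℚ.+_) (constCoeff-0 e))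
                           (ℚₚ.+-identityʳ (coeff f e))) }
          ; inverse = (λ f → mk≋ λ e → trans (ℚₚ.+-inverseˡ (coeff f e)) (sym (constCoeff-0 e)))
                    , (λ f → mk≋ λ e → trans (ℚₚ.+-inverseʳ (coeff f e)) (sym (constCoeff-0 e)))
          ; ⁻¹-cong = λ p → mk≋ λ e → cong ℚ.-_ (coeffs p e) }
        ; comm = λ f g → mk≋ λ e → ℚₚ.+-comm (coeff f e) (coeff g e) }
      ; *-cong = λ {f} {f′} {g} {g′} p q → mk≋ λ e →
          conv-cong (coeff f) (coeff f′) (coeff g) (coeff g′) e λ d d′ _ _ _ → cong₂ ℚ._*_ (coeffs p d)
              (coeffs q d′)
      ; *-assoc = λ f g h → mk≋ (conv-assoc (coeff f) (coeff g) (coeff h))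
      ; *-identity = *-identityˡ
                   , (λ f → mk≋ λ e → trans (conv-comm (coeff f) (constCoeff 1ℚ) e)
                       (coeffs (*-identityˡ f) e))
      ; distrib = (λ f g h → mk≋ λ e → trans (conv-comm (coeff f) (coeff (g + h)) e)
                     (trans (coeffs (*-distribʳ-+ f g h) e)
                            (cong₂ ℚ._+_ (conv-comm (coeff g) (coeff f) e)
                                (conv-comm (coeff h) (coeff f) e))))
                , *-distribʳ-+ }
    ; *-comm = λ f g → mk≋ (conv-comm (coeff f) (coeff g)) } }
  where
  *-identityˡ : ∀ f → const 1ℚ * f ≋ f
  *-identityˡ f = mk≋ λ e → trans (conv-constˡ 1ℚ (coeff f) e) (ℚₚ.*-identityˡ (coeff f e))

  *-distribʳ-+ : ∀ f g h → (g + h) * f ≋ g * f + h * f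
  *-distribʳ-+ f g h = mk≋ (conv-distribʳ-+ (coeff g) (coeff h) (coeff f))

module FR = CommutativeRing FPS-commutativeRing
module ≋-Reasoning = Relation.Binary.Reasoning.Setoid FR.setoid

const-* : ∀ q f → const q * f ≋ q • f
const-* q f = mk≋ (conv-constˡ q (coeff f))

const-cong : ∀ {q s} → q ≡ s → const q ≋ const s
const-cong refl = FR.refl

constCoeff-+ : ∀ q s e → constCoeff (q ℚ.+ s) e ≡ constCoeff q e ℚ.+ constCoeff s e
constCoeff-+ q s []          = refl
constCoeff-+ q s (zero  ∷ e) = constCoeff-+ q s e
constCoeff-+ q s (suc _ ∷ e) = refl

constCoeff-* : ∀ q s e → constCoeff (q ℚ.* s) e ≡ q ℚ.* constCoeff s e
constCoeff-* q s []          = refl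
constCoeff-* q s (zero  ∷ e) = constCoeff-* q s e
constCoeff-* q s (suc _ ∷ e) = sym (ℚₚ.*-zeroʳ q)

constCoeff-neg : ∀ q e → constCoeff (ℚ.- q) e ≡ ℚ.- constCoeff q e
constCoeff-neg q []          = refl
constCoeff-neg q (zero  ∷ e) = constCoeff-neg q e
constCoeff-neg q (suc _ ∷ e) = refl

const-homo-+ : ∀ q s → const (q ℚ.+ s) ≋ const q + const s
const-homo-+ q s = mk≋ (constCoeff-+ q s)

const-homo-* : ∀ q s → const (q ℚ.* s) ≋ const q * const s
const-homo-* q s = FR.trans (mk≋ (constCoeff-* q s)) (FR.sym (const-* q (const s)))

const-morphism : CommutativeRing.rawRing ℚₚ.+-*-commutativeRing -Raw-AlmostCommutative⟶ fromCommutativeRing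
    FPS-commutativeRing
const-morphism = record
  { ⟦_⟧    = const
  ; +-homo = const-homo-+
  ; *-homo = const-homo-*
  ; -‿homo = λ q → mk≋ (constCoeff-neg q)
  ; 0-homo = FR.refl
  ; 1-homo = FR.refl
  }

module FPS-Solver = RingSolver (CommutativeRing.rawRing ℚₚ.+-*-commutativeRing)
  (fromCommutativeRing FPS-commutativeRing) const-morphism
  (λ q s → Maybe.map const-cong (dec⇒maybe (q ℚₚ.≟ s)))

-- On nonempty lists `∂` and `*` compute and `∂` preserves the length; the empty list is covered by
-- stability, being equivalent to `0 ∷ []`.
≋-by-cons : ∀ {f g} → (∀ n e → coeff f (n ∷ e) ≡ coeff g (n ∷ e)) → f ≋ g
≋-by-cons {f} {g} p = mk≋ λ where
  []      → trans (sym (stable f [])) (trans (p 0 []) (stable g []))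
  (n ∷ e) → p n e

-- Partial differentiation

∂-cong : ∀ {f g} → f ≋ g → ∂ f ≋ ∂ g
∂-cong p = ≋-by-cons λ n e → cong (fromℕ (suc n) ℚ.*_) (coeffs p (suc n ∷ e))

∂-+ : ∀ f g → ∂ (f + g) ≋ ∂ f + ∂ g
∂-+ f g = ≋-by-cons λ n e → ℚₚ.*-distribˡ-+ (fromℕ (suc n)) (coeff f (suc n ∷ e)) (coeff g (suc n ∷ e))

∂-* : ∀ f g → ∂ (f * g) ≋ ∂ f * g + f * ∂ g
∂-* f g = ≋-by-cons λ n e → trans
  (Δ-leibniz n λ a b → conv (coeff f ▹ a) (coeff g ▹ b) e)
  (cong₂ ℚ._+_
    (Δ-cong n {λ a b → fromℕ (suc a) ℚ.* conv (coeff f ▹ (suc a)) (coeff g ▹ b) e}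
              {λ a b → conv (coeff (∂ f) ▹ a) (coeff g ▹ b) e}
      λ a b _ → sym (conv-*ˡ (fromℕ (suc a)) (coeff f ▹ (suc a)) (coeff g ▹ b) e))
    (Δ-cong n {λ a b → fromℕ (suc b) ℚ.* conv (coeff f ▹ a) (coeff g ▹ (suc b)) e}
              {λ a b → conv (coeff f ▹ a) (coeff (∂ g) ▹ b) e}
      λ a b _ → sym (conv-*ʳ (fromℕ (suc b)) (coeff f ▹ a) (coeff g ▹ (suc b)) e)))

∂-const : ∀ q → ∂ (const q) ≋ const 0ℚ
∂-const q = ≋-by-cons λ where
  zero    e → trans (ℚₚ.*-zeroʳ (fromℕ 1)) (sym (constCoeff-0 e))
  (suc n) e → ℚₚ.*-zeroʳ (fromℕ (suc (suc n)))

∂-const* : ∀ q f → ∂ (const q * f) ≋ const q * ∂ f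
∂-const* q f = begin
  ∂ (const q * f)                    ≈⟨ ∂-* (const q) f ⟩
  ∂ (const q) * f + const q * ∂ f    ≈⟨ FR.+-congʳ (FR.*-congʳ (∂-const q)) ⟩
  const 0ℚ * f + const q * ∂ f       ≈⟨ solve 3 (λ q f f′ → con 0ℚ :* f :+ q :* f′ := q :* f′) FR.refl
      (const q) f (∂ f) ⟩
  const q * ∂ f                      ∎
  where
  open FPS-Solver using (solve; con; _:=_; _:+_; _:*_)
  open ≋-Reasoning

∂-var₀ : ∂ (var 0) ≋ const 1ℚ
∂-var₀ = ≋-by-cons λ where
  zero    e → ℚₚ.*-identityˡ (constCoeff 1ℚ e)
  (suc n) e → ℚₚ.*-zeroʳ (fromℕ (suc (suc n)))

∂-varₛ : ∀ i → ∂ (var (suc i)) ≋ const 0ℚ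
∂-varₛ i = ≋-by-cons λ where
  zero    e → trans (ℚₚ.*-zeroʳ (fromℕ 1)) (sym (constCoeff-0 e))
  (suc n) e → ℚₚ.*-zeroʳ (fromℕ (suc (suc n)))

-- Multiplicative inverses

stable-sum0 : ∀ {f} → Stable f → ∀ e → ℕL.sum e ≡ 0 → f e ≡ f []
stable-sum0 p []         _ = refl
stable-sum0 p (zero ∷ e) s = trans (stable-sum0 (λ d → p (0 ∷ d)) e s) (p [])

-- In each product contributing to u · uⁿ, either the exponent of the first factor is zero, where u
-- vanishes, or it uses up some degree and too little is left for uⁿ.
^-order : ∀ u → constantTerm u ≡ 0ℚ → ∀ n e → ℕL.sum e ℕ.< n → coeff (u ^ n) e ≡ 0ℚ
^-order u u₀≡0 (suc n) e (s≤s sum-e≤n) = trans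
  (conv-cong (coeff u) (λ _ → 0ℚ) (coeff (u ^ n)) (coeff (u ^ n)) e λ d d′ _ _ s → trans (term d d′ s)
      (sym (ℚₚ.*-zeroˡ (coeff (u ^ n) d′))))
  (conv-vanish (λ _ → 0ℚ) (coeff (u ^ n)) e (λ _ _ → refl))
  where
  term : ∀ d d′ → ℕL.sum d ℕ.+ ℕL.sum d′ ≡ ℕL.sum e → coeff u d ℚ.* coeff (u ^ n) d′ ≡ 0ℚ
  term d d′ s with ℕL.sum d in eq
  ... | zero  = trans (cong (ℚ._* coeff (u ^ n) d′) (trans (stable-sum0 (stable u) d eq) u₀≡0))
      (ℚₚ.*-zeroˡ (coeff (u ^ n) d′))
  ... | suc k = trans (cong (coeff u d ℚ.*_) (^-order u u₀≡0 n d′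
      (ℕₚ.<-≤-trans (ℕₚ.≤-trans (s≤s (ℕₚ.m≤n+m (ℕL.sum d′) k)) (ℕₚ.≤-reflexive s)) sum-e≤n)))
                      (ℚₚ.*-zeroʳ (coeff u d))

geometric : FPS → List ℕ → ℚ
geometric u e = ∑< (suc (ℕL.sum e)) (λ n → coeff (u ^ n) e)

-- `geometric` stops at a point that depends on `e`; a common cut-off is needed before the sum can
-- be pulled out of a convolution.
geometric-truncate : ∀ u → constantTerm u ≡ 0ℚ → ∀ N e → ℕL.sum e ℕ.< N → geometric u e ≡ ∑< N
    (λ n → coeff (u ^ n) e)
geometric-truncate u u₀≡0 N e lt = ∑<-indep (suc (ℕL.sum e)) N (λ n → coeff (u ^ n) e)
  (λ n → ^-order u u₀≡0 n e) (λ n N≤n → ^-order u u₀≡0 n e (ℕₚ.<-≤-trans lt N≤n))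

geometric-unfold : ∀ u → constantTerm u ≡ 0ℚ → ∀ e → geometric u e ≡ constCoeff 1ℚ e ℚ.+ conv (coeff u)
    (geometric u) e
geometric-unfold u u₀≡0 e = begin
  geometric u e
    ≡⟨ geometric-truncate u u₀≡0 (suc N) e (ℕₚ.m≤n⇒m≤1+n ℕₚ.≤-refl) ⟩
  constCoeff 1ℚ e ℚ.+ ∑< N (λ n → conv (coeff u) (coeff (u ^ n)) e)
    ≡⟨ cong (constCoeff 1ℚ e ℚ.+_) (conv-∑ʳ N (coeff u) (λ n → coeff (u ^ n)) e) ⟨
  constCoeff 1ℚ e ℚ.+ conv (coeff u) (λ d → ∑< N (λ n → coeff (u ^ n) d)) e
    ≡⟨ cong (constCoeff 1ℚ e ℚ.+_) (conv-cong (coeff u) (coeff u) (λ d → ∑< N (λ n → coeff (u ^ n) d))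
        (geometric u) e
         λ d d′ _ _ s → cong (coeff u d ℚ.*_) (sym (geometric-truncate u u₀≡0 N d′
           (s≤s (ℕₚ.≤-trans (ℕₚ.m≤n+m (ℕL.sum d′) (ℕL.sum d)) (ℕₚ.≤-reflexive s)))))) ⟩
  constCoeff 1ℚ e ℚ.+ conv (coeff u) (geometric u) e
    ∎
  where
  open ≡-Reasoning
  N = suc (ℕL.sum e)

-- Write f = c(1 - u), and let g be the geometric series in u, so that g = 1 + u g. Then f c⁻¹ g = g
-- - u g = 1.
⁻¹-inverseʳ : ∀ f → constantTerm f ≢ 0ℚ → f * f ⁻¹ ≋ const 1ℚ
⁻¹-inverseʳ f c≢0 = mk≋ λ e → begin
  conv (coeff f) (λ d → c⁻¹ ℚ.* geometric u d) e
    ≡⟨ conv-*ʳ c⁻¹ (coeff f) (geometric u) e ⟩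
  c⁻¹ ℚ.* conv (coeff f) (geometric u) e
    ≡⟨ cong (c⁻¹ ℚ.*_) (begin
         conv (coeff f) (geometric u) e
           ≡⟨ conv-congˡ {coeff f} {λ d → c ℚ.* (constCoeff 1ℚ d ℚ.+ (ℚ.- 1ℚ) ℚ.* coeff u d)} {geometric u} e
               (λ d _ → f≡ d) ⟩
         conv (λ d → c ℚ.* (constCoeff 1ℚ d ℚ.+ (ℚ.- 1ℚ) ℚ.* coeff u d)) (geometric u) e
           ≡⟨ conv-*ˡ c (λ d → constCoeff 1ℚ d ℚ.+ (ℚ.- 1ℚ) ℚ.* coeff u d) (geometric u) e ⟩
         c ℚ.* conv (λ d → constCoeff 1ℚ d ℚ.+ (ℚ.- 1ℚ) ℚ.* coeff u d) (geometric u) e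
           ≡⟨ cong (c ℚ.*_) (conv-distribʳ-+ (constCoeff 1ℚ) (λ d → (ℚ.- 1ℚ) ℚ.* coeff u d) (geometric u) e) ⟩
         c ℚ.* (conv (constCoeff 1ℚ) (geometric u) e ℚ.+ conv (λ d → (ℚ.- 1ℚ) ℚ.* coeff u d) (geometric u) e)
           ≡⟨ cong (c ℚ.*_) (cong₂ ℚ._+_ (trans (conv-constˡ 1ℚ (geometric u) e)
               (cong (1ℚ ℚ.*_) (geometric-unfold u u₀≡0 e)))
                                         (conv-*ˡ (ℚ.- 1ℚ) (coeff u) (geometric u) e)) ⟩
         c ℚ.* (1ℚ ℚ.* (constCoeff 1ℚ e ℚ.+ conv (coeff u) (geometric u) e) ℚ.+ (ℚ.- 1ℚ) ℚ.* conv (coeff u)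
             (geometric u) e)
           ∎) ⟩
  c⁻¹ ℚ.* (c ℚ.* (1ℚ ℚ.* (constCoeff 1ℚ e ℚ.+ conv (coeff u) (geometric u) e) ℚ.+ (ℚ.- 1ℚ) ℚ.* conv (coeff u)
      (geometric u) e))
    ≡⟨ solve 4 (λ c⁻¹ c k v → c⁻¹ :* (c :* (con 1ℚ :* (k :+ v) :+ con (ℚ.- 1ℚ) :* v)) := (c :* c⁻¹) :* k) refl
         c⁻¹ c (constCoeff 1ℚ e) (conv (coeff u) (geometric u) e) ⟩
  (c ℚ.* c⁻¹) ℚ.* constCoeff 1ℚ e
    ≡⟨ trans (cong (ℚ._* constCoeff 1ℚ e) cc⁻¹≡1) (ℚₚ.*-identityˡ (constCoeff 1ℚ e)) ⟩
  constCoeff 1ℚ e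
    ∎
  where
  open ≡-Reasoning
  open +-*-Solver using (solve; con; _:=_; _:+_; _:*_; _:-_)
  c   = constantTerm f
  c⁻¹ = recip c
  u   = const 1ℚ - c⁻¹ • f

  cc⁻¹≡1 : c ℚ.* c⁻¹ ≡ 1ℚ
  cc⁻¹≡1 = recip-inverseʳ c≢0

  u₀≡0 : constantTerm u ≡ 0ℚ
  u₀≡0 = cong (λ t → 1ℚ ℚ.- t) (trans (ℚₚ.*-comm c⁻¹ c) cc⁻¹≡1)

  f≡ : ∀ d → coeff f d ≡ c ℚ.* (constCoeff 1ℚ d ℚ.+ (ℚ.- 1ℚ) ℚ.* coeff u d)
  f≡ d = sym (trans
    (solve 4 (λ c c⁻¹ k f → c :* (k :+ con (ℚ.- 1ℚ) :* (k :- c⁻¹ :* f)) := (c :* c⁻¹) :* f) refl c c⁻¹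
        (constCoeff 1ℚ d) (coeff f d))
    (trans (cong (ℚ._* coeff f d) cc⁻¹≡1) (ℚₚ.*-identityˡ (coeff f d))))

-- Substitution into Laurent series

open FPS-Solver using (solve; con; _:=_; _:+_; _:*_)

|ᵣ₌-vanish : ∀ F S e m → bound F (length e) ℕ.< ∣ m ∣ → coeff (at F m * S ^ᶻ m) e ≡ 0ℚ
|ᵣ₌-vanish F S e m lt = conv-vanish (coeff (at F m)) (coeff (S ^ᶻ m)) e λ d eq →
  vanish F m d (subst (λ n → bound F n ℕ.< ∣ m ∣) (sym eq) lt)

|ᵣ₌-truncate : ∀ F S N e → bound F (length e) ℕ.≤ N → coeff (F |ᵣ₌ S) e ≡ ∑± N
    (λ m → coeff (at F m * S ^ᶻ m) e)
|ᵣ₌-truncate F S N e le = ∑±-indep (bound F (length e)) N (λ m → coeff (at F m * S ^ᶻ m) e)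
  (|ᵣ₌-vanish F S e) (λ m lt → |ᵣ₌-vanish F S e m (ℕₚ.≤-<-trans le lt))

|ᵣ₌-cong : ∀ {F G} S → (∀ m → at F m ≋ at G m) → (F |ᵣ₌ S) ≋ (G |ᵣ₌ S)
|ᵣ₌-cong {F} {G} S F≋G = mk≋ λ e → let N = bound F (length e) ℕ.+ bound G (length e) in begin
  coeff (F |ᵣ₌ S) e                           ≡⟨ |ᵣ₌-truncate F S N e (ℕₚ.m≤m+n _ _) ⟩
  ∑± N (λ m → coeff (at F m * S ^ᶻ m) e)
      ≡⟨ ∑±-cong N {λ m → coeff (at F m * S ^ᶻ m) e} {λ m → coeff (at G m * S ^ᶻ m) e}
                                                   (λ m → coeffs (FR.*-congʳ {S ^ᶻ m} (F≋G m)) e) ⟩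
  ∑± N (λ m → coeff (at G m * S ^ᶻ m) e)      ≡⟨ |ᵣ₌-truncate G S N e (ℕₚ.m≤n+m _ _) ⟨
  coeff (G |ᵣ₌ S) e                           ∎
  where open ≡-Reasoning

|ᵣ₌-•-+ : ∀ q F G S → (q •ᴸ F +ᴸ G |ᵣ₌ S) ≋ const q * (F |ᵣ₌ S) + (G |ᵣ₌ S)
|ᵣ₌-•-+ q F G S = mk≋ λ e → let N = bound F (length e) ℕ.+ bound G (length e) in begin
  ∑± N (λ m → coeff ((q • at F m + at G m) * S ^ᶻ m) e)
    ≡⟨ ∑±-cong N {λ m → coeff ((q • at F m + at G m) * S ^ᶻ m) e}
        {λ m → q ℚ.* coeff (at F m * S ^ᶻ m) e ℚ.+ coeff (at G m * S ^ᶻ m) e} (λ m → trans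
         (conv-distribʳ-+ (coeff (q • at F m)) (coeff (at G m)) (coeff (S ^ᶻ m)) e)
         (cong (ℚ._+ coeff (at G m * S ^ᶻ m) e) (conv-*ˡ q (coeff (at F m)) (coeff (S ^ᶻ m)) e))) ⟩
  ∑± N (λ m → q ℚ.* coeff (at F m * S ^ᶻ m) e ℚ.+ coeff (at G m * S ^ᶻ m) e)
    ≡⟨ ∑±-+ N (λ m → q ℚ.* coeff (at F m * S ^ᶻ m) e) (λ m → coeff (at G m * S ^ᶻ m) e) ⟩
  ∑± N (λ m → q ℚ.* coeff (at F m * S ^ᶻ m) e) ℚ.+ ∑± N (λ m → coeff (at G m * S ^ᶻ m) e)
    ≡⟨ cong₂ ℚ._+_ (∑±-*ˡ N q (λ m → coeff (at F m * S ^ᶻ m) e)) (sym (|ᵣ₌-truncate G S N e (ℕₚ.m≤n+m _ _))) ⟩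
  q ℚ.* ∑± N (λ m → coeff (at F m * S ^ᶻ m) e) ℚ.+ coeff (G |ᵣ₌ S) e
    ≡⟨ cong (λ z → q ℚ.* z ℚ.+ coeff (G |ᵣ₌ S) e) (|ᵣ₌-truncate F S N e (ℕₚ.m≤m+n _ _)) ⟨
  q ℚ.* coeff (F |ᵣ₌ S) e ℚ.+ coeff (G |ᵣ₌ S) e
    ≡⟨ cong (ℚ._+ coeff (G |ᵣ₌ S) e) (coeffs (const-* q (F |ᵣ₌ S)) e) ⟨
  coeff (const q * (F |ᵣ₌ S) + (G |ᵣ₌ S)) e
    ∎
  where open ≡-Reasoning

-- The bound depends only on the length of the exponent list, and `conv` at `e` meets only lists as
-- long as `e`, so a single window serves all coefficients of the left factor.
|ᵣ₌-* : ∀ F S V e → coeff ((F |ᵣ₌ S) * V) e ≡ ∑± (bound F (length e)) (λ m → coeff (at F m * S ^ᶻ m * V) e)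
|ᵣ₌-* F S V e = trans
  (conv-congˡ {coeff (F |ᵣ₌ S)} {λ d → ∑± N (λ m → coeff (at F m * S ^ᶻ m) d)} {coeff V} e
    λ d l → cong (λ n → ∑± (bound F n) (λ m → coeff (at F m * S ^ᶻ m) d)) l)
  (conv-∑±ˡ N (λ m → coeff (at F m * S ^ᶻ m)) (coeff V) e)
  where
  N = bound F (length e)

-- Powers, shifts and the chain rule

-- The extra factor S avoids lowering the exponent, so one rule covers X = S with w = 1 and X = S⁻¹
-- with w = -1. It serves once more with S = X = ∂R.
power-rule : ∀ S X V w → S * ∂ X ≋ const w * (X * V) → ∀ k → S * ∂ (X ^ k) ≋ const (fromℕ k ℚ.* w) *
    (X ^ k * V)
power-rule S X V w p zero = begin
  S * ∂ (const 1ℚ)                      ≈⟨ FR.*-congˡ (∂-const 1ℚ) ⟩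
  S * const 0ℚ                          ≈⟨ solve 2 (λ S V → S :* con 0ℚ := con 0ℚ :* (con 1ℚ :* V)) FR.refl S
      V ⟩
  const 0ℚ * (const 1ℚ * V)             ≈⟨ FR.*-congʳ (const-cong (ℚₚ.*-zeroˡ w)) ⟨
  const (fromℕ 0 ℚ.* w) * (const 1ℚ * V) ∎
  where
  open ≋-Reasoning
power-rule S X V w p (suc k) = begin
  S * ∂ (X * X ^ k)
    ≈⟨ FR.*-congˡ (∂-* X (X ^ k)) ⟩
  S * (∂ X * X ^ k + X * ∂ (X ^ k))
    ≈⟨ solve 5 (λ S X X′ Y Y′ → S :* (X′ :* Y :+ X :* Y′) := (S :* X′) :* Y :+ X :* (S :* Y′)) FR.refl S X
        (∂ X) (X ^ k) (∂ (X ^ k)) ⟩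
  (S * ∂ X) * X ^ k + X * (S * ∂ (X ^ k))
    ≈⟨ FR.+-cong (FR.*-congʳ p) (FR.*-congˡ (power-rule S X V w p k)) ⟩
  (const w * (X * V)) * X ^ k + X * (const (fromℕ k ℚ.* w) * (X ^ k * V))
    ≈⟨ solve 5 (λ w kw X Y V → (w :* (X :* V)) :* Y :+ X :* (kw :* (Y :* V)) := (w :+ kw) :* (X :* Y :* V))
        FR.refl (const w) (const (fromℕ k ℚ.* w)) X (X ^ k) V ⟩
  (const w + const (fromℕ k ℚ.* w)) * (X * X ^ k * V)
    ≈⟨ FR.*-congʳ (const-homo-+ w (fromℕ k ℚ.* w)) ⟨
  const (w ℚ.+ fromℕ k ℚ.* w) * (X * X ^ k * V)
    ≈⟨ FR.*-congʳ (const-cong scale-suc) ⟩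
  const (fromℕ (suc k) ℚ.* w) * (X * X ^ k * V)
    ∎
  where
  open ≋-Reasoning
  module Q = +-*-Solver
  scale-suc : w ℚ.+ fromℕ k ℚ.* w ≡ fromℕ (suc k) ℚ.* w
  scale-suc = trans (Q.solve 2 (λ w n → w Q.:+ n Q.:* w Q.:= (Q.con 1ℚ Q.:+ n) Q.:* w) refl w (fromℕ k))
                     (cong (ℚ._* w) (sym (fromℕ-suc k)))

module _ (S : FPS) (inv : S * S ⁻¹ ≋ const 1ℚ) where

  ∂-⁻¹ : S * ∂ (S ⁻¹) ≋ const (ℚ.- 1ℚ) * (S ⁻¹ * ∂ S)
  ∂-⁻¹ = begin
    S * ∂ (S ⁻¹)
      ≈⟨ solve 4 (λ S T S′ T′ → S :* T′ := (S′ :* T :+ S :* T′) :+ con (ℚ.- 1ℚ) :* (T :* S′)) FR.refl S (S ⁻¹)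
          (∂ S) (∂ (S ⁻¹)) ⟩
    (∂ S * S ⁻¹ + S * ∂ (S ⁻¹)) + const (ℚ.- 1ℚ) * (S ⁻¹ * ∂ S)
      ≈⟨ FR.+-congʳ (FR.trans (FR.sym (∂-* S (S ⁻¹))) (FR.trans (∂-cong inv) (∂-const 1ℚ))) ⟩
    const 0ℚ + const (ℚ.- 1ℚ) * (S ⁻¹ * ∂ S)
      ≈⟨ FR.+-identityˡ _ ⟩
    const (ℚ.- 1ℚ) * (S ⁻¹ * ∂ S)
      ∎
    where
    open ≋-Reasoning

  ∂-^ᶻ : ∀ m → S * ∂ (S ^ᶻ m) ≋ const (fromℤ m) * (S ^ᶻ m * ∂ S)
  ∂-^ᶻ (+ n) = FR.trans
    (power-rule S S (∂ S) 1ℚ (FR.sym (FR.*-identityˡ (S * ∂ S))) n)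
    (FR.*-congʳ (const-cong (ℚₚ.*-identityʳ (fromℕ n))))
  ∂-^ᶻ -[1+ n ] = FR.trans
    (power-rule S (S ⁻¹) (∂ S) (ℚ.- 1ℚ) ∂-⁻¹ (suc n))
    (FR.*-congʳ (const-cong (trans (Q.solve 1 (λ n → n Q.:* Q.con (ℚ.- 1ℚ) Q.:= Q.:- n) refl (fromℕ (suc n)))
        refl)))
    where module Q = +-*-Solver

  ^ᶻ-suc : ∀ m → S ^ᶻ m ≋ S ^ᶻ ℤ.suc m * S ⁻¹
  ^ᶻ-suc (+ n) = begin
    S ^ n                   ≈⟨ FR.*-identityˡ (S ^ n) ⟨
    const 1ℚ * S ^ n        ≈⟨ FR.*-congʳ inv ⟨
    (S * S ⁻¹) * S ^ n      ≈⟨ solve 3 (λ S T Y → (S :* T) :* Y := S :* Y :* T) FR.refl S (S ⁻¹) (S ^ n) ⟩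
    S * S ^ n * S ⁻¹        ∎
    where
    open ≋-Reasoning
  ^ᶻ-suc -[1+ zero ]  = FR.*-comm (S ⁻¹) (const 1ℚ)
  ^ᶻ-suc -[1+ suc n ] = FR.*-comm (S ⁻¹) ((S ⁻¹) ^ suc n)

  -- `^ᶻ` is defined by cases on the sign, so the exponent is raised one unit at a time, and only
  -- the unit step meets the passage from negative to nonnegative.
  ^ᶻ-+ : ∀ m b → S ^ᶻ m ≋ S ^ᶻ (m ℤ.+ + b) * (S ⁻¹) ^ b
  ^ᶻ-+ m zero    = FR.trans (FR.reflexive (cong (S ^ᶻ_) (sym (ℤₚ.+-identityʳ m)))) (FR.sym (FR.*-identityʳ _))
  ^ᶻ-+ m (suc b) = begin
    S ^ᶻ m                                        ≈⟨ ^ᶻ-+ m b ⟩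
    S ^ᶻ (m ℤ.+ + b) * (S ⁻¹) ^ b                 ≈⟨ FR.*-congʳ (^ᶻ-suc (m ℤ.+ + b)) ⟩
    S ^ᶻ ℤ.suc (m ℤ.+ + b) * S ⁻¹ * (S ⁻¹) ^ b    ≈⟨ FR.*-assoc _ _ _ ⟩
    S ^ᶻ ℤ.suc (m ℤ.+ + b) * (S ⁻¹) ^ suc b       ≈⟨ FR.*-congʳ (FR.reflexive (cong (S ^ᶻ_) (+-suc-ℤ m b))) ⟨
    S ^ᶻ (m ℤ.+ + suc b) * (S ⁻¹) ^ suc b         ∎
    where open ≋-Reasoning

  |ᵣ₌-r^- : ∀ b F → ((r^- b · F) |ᵣ₌ S) ≋ (F |ᵣ₌ S) * (S ⁻¹) ^ b
  |ᵣ₌-r^- b F = mk≋ λ e → let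
      M = bound F (length e) ℕ.+ b
      N = bound F (length e)
      s = λ m → coeff (at F (m ℤ.+ + b) * S ^ᶻ m) e
      t = λ m → coeff (at F m * S ^ᶻ m * (S ⁻¹) ^ b) e
      s≡t : ∀ m → s m ≡ t (m ℤ.+ + b)
      s≡t = λ m → coeffs (FR.trans (FR.*-congˡ {at F (m ℤ.+ + b)} (^ᶻ-+ m b))
          (FR.sym (FR.*-assoc (at F (m ℤ.+ + b)) (S ^ᶻ (m ℤ.+ + b)) ((S ⁻¹) ^ b)))) e
    in begin
    ∑± M s                              ≡⟨ ∑±-cong M {s} {λ m → t (m ℤ.+ + b)} s≡t ⟩
    ∑± M (λ m → t (m ℤ.+ + b))          ≡⟨ ∑±-shift b M N t
                                             (λ m lt → trans (sym (s≡t m)) (|ᵣ₌-vanish (r^- b · F) S e m lt))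
                                             (λ m lt → conv-vanish (coeff (at F m * S ^ᶻ m))
                                                 (coeff ((S ⁻¹) ^ b)) e λ d l →
                                                |ᵣ₌-vanish F S d m
                                                    (subst (λ n → bound F n ℕ.< ∣ m ∣) (sym l) lt)) ⟩
    ∑± N t                              ≡⟨ |ᵣ₌-* F S ((S ⁻¹) ^ b) e ⟨
    coeff ((F |ᵣ₌ S) * (S ⁻¹) ^ b) e    ∎
    where open ≡-Reasoning

  -- Since `∂` kills the coefficients of F, it acts only on the powers of S, and S ∂(Sᵐ) = m Sᵐ ∂S
  -- produces the eigenvalue m of θ.
  chain-rule : ∀ F → (∀ m → ∂ (at F m) ≋ const 0ℚ) → S * ∂ (F |ᵣ₌ S) ≋ (r∂ᵣ F |ᵣ₌ S) * ∂ S
  chain-rule F free = FR.trans (FR.*-comm S (∂ (F |ᵣ₌ S)))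
      -- At `[]` the derivative would read a coefficient at a longer list, to which another
      -- summation window belongs.
      (≋-by-cons λ n e → let N = bound F (suc (length e)) in begin
    conv (coeff (∂ (F |ᵣ₌ S))) (coeff S) (n ∷ e)
      ≡⟨ conv-congˡ {coeff (∂ (F |ᵣ₌ S))} {λ d → ∑± N (λ m → coeff (∂ (at F m * S ^ᶻ m)) d)} {coeff S} (n ∷ e)
          (λ where
           (k ∷ d) l → trans (cong (λ i → fromℕ (suc k) ℚ.* ∑± (bound F i)
               (λ m → coeff (at F m * S ^ᶻ m) (suc k ∷ d))) l)
                             (sym (∑±-*ˡ N (fromℕ (suc k)) (λ m → coeff (at F m * S ^ᶻ m) (suc k ∷ d))))) ⟩
    conv (λ d → ∑± N (λ m → coeff (∂ (at F m * S ^ᶻ m)) d)) (coeff S) (n ∷ e)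
      ≡⟨ conv-∑±ˡ N (λ m → coeff (∂ (at F m * S ^ᶻ m))) (coeff S) (n ∷ e) ⟩
    ∑± N (λ m → coeff (∂ (at F m * S ^ᶻ m) * S) (n ∷ e))
      ≡⟨ ∑±-cong N {λ m → coeff (∂ (at F m * S ^ᶻ m) * S) (n ∷ e)}
          {λ m → coeff (fromℤ m • at F m * S ^ᶻ m * ∂ S) (n ∷ e)}
           (λ m → coeffs (term m) (n ∷ e)) ⟩
    ∑± N (λ m → coeff (fromℤ m • at F m * S ^ᶻ m * ∂ S) (n ∷ e))
      ≡⟨ |ᵣ₌-* (r∂ᵣ F) S (∂ S) (n ∷ e) ⟨
    coeff ((r∂ᵣ F |ᵣ₌ S) * ∂ S) (n ∷ e)
      ∎)
    where
    open ≡-Reasoning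
    term : ∀ m → ∂ (at F m * S ^ᶻ m) * S ≋ fromℤ m • at F m * S ^ᶻ m * ∂ S
    term m = ≋.begin
      ∂ (at F m * S ^ᶻ m) * S
        ≋.≈⟨ FR.*-congʳ (∂-* (at F m) (S ^ᶻ m)) ⟩
      (∂ (at F m) * S ^ᶻ m + at F m * ∂ (S ^ᶻ m)) * S
        ≋.≈⟨ FR.*-congʳ (FR.+-congʳ (FR.*-congʳ (free m))) ⟩
      (const 0ℚ * S ^ᶻ m + at F m * ∂ (S ^ᶻ m)) * S
        ≋.≈⟨ solve 4 (λ f Y Y′ S → (con 0ℚ :* Y :+ f :* Y′) :* S := f :* (S :* Y′)) FR.refl (at F m) (S ^ᶻ m)
            (∂ (S ^ᶻ m)) S ⟩
      at F m * (S * ∂ (S ^ᶻ m))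
        ≋.≈⟨ FR.*-congˡ (∂-^ᶻ m) ⟩
      at F m * (const (fromℤ m) * (S ^ᶻ m * ∂ S))
        ≋.≈⟨ solve 4 (λ f w Y S′ → f :* (w :* (Y :* S′)) := w :* f :* Y :* S′) FR.refl (at F m)
            (const (fromℤ m)) (S ^ᶻ m) (∂ S) ⟩
      const (fromℤ m) * at F m * S ^ᶻ m * ∂ S
        ≋.≈⟨ FR.*-congʳ (FR.*-congʳ (const-* (fromℤ m) (at F m))) ⟩
      fromℤ m • at F m * S ^ᶻ m * ∂ S
        ≋.∎
      where module ≋ = ≋-Reasoning

-- Differential polynomials

infixr 7 _⊙_
infixl 6 _⊕_

-- An element of Expr n d is homogeneous of degree d in R, ∂R, ..., ∂ⁿ⁻¹R, with
-- coefficients polynomial in b; i ⊙ t stands for ∂ⁱR · t.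
data Expr (n : ℕ) : ℕ → Set where
  one   : Expr n 0
  scale : ∀ {d} → List ℚ → Expr n d → Expr n d
  _⊙_   : ∀ {d} → Fin n → Expr n d → Expr n (suc d)
  _⊕_   : ∀ {d} → Expr n d → Expr n d → Expr n d

⟦_⟧ : ∀ {n d} → Expr n d → ℚ → FPS → FPS
⟦ one ⟧       b R = const 1ℚ
⟦ scale c t ⟧ b R = const (horner c b) * ⟦ t ⟧ b R
⟦ i ⊙ t ⟧     b R = ∂^ (toℕ i) R * ⟦ t ⟧ b R
⟦ s ⊕ t ⟧     b R = ⟦ s ⟧ b R + ⟦ t ⟧ b R

weaken : ∀ {n d} → Expr n d → Expr (suc n) d
weaken one         = one
weaken (scale c t) = scale c (weaken t)
weaken (i ⊙ t)     = Fin.inject₁ i ⊙ weaken t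
weaken (s ⊕ t)     = weaken s ⊕ weaken t

deriv : ∀ {n d} → Expr n d → Expr (suc n) d
-- `Expr` has no zero of its own; the empty coefficient list evaluates to 0 and keeps the degree.
deriv one         = scale [] one
deriv (scale c t) = scale c (deriv t)
deriv (i ⊙ t)     = suc i ⊙ weaken t ⊕ Fin.inject₁ i ⊙ deriv t
deriv (s ⊕ t)     = deriv s ⊕ deriv t

∂^-inject₁ : ∀ {n} (i : Fin n) R → ∂^ (toℕ (Fin.inject₁ i)) R ≋ ∂^ (toℕ i) R
∂^-inject₁ i R = FR.reflexive (cong (λ k → ∂^ k R) (Finₚ.toℕ-inject₁ i))

⟦weaken⟧ : ∀ {n d} (t : Expr n d) b R → ⟦ weaken t ⟧ b R ≋ ⟦ t ⟧ b R
⟦weaken⟧ one         b R = FR.refl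
⟦weaken⟧ (scale c t) b R = FR.*-congˡ (⟦weaken⟧ t b R)
⟦weaken⟧ (i ⊙ t)     b R = FR.*-cong (∂^-inject₁ i R) (⟦weaken⟧ t b R)
⟦weaken⟧ (s ⊕ t)     b R = FR.+-cong (⟦weaken⟧ s b R) (⟦weaken⟧ t b R)

⟦deriv⟧ : ∀ {n d} (t : Expr n d) b R → ⟦ deriv t ⟧ b R ≋ ∂ (⟦ t ⟧ b R)
⟦deriv⟧ one         b R = FR.trans (FR.*-identityʳ (const 0ℚ)) (FR.sym (∂-const 1ℚ))
⟦deriv⟧ (scale c t) b R = FR.trans (FR.*-congˡ (⟦deriv⟧ t b R)) (FR.sym (∂-const* (horner c b) (⟦ t ⟧ b R)))
⟦deriv⟧ (i ⊙ t)     b R = FR.trans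
  (FR.+-cong (FR.*-congˡ (⟦weaken⟧ t b R)) (FR.*-cong (∂^-inject₁ i R) (⟦deriv⟧ t b R)))
  (FR.sym (∂-* (∂^ (toℕ i) R) (⟦ t ⟧ b R)))
⟦deriv⟧ (s ⊕ t)     b R = FR.trans (FR.+-cong (⟦deriv⟧ s b R) (⟦deriv⟧ t b R))
    (FR.sym (∂-+ (⟦ s ⟧ b R) (⟦ t ⟧ b R)))

open Evaluation FPS-rawSemiring const using () renaming (power to powerFPS)

-- Differential polynomials as lists of terms

increment : ∀ {n} → Fin n → ℚ × Vec ℕ n → ℚ × Vec ℕ n
increment i (q , k) = q , Vec.updateAt k i suc

multiply : ∀ {n} → ℚ → ℚ × Vec ℕ n → ℚ × Vec ℕ n
multiply c (q , k) = c ℚ.* q , k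

-- Horner's scheme in variable `zero`, which stands for b. Its exponent does not count for
-- `HomogeneousInTail`, so the degree is unaffected.
scalePoly : ∀ {n} → List ℚ → Poly (suc n) → Poly (suc n)
scalePoly []       P = []
scalePoly (c ∷ cs) P = List.map (multiply c) P ++ List.map (increment zero) (scalePoly cs P)

toPoly : ∀ {n d} → Expr n d → Poly (suc n)
toPoly {n} one     = (1ℚ , Vec.replicate (suc n) 0) ∷ []
toPoly (scale c t) = scalePoly c (toPoly t)
toPoly (i ⊙ t)     = List.map (increment (suc i)) (toPoly t)
toPoly (s ⊕ t)     = toPoly s ++ toPoly t

power-0 : ∀ n (as : Vec FPS n) → powerFPS (Vec.replicate n 0) as ≋ const 1ℚ
power-0 zero    []       = FR.refl
power-0 (suc n) (a ∷ as) = FR.trans (FR.*-identityˡ _) (power-0 n as)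

power-increment : ∀ {n} i (k : Vec ℕ n) as → powerFPS (Vec.updateAt k i suc) as ≋ Vec.lookup as i * powerFPS k
    as
power-increment zero    (k ∷ ks) (a ∷ as) = FR.*-assoc a (a ^ k) (powerFPS ks as)
power-increment (suc i) (k ∷ ks) (a ∷ as) = FR.trans (FR.*-congˡ (power-increment i ks as))
  (solve 3 (λ x y z → x :* (y :* z) := y :* (x :* z)) FR.refl (a ^ k) (Vec.lookup as i) (powerFPS ks as))

eval-++ : ∀ {n} (P P′ : Poly n) as → evalFPS (P ++ P′) as ≋ evalFPS P as + evalFPS P′ as
eval-++ []            P′ as = FR.sym (FR.+-identityˡ _)
eval-++ ((q , k) ∷ P) P′ as = FR.trans (FR.+-congˡ (eval-++ P P′ as)) (FR.sym (FR.+-assoc _ _ _))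

eval-multiply : ∀ {n} c (P : Poly n) as → evalFPS (List.map (multiply c) P) as ≋ const c * evalFPS P as
eval-multiply c []            as = FR.sym (FR.zeroʳ (const c))
eval-multiply c ((q , k) ∷ P) as = FR.trans (FR.+-cong (FR.*-congʳ (const-homo-* c q)) (eval-multiply c P as))
  (solve 4 (λ c q y z → c :* q :* y :+ c :* z := c :* (q :* y :+ z)) FR.refl (const c) (const q)
      (powerFPS k as) (evalFPS P as))

eval-increment : ∀ {n} i (P : Poly n) as → evalFPS (List.map (increment i) P) as ≋ Vec.lookup as i * evalFPS P
    as
eval-increment i []            as = FR.sym (FR.zeroʳ (Vec.lookup as i))
eval-increment i ((q , k) ∷ P) as = FR.trans (FR.+-cong (FR.*-congˡ (power-increment i k as))
    (eval-increment i P as))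
  (solve 4 (λ x q y z → q :* (x :* y) :+ x :* z := x :* (q :* y :+ z)) FR.refl (Vec.lookup as i) (const q)
      (powerFPS k as) (evalFPS P as))

eval-scale : ∀ {n} c (P : Poly (suc n)) b as → evalFPS (scalePoly c P) (const b ∷ as) ≋ const (horner c b) *
    evalFPS P (const b ∷ as)
eval-scale []       P b as = FR.sym (FR.zeroˡ _)
eval-scale (c ∷ cs) P b as = begin
  evalFPS (List.map (multiply c) P ++ List.map (increment zero) (scalePoly cs P)) (const b ∷ as)
    ≈⟨ eval-++ (List.map (multiply c) P) (List.map (increment zero) (scalePoly cs P)) (const b ∷ as) ⟩
  evalFPS (List.map (multiply c) P) (const b ∷ as) + evalFPS (List.map (increment zero) (scalePoly cs P))
      (const b ∷ as)
    ≈⟨ FR.+-cong (eval-multiply c P (const b ∷ as))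
        (FR.trans (eval-increment zero (scalePoly cs P) (const b ∷ as)) (FR.*-congˡ (eval-scale cs P b as))) ⟩
  const c * E + const b * (const (horner cs b) * E)
    ≈⟨ solve 4 (λ c b h E → c :* E :+ b :* (h :* E) := (c :+ b :* h) :* E) FR.refl (const c) (const b)
        (const (horner cs b)) E ⟩
  (const c + const b * const (horner cs b)) * E
    ≈⟨ FR.*-congʳ (FR.trans (const-homo-+ c (b ℚ.* horner cs b))
        (FR.+-congˡ (const-homo-* b (horner cs b)))) ⟨
  const (horner (c ∷ cs) b) * E
    ∎
  where
  open ≋-Reasoning
  E = evalFPS P (const b ∷ as)

eval-toPoly : ∀ {n d} (t : Expr n d) b R → evalFPS (toPoly t) (const b ∷ derivatives n R) ≋ ⟦ t ⟧ b R
eval-toPoly {n} one     b R = FR.trans (FR.+-identityʳ _)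
    (FR.trans (FR.*-identityˡ _) (power-0 (suc n) (const b ∷ derivatives n R)))
eval-toPoly (scale c t) b R = FR.trans (eval-scale c (toPoly t) b _) (FR.*-congˡ (eval-toPoly t b R))
eval-toPoly {n} (i ⊙ t) b R = FR.trans (eval-increment (suc i) (toPoly t) (const b ∷ derivatives n R))
  (FR.*-cong (FR.reflexive (Vecₚ.lookup∘tabulate (λ i → ∂^ (toℕ i) R) i)) (eval-toPoly t b R))
eval-toPoly (s ⊕ t)     b R = FR.trans (eval-++ (toPoly s) (toPoly t) _)
    (FR.+-cong (eval-toPoly s b R) (eval-toPoly t b R))

sum-0 : ∀ n → Vec.sum (Vec.replicate n 0) ≡ 0
sum-0 zero    = refl
sum-0 (suc n) = sum-0 n

sum-increment : ∀ {n} i (k : Vec ℕ n) → Vec.sum (Vec.updateAt k i suc) ≡ suc (Vec.sum k)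
sum-increment zero    (k ∷ ks) = refl
sum-increment (suc i) (k ∷ ks) = trans (cong (k ℕ.+_) (sum-increment i ks)) (ℕₚ.+-suc k (Vec.sum ks))

scalePoly-homogeneous : ∀ {n d} c {P : Poly (suc n)} → HomogeneousInTail d P → HomogeneousInTail d
    (scalePoly c P)
scalePoly-homogeneous []       h = []
scalePoly-homogeneous (c ∷ cs) h = Allₚ.++⁺ (Allₚ.map⁺ (All.map id h))
  (Allₚ.map⁺ (All.map (λ {t} → shift t) (scalePoly-homogeneous cs h)))
  where
  shift : ∀ {n d} (t : ℚ × Vec ℕ (suc n)) → Vec.sum (Vec.tail (proj₂ t)) ≡ d → Vec.sum
      (Vec.tail (proj₂ (increment zero t))) ≡ d
  shift (q , k ∷ ks) eq = eq

toPoly-homogeneous : ∀ {n d} (t : Expr n d) → HomogeneousInTail d (toPoly t)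
toPoly-homogeneous {n} one     = sum-0 n ∷ []
toPoly-homogeneous (scale c t) = scalePoly-homogeneous c (toPoly-homogeneous t)
toPoly-homogeneous (i ⊙ t)     = Allₚ.map⁺ (All.map (λ {s} → shift i s) (toPoly-homogeneous t))
  where
  shift : ∀ {n d} i (t : ℚ × Vec ℕ (suc n)) → Vec.sum (Vec.tail (proj₂ t)) ≡ d → Vec.sum
      (Vec.tail (proj₂ (increment (suc i) t))) ≡ suc d
  shift i (q , k ∷ ks) eq = trans (sum-increment i ks) (cong suc eq)
toPoly-homogeneous (s ⊕ t)     = Allₚ.++⁺ (toPoly-homogeneous s) (toPoly-homogeneous t)

-- Unlike 2 * p, this reduces to suc (suc _) at suc p, as the degrees in T require.
double : ℕ → ℕ
double zero    = 0
double (suc p) = suc (suc (double p))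

derivPower : ∀ {n} k → Expr (suc (suc n)) k
derivPower zero    = one
derivPower (suc k) = suc zero ⊙ derivPower k

⟦derivPower⟧ : ∀ {n} k b R → ⟦ derivPower {n} k ⟧ b R ≋ ∂ R ^ k
⟦derivPower⟧ zero    b R = FR.refl
⟦derivPower⟧ (suc k) b R = FR.*-congˡ (⟦derivPower⟧ k b R)

-- With G = R T′ / (∂R)ᵐ and m = 2p+1, the last three summands come from
-- (R/∂R) ∂G = R ((∂R)² T′ + R ∂R ∂T′ - m R ∂²R T′) / (∂R)ᵐ⁺².
T : ∀ {p} → Vec (List ℚ) (suc p) → Expr (suc (suc p)) (double p)
T {zero}  (c ∷ [])  = scale c one
T {suc p} (c ∷ cs)  =
    scale c (derivPower (double (suc p)))
  ⊕ (suc zero ⊙ suc zero ⊙ weaken (T cs))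
  ⊕ (zero ⊙ suc zero ⊙ deriv (T cs))
  ⊕ scale (ℚ.- fromℕ (suc (double p)) ∷ []) (zero ⊙ suc (suc zero) ⊙ weaken (T cs))

-- Polynomials in θ under substitution

weight : (ℤ → ℚ) → Laurent → Laurent
weight w F = mkLaurent (λ m → w m • at F m) (bound F) λ m e lt →
  trans (cong (w m ℚ.*_) (vanish F m e lt)) (ℚₚ.*-zeroʳ (w m))

Free : Laurent → Set
Free F = ∀ m → ∂ (at F m) ≋ const 0ℚ

∂-•-zero : ∀ q {f} → ∂ f ≋ const 0ℚ → ∂ (q • f) ≋ const 0ℚ
∂-•-zero q {f} p = FR.trans (∂-cong (FR.sym (const-* q f)))
    (FR.trans (∂-const* q f) (FR.trans (FR.*-congˡ p) (FR.zeroʳ (const q))))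

|ᵣ₌-zero : ∀ F S → (∀ m → at F m ≋ const 0ℚ) → (F |ᵣ₌ S) ≋ const 0ℚ
|ᵣ₌-zero F S p = mk≋ λ e → trans
  (cong₂ ℚ._+_ (∑<-zero (suc (bound F (length e))) (λ i → coeff (at F (+ i) * S ^ᶻ (+ i)) e)
      (λ i → term (+ i) e))
               (∑<-zero (bound F (length e)) (λ i → coeff (at F -[1+ i ] * S ^ᶻ -[1+ i ]) e)
                   (λ i → term -[1+ i ] e)))
  (sym (constCoeff-0 e))
  where
  term : ∀ m e → coeff (at F m * S ^ᶻ m) e ≡ 0ℚ
  term m e = conv-vanish (coeff (at F m)) (coeff (S ^ᶻ m)) e λ d _ → trans (coeffs (p m) d) (constCoeff-0 d)

module _ (b : ℚ) (R : FPS) (inv : R * R ⁻¹ ≋ const 1ℚ) (F : Laurent) (free : Free F)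
         (Θ∂R : (r∂ᵣ F |ᵣ₌ R) * ∂ R ≋ R) where

  -- θ h(θ) F, where h has the coefficients `cs`. The outer factor m is the θ split off from Q;
  -- because of it the recursion starts from `Θ`, never from F|ᵣ₌R.
  W : ∀ {l} → Vec (List ℚ) l → Laurent
  W cs = weight (λ m → fromℤ m ℚ.* horner₂ cs b (fromℤ m)) F

  G : ∀ {l} → Vec (List ℚ) l → FPS
  G cs = W cs |ᵣ₌ R

  Θ : FPS
  Θ = r∂ᵣ F |ᵣ₌ R

  -- Horner's step θ(c + θh) = cθ + θ(θh): each further coefficient costs one more θ, to which the
  -- chain rule applies.
  G-∷ : ∀ {l} c (cs : Vec (List ℚ) l) → G (c ∷ cs) ≋ const (horner c b) * Θ + (r∂ᵣ (W cs) |ᵣ₌ R)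
  G-∷ c cs = FR.trans
    (|ᵣ₌-cong {W (c ∷ cs)} {horner c b •ᴸ r∂ᵣ F +ᴸ r∂ᵣ (W cs)} R λ m → mk≋ λ e → Q.solve 4
        (λ m c h f → m Q.:* (c Q.:+ m Q.:* h) Q.:* f Q.:= c Q.:* (m Q.:* f) Q.:+ m Q.:* (m Q.:* h Q.:* f))
        refl
        (fromℤ m) (horner c b) (horner₂ cs b (fromℤ m)) (coeff (at F m) e))
    (|ᵣ₌-•-+ (horner c b) (r∂ᵣ F) (r∂ᵣ (W cs)) R)
    where module Q = +-*-Solver

  G-[] : (r∂ᵣ (W []) |ᵣ₌ R) ≋ const 0ℚ
  G-[] = |ᵣ₌-zero (r∂ᵣ (W [])) R λ m → mk≋ λ e →
    trans (Q.solve 2 (λ m f → m Q.:* (m Q.:* Q.con 0ℚ Q.:* f) Q.:= Q.con 0ℚ) refl (fromℤ m)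
        (coeff (at F m) e)) (sym (constCoeff-0 e))
    where module Q = +-*-Solver

  -- Stated without denominators. Each step multiplies by (∂R)²: one factor for θ acting as (R/∂R)∂,
  -- one for differentiating a quotient by a power of ∂R.
  G≋T : ∀ {p} (cs : Vec (List ℚ) (suc p)) → G cs * ∂ R ^ suc (double p) ≋ R * ⟦ T cs ⟧ b R
  G≋T {zero} (c ∷ []) = begin
    G (c ∷ []) * (R′ * const 1ℚ)
      ≈⟨ FR.*-congʳ (FR.trans (G-∷ c []) (FR.+-congˡ G-[])) ⟩
    (const (horner c b) * Θ + const 0ℚ) * (R′ * const 1ℚ)
      ≈⟨ solve 3 (λ c Θ R′ → (c :* Θ :+ con 0ℚ) :* (R′ :* con 1ℚ) := (Θ :* R′) :* (c :* con 1ℚ)) FR.refl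
          (const (horner c b)) Θ R′ ⟩
    (Θ * R′) * (const (horner c b) * const 1ℚ)
      ≈⟨ FR.*-congʳ Θ∂R ⟩
    R * (const (horner c b) * const 1ℚ)
      ∎
    where
    open ≋-Reasoning
    R′ = ∂ R
  G≋T {suc p} (c ∷ cs) = begin
    G (c ∷ cs) * (R′ * (R′ * (R′ * Y)))
      ≈⟨ FR.*-congʳ (G-∷ c cs) ⟩
    (κ * Θ + X) * (R′ * (R′ * (R′ * Y)))
      ≈⟨ solve 5 (λ κ Θ X R′ Y → (κ :* Θ :+ X) :* (R′ :* (R′ :* (R′ :* Y)))
                  := (Θ :* R′) :* (κ :* (R′ :* (R′ :* Y))) :+ (X :* R′) :* (R′ :* (R′ :* Y))) FR.refl κ Θ X R′
                      Y ⟩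
    (Θ * R′) * (κ * (R′ * (R′ * Y))) + (X * R′) * (R′ * (R′ * Y))
      ≈⟨ FR.+-cong (FR.*-congʳ Θ∂R) (FR.*-congʳ
          (FR.sym (chain-rule R inv (W cs) λ m → ∂-•-zero (fromℤ m ℚ.* horner₂ cs b (fromℤ m)) (free m)))) ⟩
    R * (κ * (R′ * (R′ * Y))) + (R * G′) * (R′ * (R′ * Y))
      -- Completes `G′` to the derivative of the product of `G cs` and the odd power of ∂R, so that
      -- the induction hypothesis can be differentiated as it stands; the last term corrects for the
      -- derivative of that power.
      ≈⟨ FR.+-congˡ (solve 6 (λ R g G′ R′ Y Y′ → (R :* G′) :* (R′ :* (R′ :* Y))
           := R :* R′ :* (G′ :* (R′ :* Y) :+ g :* Y′) :+ con (ℚ.- 1ℚ) :* (R :* g :* (R′ :* Y′))) FR.refl R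
               (G cs) G′ R′ Y Y′) ⟩
    R * (κ * (R′ * (R′ * Y))) + (R * R′ * (G′ * (R′ * Y) + G cs * Y′) + const (ℚ.- 1ℚ) *
        (R * G cs * (R′ * Y′)))
      ≈⟨ FR.+-congˡ (FR.+-cong (FR.*-congˡ ∂G≋) (FR.*-congˡ (FR.*-congˡ Y′≋))) ⟩
    R * (κ * (R′ * (R′ * Y))) + (R * R′ * (R′ * t + R * t′) + const (ℚ.- 1ℚ) *
        (R * G cs * (const μ * (R′ * Y * R″))))
      ≈⟨ FR.+-congˡ (FR.+-congˡ (solve 5 (λ R g μ y R″ → con (ℚ.- 1ℚ) :* (R :* g :* (μ :* (y :* R″))) := con
          (ℚ.- 1ℚ) :* (R :* (μ :* R″)) :* (g :* y))
           FR.refl R (G cs) (const μ) (R′ * Y) R″)) ⟩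
    R * (κ * (R′ * (R′ * Y))) + (R * R′ * (R′ * t + R * t′) + const (ℚ.- 1ℚ) * (R * (const μ * R″)) *
        (G cs * (R′ * Y)))
      ≈⟨ FR.+-congˡ (FR.+-congˡ (FR.*-congˡ (G≋T cs))) ⟩
    R * (κ * (R′ * (R′ * Y))) + (R * R′ * (R′ * t + R * t′) + const (ℚ.- 1ℚ) * (R * (const μ * R″)) * (R * t))
      ≈⟨ solve 8 (λ R κ R′ Y t t′ μ R″ → R :* (κ :* (R′ :* (R′ :* Y))) :+
          (R :* R′ :* (R′ :* t :+ R :* t′) :+ con (ℚ.- 1ℚ) :* (R :* (μ :* R″)) :* (R :* t))
           := R :* (κ :* (R′ :* (R′ :* Y)) :+ R′ :* (R′ :* t) :+ R :* (R′ :* t′) :+ (con (ℚ.- 1ℚ) :* μ) :*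
               (R :* (R″ :* t)))) FR.refl R κ R′ Y t t′ (const μ) R″ ⟩
    R * (κ * (R′ * (R′ * Y)) + R′ * (R′ * t) + R * (R′ * t′) + (const (ℚ.- 1ℚ) * const μ) * (R * (R″ * t)))
      ≈⟨ FR.*-congˡ (FR.+-cong (FR.+-cong (FR.+-cong
           (FR.*-congˡ (⟦derivPower⟧ (double (suc p)) b R))
           (FR.*-congˡ (FR.*-congˡ (⟦weaken⟧ (T cs) b R))))
           (FR.*-congˡ (FR.*-congˡ (⟦deriv⟧ (T cs) b R))))
           (FR.*-cong (FR.trans (const-cong μ≡) (const-homo-* (ℚ.- 1ℚ) μ))
               (FR.*-congˡ (FR.*-congˡ (⟦weaken⟧ (T cs) b R))))) ⟨
    R * ⟦ T (c ∷ cs) ⟧ b R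
      ∎
    where
    open ≋-Reasoning
    module Q = +-*-Solver
    κ = const (horner c b)
    μ = fromℕ (suc (double p))
    R′ = ∂ R
    R″ = ∂ R′
    Y = R′ ^ double p
    Y′ = ∂ (R′ ^ suc (double p))
    X = r∂ᵣ (W cs) |ᵣ₌ R
    G′ = ∂ (G cs)
    t = ⟦ T cs ⟧ b R
    t′ = ∂ t

    ∂G≋ : G′ * (R′ * Y) + G cs * Y′ ≋ R′ * t + R * t′
    ∂G≋ = FR.trans (FR.sym (∂-* (G cs) (R′ * Y))) (FR.trans (∂-cong (G≋T cs)) (∂-* R t))

    Y′≋ : R′ * Y′ ≋ const μ * (R′ * Y * R″)
    Y′≋ = FR.trans (power-rule R′ R′ R″ 1ℚ (FR.sym (FR.*-identityˡ _)) (suc (double p)))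
                   (FR.*-congʳ (const-cong (ℚₚ.*-identityʳ μ)))

    μ≡ : horner (ℚ.- μ ∷ []) b ≡ ℚ.- 1ℚ ℚ.* μ
    μ≡ = Q.solve 2 (λ μ b → Q.:- μ Q.:+ b Q.:* Q.con 0ℚ Q.:= Q.con (ℚ.- 1ℚ) Q.:* μ) refl μ b

-- Independence of Z from x_b

Free-+ : ∀ F G → Free F → Free G → Free (F +ᴸ G)
Free-+ F G p q m = FR.trans (∂-+ (at F m) (at G m))
    (FR.trans (FR.+-cong (p m) (q m)) (FR.+-identityˡ (const 0ℚ)))

Free-- : ∀ F G → Free F → Free G → Free (F -ᴸ G)
Free-- F G p q = Free-+ F ((ℚ.- 1ℚ) •ᴸ G) p λ m → ∂-•-zero (ℚ.- 1ℚ) (q m)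

Free-monomial : ∀ q k → Free (monomial q k)
Free-monomial q k m with m ℤₚ.≟ k
... | yes _ = ∂-const q
... | no  _ = ∂-const 0ℚ

Free-∑ : ∀ n F → (∀ i → Free (F i)) → Free (∑ᴸ< n F)
Free-∑ zero    F p m = ∂-const 0ℚ
Free-∑ (suc n) F p = Free-+ (F 0) (∑ᴸ< n (F ∘ suc)) (p 0) (Free-∑ n (F ∘ suc) (p ∘ suc))

Free-indicator : ∀ b → Free (indicator b)
Free-indicator zero    m = Free-monomial 1ℚ (+ 1) m
Free-indicator (suc b) m = ∂-const 0ℚ

-- The condition 2b + 1 ≤ m means j = m - b > b, so the variable has positive index j - b and is not
-- y₀.
Free-infinitePart : ∀ b → Free (infinitePart b)
Free-infinitePart b -[1+ _ ] = ∂-const 0ℚ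
Free-infinitePart b (+ m) with b ℕ.+ suc b ℕₚ.≤? m
... | no  _  = ∂-const 0ℚ
... | yes le = ∂-•-zero (fromℕ ((2 ℕ.* (m ℕ.∸ b) ℕ.∸ 1) C ((m ℕ.∸ b) ℕ.+ b)))
    (positive (m ℕ.∸ b ℕ.∸ b) index>0)
  where
  index>0 : 0 ℕ.< m ℕ.∸ b ℕ.∸ b
  index>0 = ℕₚ.m<n⇒0<n∸m (ℕₚ.m+n≤o⇒m≤o∸n (suc b) (subst (ℕ._≤ m) (ℕₚ.+-suc b b) le))

  positive : ∀ i → 0 ℕ.< i → ∂ (var i) ≋ const 0ℚ
  positive (suc i) _ = ∂-varₛ i

Z-free : ∀ b → Free (Z b)
Z-free b = Free-- (indicator b -ᴸ S) (infinitePart b)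
  (Free-- (indicator b) S (Free-indicator b) (Free-∑ (suc b) summand λ ℓ → Free-monomial (c ℓ) (+ (b ℕ.∸ ℓ))))
  (Free-infinitePart b)
  where
  c : ℕ → ℚ
  c ℓ = (ℚ.- 1ℚ) ^ℚ (b ℕ.∸ ℓ) ℚ.* fromℕ ((b ℕ.+ ℓ) C (2 ℕ.* ℓ)) ℚ.* Cat ℓ
  summand : ℕ → Laurent
  summand ℓ = monomial (c ℓ) (+ (b ℕ.∸ ℓ))
  S = ∑ᴸ< (suc b) summand

-- Diagonal operators

-- Both b and θ act on the coefficient of rᵐ by a scalar depending on m alone, so evaluating Q at
-- operators reduces to evaluating it at numbers.
Diagonal : (Laurent → Laurent) → (ℤ → ℚ) → Set
Diagonal A w = ∀ F m e → coeff (at (A F) m) e ≡ w m ℚ.* coeff (at F m) e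

open RawSemiringDefs Operator-rawSemiring using () renaming (_^_ to _^ᴼ_)

Diagonal-^ : ∀ {A w} → Diagonal A w → ∀ k → Diagonal (A ^ᴼ k) (λ m → w m ^ℚ k)
Diagonal-^         p zero    F m e = sym (ℚₚ.*-identityˡ (coeff (at F m) e))
Diagonal-^ {A} {w} p (suc k) F m e = begin
  coeff (at (A ((A ^ᴼ k) F)) m) e               ≡⟨ p ((A ^ᴼ k) F) m e ⟩
  w m ℚ.* coeff (at ((A ^ᴼ k) F) m) e           ≡⟨ cong (w m ℚ.*_) (Diagonal-^ {A} {w} p k F m e) ⟩
  w m ℚ.* (w m ^ℚ k ℚ.* coeff (at F m) e)       ≡⟨ ℚₚ.*-assoc (w m) (w m ^ℚ k) (coeff (at F m) e) ⟨
  w m ℚ.* w m ^ℚ k ℚ.* coeff (at F m) e         ∎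
  where open ≡-Reasoning

Diagonal-evalOp : ∀ Q {A B u w} → Diagonal A u → Diagonal B w →
                  Diagonal (evalOp Q (A ∷ B ∷ [])) (λ m → evalℚ Q (u m ∷ w m ∷ []))
Diagonal-evalOp []                     _ _ F m e = trans (constCoeff-0 e)
    (sym (ℚₚ.*-zeroˡ (coeff (at F m) e)))
Diagonal-evalOp ((q , i ∷ k ∷ []) ∷ Q) {A} {B} {u} {w} p r F m e = begin
  q ℚ.* coeff (at ((A ^ᴼ i) ((B ^ᴼ k) F)) m) e ℚ.+ coeff (at (evalOp Q (A ∷ B ∷ []) F) m) e
    ≡⟨ cong₂ (λ y z → q ℚ.* y ℚ.+ z)
         (trans (Diagonal-^ {A} {u} p i ((B ^ᴼ k) F) m e)
             (cong (u m ^ℚ i ℚ.*_) (Diagonal-^ {B} {w} r k F m e)))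
         (Diagonal-evalOp Q {A} {B} {u} {w} p r F m e) ⟩
  q ℚ.* (u m ^ℚ i ℚ.* (w m ^ℚ k ℚ.* f)) ℚ.+ evalℚ Q (u m ∷ w m ∷ []) ℚ.* f
    ≡⟨ Q.solve 5 (λ q x y z f → q Q.:* (x Q.:* (y Q.:* f)) Q.:+ z Q.:* f Q.:=
        (q Q.:* (x Q.:* (y Q.:* Q.con 1ℚ)) Q.:+ z) Q.:* f) refl
         q (u m ^ℚ i) (w m ^ℚ k) (evalℚ Q (u m ∷ w m ∷ [])) f ⟩
  evalℚ ((q , i ∷ k ∷ []) ∷ Q) (u m ∷ w m ∷ []) ℚ.* f
    ∎
  where
  open ≡-Reasoning
  module Q = +-*-Solver
  f = coeff (at F m) e

*-nonZero : ∀ {q s} → q ≢ 0ℚ → s ≢ 0ℚ → q ℚ.* s ≢ 0ℚ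
*-nonZero {q} q≢0 s≢0 qs≡0 = s≢0 (*-cancelˡ-≢0 q≢0 (trans qs≡0 (sym (ℚₚ.*-zeroʳ q))))

constantTerm-^ : ∀ f → constantTerm f ≢ 0ℚ → ∀ k → constantTerm (f ^ k) ≢ 0ℚ
constantTerm-^ f f₀≢0 zero    = λ ()
constantTerm-^ f f₀≢0 (suc k) = *-nonZero f₀≢0 (constantTerm-^ f f₀≢0 k)

1⊖n+n≡1 : ∀ n → (1 ⊖ n) ℤ.+ + n ≡ + 1
1⊖n+n≡1 n = trans (cong (ℤ._+ + n) (sym (ℤₚ.m-n≡m⊖n 1 n)))
  (trans (ℤₚ.+-assoc (+ 1) (ℤ.- + n) (+ n)) (cong (λ i → + 1 ℤ.+ i) (ℤₚ.+-inverseˡ (+ n))))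

double≡2* : ∀ p → double p ≡ 2 ℕ.* p
double≡2* zero    = refl
double≡2* (suc p) = cong suc (trans (cong suc (double≡2* p)) (sym (ℕₚ.+-suc p (p ℕ.+ 0))))

-- The moments

module _ (p : ℕ) (Q : Poly 2) (isQ : IsQ p Q) where

  cs : Vec (List ℚ) (suc p)
  cs = proj₁ (Q-factorised p Q isQ)

  -- `G≋T` contributes one factor R and r⁻ᵇ contributes b factors R⁻¹, together R¹⁻ᵇ. The product Y
  -- Y⁻¹ = 1 is inserted to make the denominator-free `G≋T` applicable.
  moment≋ : ∀ b R → IsR b R →
            moment Q b R ≋ R ^ᶻ (1 ⊖ b) * (∂ R ^ suc (double p)) ⁻¹ * ⟦ T cs ⟧ (fromℕ b) R
  moment≋ b R (R₀≡1 , Z|R≈) = begin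
    moment Q b R
      ≈⟨ |ᵣ₌-cong {evalOp Q ((b̂ •ᴸ_) ∷ r∂ᵣ ∷ []) (r^- b · Z b)} {r^- b · Wb} R operator ⟩
    ((r^- b · Wb) |ᵣ₌ R)
      ≈⟨ |ᵣ₌-r^- R inv b Wb ⟩
    g * S ^ b
      ≈⟨ FR.*-congʳ (FR.trans (FR.sym (FR.*-identityʳ g)) (FR.*-congˡ (FR.sym Y-inv))) ⟩
    (g * (Y * Y ⁻¹)) * S ^ b
      ≈⟨ solve 4 (λ g Y Y⁻ s → (g :* (Y :* Y⁻)) :* s := (g :* Y) :* (Y⁻ :* s)) FR.refl g Y (Y ⁻¹) (S ^ b) ⟩
    (g * Y) * (Y ⁻¹ * S ^ b)
      ≈⟨ FR.*-congʳ (G≋T b̂ R inv (Z b) (Z-free b) Θ∂R cs) ⟩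
    (R * t) * (Y ⁻¹ * S ^ b)
      ≈⟨ solve 4 (λ R t Y⁻ s → (R :* t) :* (Y⁻ :* s) := (R :* con 1ℚ) :* s :* Y⁻ :* t) FR.refl R t (Y ⁻¹)
          (S ^ b) ⟩
    R ^ᶻ (+ 1) * S ^ b * Y ⁻¹ * t
      ≈⟨ FR.*-congʳ (FR.*-congʳ (FR.trans (^ᶻ-+ R inv (1 ⊖ b) b)
          (FR.*-congʳ (FR.reflexive (cong (R ^ᶻ_) (1⊖n+n≡1 b)))))) ⟨
    R ^ᶻ (1 ⊖ b) * Y ⁻¹ * t
      ∎
    where
    open ≋-Reasoning
    b̂ = fromℕ b
    S = R ⁻¹
    Y = ∂ R ^ suc (double p)
    t = ⟦ T cs ⟧ b̂ R

    inv : R * R ⁻¹ ≋ const 1ℚ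
    inv = ⁻¹-inverseʳ R λ R₀≡0 → contradiction (trans (sym R₀≡1) R₀≡0) λ ()

    Θ∂R : (r∂ᵣ (Z b) |ᵣ₌ R) * ∂ R ≋ R
    Θ∂R = FR.trans (FR.sym (chain-rule R inv (Z b) (Z-free b))) (FR.trans (FR.*-congˡ (FR.trans
      (∂-cong {Z b |ᵣ₌ R} {var 0} (mk≋ λ e → trans (Z|R≈ e) (cong (λ i → varCoeff i e) (ℕₚ.n∸n≡0 b))))
          ∂-var₀)) (FR.*-identityʳ R))

    Wb = W b̂ R inv (Z b) (Z-free b) Θ∂R cs
    g = Wb |ᵣ₌ R

    -- The constant terms of Θ and ∂R multiply to that of R, which is 1. So `⁻¹` below is a genuine
    -- inverse and not the default 0.
    ∂R₀≢0 : constantTerm (∂ R) ≢ 0ℚ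
    ∂R₀≢0 eq = contradiction (trans (sym R₀≡1) (trans (sym (coeffs Θ∂R []))
      (trans (cong (constantTerm (r∂ᵣ (Z b) |ᵣ₌ R) ℚ.*_) eq) (ℚₚ.*-zeroʳ (constantTerm (r∂ᵣ (Z b) |ᵣ₌ R))))))
          λ ()

    Y-inv : Y * Y ⁻¹ ≋ const 1ℚ
    Y-inv = ⁻¹-inverseʳ Y (constantTerm-^ (∂ R) ∂R₀≢0 (suc (double p)))

    -- The coefficient of rᵐ in r⁻ᵇZ is that of rᵐ⁺ᵇ in Z, so Q(b, m) becomes the weight of `Wb` at
    -- n = m + b.
    operator : ∀ m → at (evalOp Q ((b̂ •ᴸ_) ∷ r∂ᵣ ∷ []) (r^- b · Z b)) m ≋ at (r^- b · Wb) m
    operator m = mk≋ λ e → trans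
      (Diagonal-evalOp Q {b̂ •ᴸ_} {r∂ᵣ} {λ _ → b̂} {fromℤ} (λ _ _ _ → refl) (λ _ _ _ → refl) (r^- b · Z b) m
          e)
      (cong (ℚ._* coeff (at (Z b) (m ℤ.+ + b)) e) (trans (proj₂ (Q-factorised p Q isQ) b (fromℤ m))
        (cong (λ y → y ℚ.* horner₂ cs b̂ y) (sym (fromℤ-+ m (+ b))))))

  -- The sizes p + 2, 2p and 2p + 1 agree with those of `T` only propositionally. As variables tied
  -- by equations they are matched by `refl`, and no polynomial has to be transported.
  lemma9-indexed : ∀ n d k → suc (suc p) ≡ n → double p ≡ d → suc (double p) ≡ k →
    Σ[ T ∈ Poly (suc n) ]
      HomogeneousInTail d T ×
      ((b : ℕ) (R : FPS) → IsR b R →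
        moment Q b R ≈ R ^ᶻ (1 ⊖ b) * ((∂ R) ^ k) ⁻¹ * evalFPS T (const (fromℕ b) ∷ derivatives n R))
  lemma9-indexed _ _ _ refl refl refl = toPoly (T cs) , toPoly-homogeneous (T cs) , λ b R isR →
    coeffs (FR.trans (moment≋ b R isR) (FR.*-congˡ (FR.sym (eval-toPoly (T cs) (fromℕ b) R))))

lemma9 : (p : ℕ) (Q : Poly 2) → IsQ p Q →
    Σ[ T ∈ Poly (suc (p ℕ.+ 2)) ]
    HomogeneousInTail (2 ℕ.* p) T ×
    ((b : ℕ) (R : FPS) → IsR b R →
    moment Q b R ≈
    R ^ᶻ (1 ⊖ b) * ((∂ R) ^ (2 ℕ.* p ℕ.+ 1)) ⁻¹
    * evalFPS T (const (fromℕ b) ∷ derivatives (p ℕ.+ 2) R))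
lemma9 p Q isQ = lemma9-indexed p Q isQ (p ℕ.+ 2) (2 ℕ.* p) (2 ℕ.* p ℕ.+ 1)
  (ℕₚ.+-comm 2 p) (double≡2* p) (trans (cong suc (double≡2* p)) (ℕₚ.+-comm 1 (2 ℕ.* p)))
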